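{- Let $a,b,n$ be positive integers with $a>b$, and define \[ t_0(an,bn,q)'=\sum_{k=an-bn-\lfloor n/2\rfloor}^{an-bn}(-1)^kq^{k^2}\begin{bmatrix} an\\ k\end{bmatrix}_{q^2}\begin{bmatrix} 2an-2k\\ an-bn-k\end{bmatrix}. \] Then \[ t_0(an,bn,q)'\equiv(-1)^{an-bn}q^{(an-bn)^2}\begin{bmatrix} an\\ bn\end{bmatrix}_{q^2}\Big\{1-2(a-b)\big(1-\theta_n(q^{ -1})\big)\Big\}\pmod{\Phi_n(q)^2}, \] where \[ \theta_n(q)=\begin{cases} (-1)^m(1+q^m)q^{m(3m-1)/2}, &\text{if } n=3m,\\ (-1)^mq^{m(3m+1)/2}, &\text{if } n=3m+1,\\ (-1)^{m+1}q^{(m+1)(3m+2)/2}, &\text{if } n=3m+2.\end{cases} \]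
   Context: For integers $n,m$, the $q$-binomial coefficient is $\begin{bmatrix} n\\ m\end{bmatrix}_q=\begin{bmatrix} n\\ m\end{bmatrix}=\frac{(1-q^n)(1-q^{n-1})\cdots(1-q^{n-m+1})}{(1-q)(1-q^2)\cdots(1-q^m)}$ if $0\le m\le n$, and $0$ otherwise; $\begin{bmatrix} n\\ m\end{bmatrix}_{q^2}$ is the same with $q$ replaced by $q^2$. $\Phi_n(q)$ denotes the $n$-th cyclotomic polynomial. $\lfloor x\rfloor$ is the integer part of $x$. For rational functions (including Laurent polynomials) $A(q),B(q)$, $A\equiv B\pmod{\Phi_n(q)^2}$ means $A-B=\Phi_n(q)^2P(q)/Q(q)$ with $P,Q\in\mathbb{Z}[q]$ and $Q$ coprime to $\Phi_n(q)$. -}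

module Defs where

open import Data.Nat as ℕ using (ℕ; zero; suc; _∸_; _<_)
import Data.Bool
open import Data.Nat.DivMod using (_/_; _%_)
open import Data.Nat.Divisibility using (_∣?_)
open import Data.Integer as ℤ using (ℤ; +_; 0ℤ; 1ℤ)
open import Data.List using (List; []; _∷_; _++_; replicate; reverse; length; filter; foldr; map; upTo)
open import Data.List.Relation.Unary.All using (All)
open import Data.Product using (Σ; _×_)
open import Relation.Binary.PropositionalEquality using (_≡_; _≢_)

-- Polynomials in ℤ[q] as coefficient lists, lowest degree first.
-- (Trailing zeros allowed; equality is "difference has all coefficients 0".)

Poly : Set
Poly = List ℤ

infixl 6 _+ₚ_ _-ₚ_
infixl 7 _*ₚ_

_+ₚ_ : Poly → Poly → Poly
[] +ₚ r = r
(a ∷ p) +ₚ [] = a ∷ p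
(a ∷ p) +ₚ (b ∷ r) = (a ℤ.+ b) ∷ (p +ₚ r)

negₚ : Poly → Poly
negₚ = map (λ x → ℤ.- x)

_-ₚ_ : Poly → Poly → Poly
p -ₚ r = p +ₚ negₚ r

scaleₚ : ℤ → Poly → Poly
scaleₚ c = map (c ℤ.*_)

_*ₚ_ : Poly → Poly → Poly
[] *ₚ r = []
(a ∷ p) *ₚ r = scaleₚ a r +ₚ (0ℤ ∷ (p *ₚ r))

constₚ : ℤ → Poly
constₚ c = c ∷ []

mono : ℤ → ℕ → Poly
mono c e = replicate e 0ℤ ++ (c ∷ [])

oneₚ : Poly
oneₚ = constₚ 1ℤ

prodₚ : List Poly → Poly
prodₚ = foldr _*ₚ_ oneₚ

IsZeroₚ : Poly → Set
IsZeroₚ p = All (_≡ 0ℤ) p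

infix 4 _≈ₚ_
_≈ₚ_ : Poly → Poly → Set
p ≈ₚ r = IsZeroₚ (p -ₚ r)

-- Coprimality of two polynomials of ℤ[q] (i.e. gcd 1 in ℚ[q]):
-- a Bézout relation U·A + V·B = c with c a nonzero integer constant.
CoprimeP : Poly → Poly → Set
CoprimeP A B = Σ Poly λ U → Σ Poly λ V → Σ ℤ λ c → (c ≢ 0ℤ) × (U *ₚ A +ₚ V *ₚ B ≈ₚ constₚ c)

-- Exact division by a polynomial whose leading coefficient is ±1
-- (used only for cyclotomic polynomials, where all divisors are monic).

private
  dropZerosHigh : List ℤ → List ℤ
  dropZerosHigh [] = []
  dropZerosHigh (+ zero ∷ xs) = dropZerosHigh xs
  dropZerosHigh (x ∷ xs) = x ∷ xs

normₚ : Poly → Poly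
normₚ p = reverse (dropZerosHigh (reverse p))

private
  -- subtract c·d from the front of r (both high-degree first)
  subFront : ℤ → List ℤ → List ℤ → List ℤ
  subFront c [] r = r
  subFront c (d ∷ ds) [] = []
  subFront c (d ∷ ds) (x ∷ xs) = (x ℤ.- c ℤ.* d) ∷ subFront c ds xs

  -- long division, high-degree-first lists; l = leading coeff of divisor (±1)
  divLoop : ℕ → ℕ → ℤ → List ℤ → List ℤ → List ℤ
  divLoop zero k l d r = []
  divLoop (suc f) k l d [] = []
  divLoop (suc f) k l d (x ∷ xs) with length (x ∷ xs) ℕ.<ᵇ k
  ... | Data.Bool.true = []
  ... | Data.Bool.false =
        let c = x ℤ.* l in
        c ∷ divLoop f k l d (subFrontTail c d (x ∷ xs))
    where
    subFrontTail : ℤ → List ℤ → List ℤ → List ℤ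
    subFrontTail c d r with subFront c d r
    ... | [] = []
    ... | _ ∷ ys = ys

  lead : List ℤ → ℤ
  lead [] = 0ℤ
  lead (x ∷ _) = x

-- quotient of p by d (exact when d divides p and d has leading coefficient ±1)
divₚ : Poly → Poly → Poly
divₚ p d =
  let hp = reverse (normₚ p)
      hd = reverse (normₚ d)
  in reverse (divLoop (length hp) (length hd) (lead hd) hd hp)

-- Cyclotomic polynomials, via  q^n - 1 = ∏_{d ∣ n} Φ_d(q).

private
  cycFuel : ℕ → ℕ → Poly
  cycFuel zero n = oneₚ
  cycFuel (suc f) n =
    divₚ (mono 1ℤ n -ₚ oneₚ)
         (prodₚ (map (cycFuel f) (filter (_∣? n) (map suc (upTo (n ∸ 1))))))

Φ : ℕ → Poly
Φ n = cycFuel n n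

-- Rational functions in q as formal fractions num/den (den ≠ 0).

record Frac : Set where
  constructor _/ₚ_
  field
    num : Poly
    den : Poly
open Frac public

infixl 6 _+f_ _-f_
infixl 7 _*f_

_+f_ : Frac → Frac → Frac
(a /ₚ b) +f (c /ₚ d) = (a *ₚ d +ₚ c *ₚ b) /ₚ (b *ₚ d)

_-f_ : Frac → Frac → Frac
(a /ₚ b) -f (c /ₚ d) = (a *ₚ d -ₚ c *ₚ b) /ₚ (b *ₚ d)

_*f_ : Frac → Frac → Frac
(a /ₚ b) *f (c /ₚ d) = (a *ₚ c) /ₚ (b *ₚ d)

polyF : Poly → Frac
polyF p = p /ₚ oneₚ

zeroF : Frac
zeroF = [] /ₚ oneₚ

sumF : List Frac → Frac
sumF = foldr _+f_ zeroF

-- p(q⁻¹) for a polynomial p = Σ_{i<L} c_i q^i :  (Σ c_i q^{L-1-i}) / q^{L-1}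
atInv : Poly → Frac
atInv p = reverse p /ₚ mono 1ℤ (length p ∸ 1)

-- A ≡ B (mod Φ_n(q)^2): A - B = Φ_n² P / Q with P, Q ∈ ℤ[q], Q coprime to Φ_n.
-- Writing A - B = N/D, this is  Q·N = Φ_n²·P·D.
CongΦ² : ℕ → Frac → Frac → Set
CongΦ² n A B =
  Σ Poly λ P → Σ Poly λ Q →
    CoprimeP Q (Φ n) × (Q *ₚ num (A -f B) ≈ₚ Φ n *ₚ Φ n *ₚ P *ₚ den (A -f B))

private
  prodOneMinus : ℕ → (ℕ → ℕ) → ℕ → Poly
  prodOneMinus s e m = prodₚ (map (λ j → oneₚ -ₚ mono 1ℤ (s ℕ.* e j)) (upTo m))

qbin : ℕ → ℕ → ℕ → Frac
qbin s n m with m ℕ.≤ᵇ n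
... | Data.Bool.true  = prodOneMinus s (λ i → n ∸ i) m /ₚ prodOneMinus s suc m
... | Data.Bool.false = zeroF

qbinom : ℕ → ℕ → Frac
qbinom = qbin 1

qbinom² : ℕ → ℕ → Frac
qbinom² = qbin 2

sgn : ℕ → ℤ
sgn k = (ℤ.- 1ℤ) ℤ.^ k

t0' : ℕ → ℕ → ℕ → Frac
t0' a b n =
  let A = a ℕ.* n
      B = b ℕ.* n
      U = A ∸ B
      L = U ∸ (n / 2)
      term : ℕ → Frac
      term k = polyF (mono (sgn k) (k ℕ.* k)) *f qbinom² A k
                 *f qbinom (2 ℕ.* A ∸ 2 ℕ.* k) (U ∸ k)
  in sumF (map (λ i → term (L ℕ.+ i)) (upTo (suc (U ∸ L))))

thetaAux : ℕ → ℕ → Poly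
thetaAux m zero =
  let e = (m ℕ.* (3 ℕ.* m ∸ 1)) / 2 in
  mono (sgn m) e +ₚ mono (sgn m) (e ℕ.+ m)
thetaAux m (suc zero) = mono (sgn m) ((m ℕ.* (3 ℕ.* m ℕ.+ 1)) / 2)
thetaAux m (suc (suc _)) = mono (sgn (suc m)) (((m ℕ.+ 1) ℕ.* (3 ℕ.* m ℕ.+ 2)) / 2)

θ : ℕ → Poly
θ n = thetaAux (n / 3) (n % 3)

rhs : ℕ → ℕ → ℕ → Frac
rhs a b n =
  let U = a ℕ.* n ∸ b ℕ.* n in
  polyF (mono (sgn U) (U ℕ.* U)) *f qbinom² (a ℕ.* n) (b ℕ.* n)
    *f (polyF oneₚ -f polyF (constₚ (+ (2 ℕ.* (a ∸ b)))) *f (polyF oneₚ -f atInv (θ n)))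

-- Work modulo Φ_n(q)² in ℤ[q] localised at the elements coprime to Φ_n, and put w = 1 - q^n, so that w² = 0, and
-- e = a - b, j = an - bn - k. There every 1 - q^i with 0 < i < n is cancellable and q has an inverse p. Absorption
-- identities for q-binomials, free of division, give (1 - q^j) t_j = 2e w t_0 (...) for the j-th summand t_j with
-- 1 ≤ j ≤ n/2, the factor 2e w coming from 1 - q^(2en); as w² = 0, the remaining factors may be reduced modulo q^n = 1.
-- They turn out to be those of the j-th summand of
--   θ_n(x) = Σ_j (-1)^j x^(j(j-1)/2) (1 - x^n) / (1 - x^(n-j)) [n-j; j]_x
-- at x = p, so t_j = 2e t_0 (that summand), and the summand j = 0 of θ_n is 1. The identity for θ_n follows from the
-- two Pascal rules, which give a recursion of step 3 for Σ_j (-1)^j x^(j(j-1)/2) [n-j; j]_x.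
-- Coprimality of Φ_n with q^d - 1 for 0 < d < n is proved together with the product formula for q^n - 1, by strong
-- induction: distinct Φ_d are pairwise coprime over ℚ, hence the product of the Φ_d with d ∣ n, d < n divides q^n - 1.
module Submission where

open import Defs
open import Algebra using (CommutativeRing; CommutativeSemigroup)
open import Algebra.Solver.Ring.AlmostCommutativeRing using (fromCommutativeRing; _-Raw-AlmostCommutative⟶_)
import Algebra.Solver.Ring
import Algebra.Properties.Ring
import Algebra.Properties.AbelianGroup
import Algebra.Properties.Semiring.Mult
import Algebra.Properties.Semiring.Mult.TCOptimised
import Algebra.Properties.Semiring.Exp
import Data.Integer.Properties as ℤ
open import Data.Integer as ℤ using (ℤ; +_; -[1+_]; 0ℤ; 1ℤ)
open import Data.Maybe using (Maybe; just; nothing)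
open import Data.Nat as ℕ using (ℕ; zero; suc; _∸_; _≤_; _<_; z≤n; s≤s)
import Data.Nat.Properties as ℕ
import Data.Sum
open import Data.Sum using (inj₁; inj₂)
import Data.Bool
open import Data.Nat.Divisibility using (_∣_; _∣?_; divides; ∣-refl; ∣-trans; ∣⇒≤; 0∣⇒≡0)
open import Data.Nat.GCD using (gcd; gcd-GCD; gcd[m,n]∣m; gcd[m,n]∣n; module Bézout)
open import Data.Nat.Induction using (<-rec)
import Data.List.Relation.Unary.All.Properties as All
open import Level using (_⊔_)
open import Algebra.Structures using (IsAbelianGroup)
import Algebra.Properties.CommutativeSemigroup
open import Data.List using (List; []; _∷_; _++_; [_]; reverse; length; filter; map; upTo; applyUpTo)
import Data.List.Properties as List
open import Data.List.Relation.Unary.All as All using (All; []; _∷_)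
open import Relation.Binary using (IsEquivalence)
import Algebra.Properties.CommutativeSemiring.Exp
import Data.Product
open import Data.Product using (Σ; _,_; proj₁; proj₂)
open import Data.Nat.DivMod using (_/_; _%_; m≡m%n+[m/n]*n; m%n<n; m*n/n≡m; m/n≡1+[m∸n]/n; m/n≤m)
open import Data.Nat.Tactic.RingSolver using (solve-∀)
open import Relation.Binary.PropositionalEquality as ≡ using (_≡_; _≢_)
open import Relation.Nullary using (Dec; yes; no; ¬_; contradiction)
import Relation.Binary.Reasoning.Setoid

-- Two obstacles shape the argument. For even n the summand j = n/2 meets 1 - q^(2j) = w, which is
-- nilpotent and cannot be cancelled, so there the q^2-binomial cannot be determined on its own. The
-- product of both binomials is treated instead: absorption in the q-binomial produces 1 - q^(2(bn +
-- j)), exactly the factor that moves the q^2-binomial one step along its row, and only 1 - q^j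
-- remains to be cancelled. The second obstacle is that Φ_n may divide both numerator and
-- denominator of a given fraction, so a fraction cannot be read in the local ring by inverting its
-- denominator. The relation `Value` replaces inversion, and the q-binomials get their values from
-- identities numerator = Gaussian polynomial times denominator in ℤ[q]. The congruence itself is
-- proved in any commutative ring with a `RootOfUnity`; the local ring is then realised on
-- polynomials by a coarser equality.

-- Integer coefficients in an arbitrary commutative ring.

module IntegerCoefficients {c ℓ} (R : CommutativeRing c ℓ) where
  open CommutativeRing R
  open Algebra.Properties.Ring ring
  open Algebra.Properties.AbelianGroup +-abelianGroup using (⁻¹-∙-comm)
  open Algebra.Properties.Semiring.Mult.TCOptimised semiring
  open Relation.Binary.Reasoning.Setoid setoid

  -- Integers supply the decidable equality of coefficients that normalisation uses and an abstract
  -- ring need not have. With the optimised multiple, `⟦ 1ℤ ⟧` reduces to `1#`.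
  ⟦_⟧ : ℤ → Carrier
  ⟦ + n ⟧ = n × 1#
  ⟦ -[1+ n ] ⟧ = - (suc n × 1#)

  ⊖-homo : ∀ m n → ⟦ m ℤ.⊖ n ⟧ ≈ m × 1# - n × 1#
  ⊖-homo m zero = sym (trans (+-congˡ -0#≈0#) (+-identityʳ _))
  ⊖-homo zero (suc n) = sym (+-identityˡ _)
  ⊖-homo (suc m) (suc n) = begin
    ⟦ suc m ℤ.⊖ suc n ⟧                       ≡⟨ ≡.cong ⟦_⟧ (ℤ.[1+m]⊖[1+n]≡m⊖n m n) ⟩
    ⟦ m ℤ.⊖ n ⟧                               ≈⟨ ⊖-homo m n ⟩
    m × 1# - n × 1#                           ≈⟨ +-congʳ (+-identityʳ _) ⟨
    m × 1# + 0# - n × 1#                      ≈⟨ +-congʳ (+-congˡ (-‿inverseʳ 1#)) ⟨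
    m × 1# + (1# - 1#) - n × 1#               ≈⟨ +-congʳ (+-assoc _ _ _) ⟨
    m × 1# + 1# - 1# - n × 1#                 ≈⟨ +-assoc _ _ _ ⟩
    m × 1# + 1# + (- 1# - n × 1#)             ≈⟨ +-cong (×-homo-+ 1# m 1) (sym (⁻¹-∙-comm 1# _)) ⟨
    (m ℕ.+ 1) × 1# + - (1# + n × 1#)          ≈⟨ +-cong (×-cong (ℕ.+-comm m 1) refl) (-‿cong (sym (1+× n 1#))) ⟩
    suc m × 1# - suc n × 1#                   ∎

  +-homo : ∀ i j → ⟦ i ℤ.+ j ⟧ ≈ ⟦ i ⟧ + ⟦ j ⟧
  +-homo (+ m) (+ n) = ×-homo-+ 1# m n
  +-homo (+ m) -[1+ n ] = ⊖-homo m (suc n)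
  +-homo -[1+ m ] (+ n) = trans (⊖-homo n (suc m)) (+-comm _ _)
  +-homo -[1+ m ] -[1+ n ] = begin
    - (suc (suc (m ℕ.+ n)) × 1#)    ≡⟨ ≡.cong (λ k → - (k × 1#)) (≡.cong suc (≡.sym (ℕ.+-suc m n))) ⟩
    - ((suc m ℕ.+ suc n) × 1#)      ≈⟨ -‿cong (×-homo-+ 1# (suc m) (suc n)) ⟩
    - (suc m × 1# + suc n × 1#)     ≈⟨ ⁻¹-∙-comm _ _ ⟨
    - (suc m × 1#) - suc n × 1#     ∎

  -‿homo : ∀ i → ⟦ ℤ.- i ⟧ ≈ - ⟦ i ⟧
  -‿homo (+ zero) = sym -0#≈0#
  -‿homo ℤ.+[1+ n ] = refl
  -‿homo -[1+ n ] = sym (-‿involutive _)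

  *-homo-+ˡ : ∀ m j → ⟦ + m ℤ.* j ⟧ ≈ (m × 1#) * ⟦ j ⟧
  *-homo-+ˡ zero j = trans (reflexive (≡.cong ⟦_⟧ (ℤ.*-zeroˡ j))) (sym (zeroˡ _))
  *-homo-+ˡ (suc m) j = begin
    ⟦ + suc m ℤ.* j ⟧                  ≡⟨ ≡.cong ⟦_⟧ (ℤ.suc-* (+ m) j) ⟩
    ⟦ j ℤ.+ + m ℤ.* j ⟧                ≈⟨ +-homo j (+ m ℤ.* j) ⟩
    ⟦ j ⟧ + ⟦ + m ℤ.* j ⟧              ≈⟨ +-cong (sym (*-identityˡ _)) (*-homo-+ˡ m j) ⟩
    1# * ⟦ j ⟧ + (m × 1#) * ⟦ j ⟧      ≈⟨ distribʳ _ _ _ ⟨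
    (1# + m × 1#) * ⟦ j ⟧              ≈⟨ *-congʳ (1+× m 1#) ⟨
    (suc m × 1#) * ⟦ j ⟧               ∎

  *-homo : ∀ i j → ⟦ i ℤ.* j ⟧ ≈ ⟦ i ⟧ * ⟦ j ⟧
  *-homo (+ m) j = *-homo-+ˡ m j
  *-homo -[1+ m ] j = begin
    ⟦ -[1+ m ] ℤ.* j ⟧                 ≡⟨ ≡.cong ⟦_⟧ (ℤ.neg-distribˡ-* (+ suc m) j) ⟨
    ⟦ ℤ.- (+ suc m ℤ.* j) ⟧            ≈⟨ -‿homo (+ suc m ℤ.* j) ⟩
    - ⟦ + suc m ℤ.* j ⟧                ≈⟨ -‿cong (*-homo-+ˡ (suc m) j) ⟩
    - ((suc m × 1#) * ⟦ j ⟧)           ≈⟨ -‿distribˡ-* _ _ ⟩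
    - (suc m × 1#) * ⟦ j ⟧             ∎

  decide : ∀ i j → Maybe (⟦ i ⟧ ≈ ⟦ j ⟧)
  decide i j with i ℤ.≟ j
  ... | yes i≡j = just (reflexive (≡.cong ⟦_⟧ i≡j))
  ... | no _ = nothing

  morphism : ℤ.+-*-rawRing -Raw-AlmostCommutative⟶ fromCommutativeRing R
  morphism = record
    { ⟦_⟧ = ⟦_⟧ ; +-homo = +-homo ; *-homo = *-homo ; -‿homo = -‿homo ; 0-homo = refl ; 1-homo = refl }

  module Solver = Algebra.Solver.Ring ℤ.+-*-rawRing (fromCommutativeRing R) morphism decide

-- Gaussian binomials and their absorption identities.

module GaussianBinomials {c ℓ} (R : CommutativeRing c ℓ) (x : CommutativeRing.Carrier R) where
  open CommutativeRing R hiding (zero)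
  open Algebra.Properties.Semiring.Exp semiring
  open IntegerCoefficients.Solver R
  open Relation.Binary.Reasoning.Setoid setoid

  d : ℕ → Carrier
  d n = 1# - x ^ n

  d-+ : ∀ m n → d m + x ^ m * d n ≈ d (m ℕ.+ n)
  d-+ m n = begin
    1# - x ^ m + x ^ m * (1# - x ^ n)
      ≈⟨ solve 2 (λ a b → con 1ℤ :- a :+ a :* (con 1ℤ :- b) := con 1ℤ :- a :* b) refl (x ^ m) (x ^ n) ⟩
    1# - x ^ m * x ^ n
      ≈⟨ +-congˡ (-‿cong (^-homo-* x m n)) ⟨
    1# - x ^ (m ℕ.+ n) ∎

  -- gauss k l is the Gaussian binomial coefficient [k + l; k].
  gauss : ℕ → ℕ → Carrier
  gauss zero l = 1#
  gauss (suc k) zero = 1#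
  gauss (suc k) (suc l) = gauss k (suc l) + x ^ suc k * gauss (suc k) l

  gauss-zeroʳ : ∀ k → gauss k 0 ≡ 1#
  gauss-zeroʳ zero = ≡.refl
  gauss-zeroʳ (suc k) = ≡.refl

  -- Both absorption rules are proved by one induction. After Pascal's rule the induction hypotheses
  -- trade one product for the other, as both equal `gauss k l * d (suc k ℕ.+ l)`, and `d-+`
  -- collects the factors. Nothing is cancelled, so the rules survive where some 1 - x^i is a zero
  -- divisor.
  gauss-sucˡ : ∀ k l → gauss (suc k) l * d (suc k) ≈ gauss k l * d (suc k ℕ.+ l)
  gauss-sucʳ : ∀ k l → gauss k (suc l) * d (suc l) ≈ gauss k l * d (suc k ℕ.+ l)

  gauss-sucˡ k zero = *-cong (reflexive (≡.sym (gauss-zeroʳ k)))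
    (reflexive (≡.cong d (≡.sym (ℕ.+-identityʳ (suc k)))))
  gauss-sucˡ k (suc l) = begin
    (a + X * b) * d (suc k)
      ≈⟨ solve 4 (λ a X b e → (a :+ X :* b) :* e := a :* e :+ X :* (b :* e)) refl a X b (d (suc k)) ⟩
    a * d (suc k) + X * (b * d (suc k))
      ≈⟨ +-congˡ (*-congˡ (trans (gauss-sucˡ k l) (sym (gauss-sucʳ k l)))) ⟩
    a * d (suc k) + X * (a * d (suc l))
      ≈⟨ solve 4 (λ a X e f → a :* e :+ X :* (a :* f) := a :* (e :+ X :* f)) refl a X (d (suc k)) (d (suc l)) ⟩
    a * (d (suc k) + X * d (suc l))
      ≈⟨ *-congˡ (d-+ (suc k) (suc l)) ⟩
    a * d (suc k ℕ.+ suc l) ∎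
    where
    a = gauss k (suc l)
    b = gauss (suc k) l
    X = x ^ suc k

  gauss-sucʳ zero l = refl
  gauss-sucʳ (suc k) l = begin
    (a + X * b) * d (suc l)
      ≈⟨ solve 4 (λ a X b e → (a :+ X :* b) :* e := a :* e :+ X :* (b :* e)) refl a X b (d (suc l)) ⟩
    a * d (suc l) + X * (b * d (suc l))
      ≈⟨ +-congʳ (trans (gauss-sucʳ k l) (sym (gauss-sucˡ k l))) ⟩
    b * d (suc k) + X * (b * d (suc l))
      ≈⟨ solve 4 (λ b X e f → b :* e :+ X :* (b :* f) := b :* (e :+ X :* f)) refl b X (d (suc k)) (d (suc l)) ⟩
    b * (d (suc k) + X * d (suc l))
      ≈⟨ *-congˡ (d-+ (suc k) (suc l)) ⟩
    b * d (suc k ℕ.+ suc l)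
      ≡⟨ ≡.cong (λ n → b * d n) (ℕ.+-suc (suc k) l) ⟩
    b * d (suc (suc k) ℕ.+ l) ∎
    where
    a = gauss k (suc l)
    b = gauss (suc k) l
    X = x ^ suc k

  -- The two Pascal rules differ by a (1 - Y) - b (1 - X), and by absorption both products equal
  -- `gauss k l * d (suc k ℕ.+ l)`.
  gauss-suc-suc : ∀ k l → gauss (suc k) (suc l) ≈ x ^ suc l * gauss k (suc l) + gauss (suc k) l
  gauss-suc-suc k l = begin
    a + X * b
      ≈⟨ solve 4 (λ a b X Y → a :+ X :* b := a :* (con 1ℤ :- Y) :+ (Y :* a :+ X :* b)) refl a b X Y ⟩
    a * (1# - Y) + (Y * a + X * b)
      ≈⟨ +-congʳ (trans (gauss-sucʳ k l) (sym (gauss-sucˡ k l))) ⟩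
    b * (1# - X) + (Y * a + X * b)
      ≈⟨ solve 4 (λ a b X Y → b :* (con 1ℤ :- X) :+ (Y :* a :+ X :* b) := Y :* a :+ b) refl a b X Y ⟩
    Y * a + b ∎
    where
    a = gauss k (suc l)
    b = gauss (suc k) l
    X = x ^ suc k
    Y = x ^ suc l

  gauss-comm : ∀ k l → gauss k l ≈ gauss l k
  gauss-comm zero l = reflexive (≡.sym (gauss-zeroʳ l))
  gauss-comm (suc k) zero = refl
  gauss-comm (suc k) (suc l) = begin
    gauss k (suc l) + x ^ suc k * gauss (suc k) l  ≈⟨ +-comm _ _ ⟩
    x ^ suc k * gauss (suc k) l + gauss k (suc l)  ≈⟨ +-cong (*-congˡ (gauss-comm (suc k) l)) (gauss-comm k (suc l)) ⟩
    x ^ suc k * gauss l (suc k) + gauss (suc l) k  ≈⟨ gauss-suc-suc l k ⟨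
    gauss (suc l) (suc k)                          ∎

-- Sums along the diagonals 2j + l = n.

module DiagonalSums {c ℓ} (R : CommutativeRing c ℓ) where
  open CommutativeRing R hiding (zero)
  open IntegerCoefficients.Solver R

  -- ∑ f n is the sum of f j l over all j, l with 2j + l = n.
  ∑ : (ℕ → ℕ → Carrier) → ℕ → Carrier
  ∑ f zero = f 0 0
  ∑ f (suc zero) = f 0 1
  ∑ f (suc (suc n)) = f 0 (suc (suc n)) + ∑ (λ j l → f (suc j) l) n

  ∑-cong : ∀ {f g} n → (∀ j l → j ℕ.+ (j ℕ.+ l) ≡ n → f j l ≈ g j l) → ∑ f n ≈ ∑ g n
  ∑-cong zero f≈g = f≈g 0 0 ≡.refl
  ∑-cong (suc zero) f≈g = f≈g 0 1 ≡.refl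
  ∑-cong (suc (suc n)) f≈g = +-cong (f≈g 0 _ ≡.refl)
    (∑-cong n (λ j l e → f≈g (suc j) l (≡.cong suc (≡.trans (ℕ.+-suc j (j ℕ.+ l)) (≡.cong suc e)))))

  ∑-+ : ∀ f g n → ∑ (λ j l → f j l + g j l) n ≈ ∑ f n + ∑ g n
  ∑-+ f g zero = refl
  ∑-+ f g (suc zero) = refl
  ∑-+ f g (suc (suc n)) = trans (+-congˡ (∑-+ _ _ n))
    (solve 4 (λ a b c d → a :+ b :+ (c :+ d) := a :+ c :+ (b :+ d)) refl _ _ _ _)

  ∑-*ˡ : ∀ a f n → ∑ (λ j l → a * f j l) n ≈ a * ∑ f n
  ∑-*ˡ a f zero = refl
  ∑-*ˡ a f (suc zero) = refl
  ∑-*ˡ a f (suc (suc n)) = trans (+-congˡ (∑-*ˡ a _ n)) (sym (distribˡ _ _ _))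

  -- Extension by zero at index 0: a Pascal term that exists only for positive j or l becomes a
  -- summand on the whole diagonal. Lowering j shortens the diagonal by two, lowering l by one.
  shift : (ℕ → Carrier) → ℕ → Carrier
  shift f zero = 0#
  shift f (suc n) = f n

  ∑-shiftˡ : ∀ f n → ∑ (λ j l → shift (λ i → f i l) j) (suc (suc n)) ≈ ∑ f n
  ∑-shiftˡ f n = +-identityˡ _

  ∑-shiftʳ : ∀ f n → ∑ (λ j → shift (f j)) (suc n) ≈ ∑ f n
  ∑-shiftʳ f zero = refl
  ∑-shiftʳ f (suc zero) = +-identityʳ _
  ∑-shiftʳ f (suc (suc n)) = +-congˡ (∑-shiftʳ _ n)

-- The alternating sums behind the theta function.

module ThetaSums {c ℓ} (R : CommutativeRing c ℓ) (x : CommutativeRing.Carrier R) where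
  open CommutativeRing R hiding (zero)
  open Algebra.Properties.Ring ring
  open Algebra.Properties.Semiring.Exp semiring
  open IntegerCoefficients.Solver R
  open GaussianBinomials R x
  open DiagonalSums R
  open Relation.Binary.Reasoning.Setoid setoid

  -- coeff s j = (-1)^j x^(s j + j (j - 1) / 2)
  coeff : ℕ → ℕ → Carrier
  coeff s zero = 1#
  coeff s (suc j) = - (x ^ s) * coeff (suc s) j

  coeff-suc : ∀ s j → coeff (suc s) j ≈ x ^ j * coeff s j
  coeff-suc s zero = sym (*-identityˡ _)
  coeff-suc s (suc j) = trans (*-congˡ (coeff-suc (suc s) j))
    (solve 4 (λ x X Y c → :- (x :* X) :* (Y :* c) := x :* Y :* (:- X :* c)) refl x (x ^ s) (x ^ j) _)

  -- On the diagonal 2j + l = n the binomial is [n - j; j]. The parameter s is carried because the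
  -- Pascal rules link the sums for s = 0 and s = 1.
  G : ℕ → ℕ → Carrier
  G s = ∑ (λ j l → coeff s j * gauss j l)

  -- First Pascal rule. The part lowering l carries the extra factor x^j, and the part lowering j
  -- takes one factor -1 out of the coefficient; either change turns s = 0 into s = 1.
  G₀-rec : ∀ n → G 0 (2 ℕ.+ n) ≈ G 1 (1 ℕ.+ n) - G 1 n
  G₀-rec n = begin
    G 0 (2 ℕ.+ n)
      ≈⟨ ∑-cong (2 ℕ.+ n) step ⟩
    ∑ (λ j l → shift (λ i → F i l) j + shift (H j) l) (2 ℕ.+ n)
      ≈⟨ ∑-+ (λ j l → shift (λ i → F i l) j) (λ j → shift (H j)) (2 ℕ.+ n) ⟩
    ∑ (λ j l → shift (λ i → F i l) j) (2 ℕ.+ n) + ∑ (λ j l → shift (H j) l) (2 ℕ.+ n)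
      ≈⟨ +-cong (∑-shiftˡ F n) (∑-shiftʳ H (1 ℕ.+ n)) ⟩
    ∑ F n + G 1 (1 ℕ.+ n)
      ≈⟨ +-congʳ (trans (∑-cong n (λ j l _ → *-assoc _ _ _)) (∑-*ˡ _ H n)) ⟩
    - 1# * G 1 n + G 1 (1 ℕ.+ n)
      ≈⟨ solve 2 (λ a b → :- con 1ℤ :* a :+ b := b :- a) refl (G 1 n) (G 1 (1 ℕ.+ n)) ⟩
    G 1 (1 ℕ.+ n) - G 1 n ∎
    where
    F H : ℕ → ℕ → Carrier
    F i l = coeff 0 (suc i) * gauss i l
    H j l = coeff 1 j * gauss j l

    step : ∀ j l → j ℕ.+ (j ℕ.+ l) ≡ 2 ℕ.+ n →
      coeff 0 j * gauss j l ≈ shift (λ i → F i l) j + shift (H j) l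
    step zero (suc l) _ = sym (+-identityˡ _)
    step (suc j) zero _ = trans (*-congˡ (reflexive (≡.sym (gauss-zeroʳ j)))) (sym (+-identityʳ _))
    step (suc j) (suc l) _ = begin
      coeff 0 (suc j) * (gauss j (suc l) + x ^ suc j * gauss (suc j) l)
        ≈⟨ solve 4 (λ c a X b → c :* (a :+ X :* b) := c :* a :+ X :* c :* b) refl _ _ _ _ ⟩
      coeff 0 (suc j) * gauss j (suc l) + x ^ suc j * coeff 0 (suc j) * gauss (suc j) l
        ≈⟨ +-congˡ (*-congʳ (coeff-suc 0 (suc j))) ⟨
      coeff 0 (suc j) * gauss j (suc l) + coeff 1 (suc j) * gauss (suc j) l ∎

  x^weight : ∀ j l {n} → j ℕ.+ (j ℕ.+ l) ≡ n → x ^ j * (x ^ j * x ^ l) ≈ x ^ n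
  x^weight j l ≡.refl = sym (trans (^-homo-* x j (j ℕ.+ l)) (*-congˡ (^-homo-* x j l)))

  -- Second Pascal rule. In the part lowering j, the power x^l and the coefficient combine to x^(1 +
  -- 2j + l) times `coeff 0 j`, and that power is constant along the diagonal.
  G₁-rec : ∀ n → G 1 (2 ℕ.+ n) ≈ G 1 (1 ℕ.+ n) - x ^ suc n * G 0 n
  G₁-rec n = begin
    G 1 (2 ℕ.+ n)
      ≈⟨ ∑-cong (2 ℕ.+ n) step ⟩
    ∑ (λ j l → shift (λ i → F i l) j + shift (H j) l) (2 ℕ.+ n)
      ≈⟨ ∑-+ (λ j l → shift (λ i → F i l) j) (λ j → shift (H j)) (2 ℕ.+ n) ⟩
    ∑ (λ j l → shift (λ i → F i l) j) (2 ℕ.+ n) + ∑ (λ j l → shift (H j) l) (2 ℕ.+ n)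
      ≈⟨ +-cong (∑-shiftˡ F n) (∑-shiftʳ H (1 ℕ.+ n)) ⟩
    ∑ F n + G 1 (1 ℕ.+ n)
      ≈⟨ +-congʳ (trans (∑-cong n F≈) (∑-*ˡ _ _ n)) ⟩
    - (x ^ suc n) * G 0 n + G 1 (1 ℕ.+ n)
      ≈⟨ solve 3 (λ a b c → :- c :* a :+ b := b :- c :* a) refl (G 0 n) (G 1 (1 ℕ.+ n)) (x ^ suc n) ⟩
    G 1 (1 ℕ.+ n) - x ^ suc n * G 0 n ∎
    where
    F H : ℕ → ℕ → Carrier
    F i l = coeff 1 (suc i) * (x ^ l * gauss i l)
    H j l = coeff 1 j * gauss j l

    step : ∀ j l → j ℕ.+ (j ℕ.+ l) ≡ 2 ℕ.+ n →
      coeff 1 j * gauss j l ≈ shift (λ i → F i l) j + shift (H j) l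
    step zero (suc l) _ = sym (+-identityˡ _)
    step (suc j) zero _ = trans (*-congˡ (sym (trans (*-identityˡ _) (reflexive (gauss-zeroʳ j)))))
      (sym (+-identityʳ _))
    step (suc j) (suc l) _ = trans (*-congˡ (gauss-suc-suc j l)) (distribˡ _ _ _)

    F≈ : ∀ j l → j ℕ.+ (j ℕ.+ l) ≡ n → F j l ≈ - (x ^ suc n) * (coeff 0 j * gauss j l)
    F≈ j l e = begin
      - (x * 1#) * coeff 2 j * (x ^ l * gauss j l)
        ≈⟨ *-congʳ (*-congˡ (trans (coeff-suc 1 j) (*-congˡ (coeff-suc 0 j)))) ⟩
      - (x * 1#) * (x ^ j * (x ^ j * coeff 0 j)) * (x ^ l * gauss j l)
        ≈⟨ solve 5 (λ x J c L g → :- (x :* con 1ℤ) :* (J :* (J :* c)) :* (L :* g) :=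
             :- (x :* (J :* (J :* L))) :* (c :* g)) refl x (x ^ j) _ (x ^ l) _ ⟩
      - (x * (x ^ j * (x ^ j * x ^ l))) * (coeff 0 j * gauss j l)
        ≈⟨ *-congʳ (-‿cong (*-congˡ (x^weight j l e))) ⟩
      - (x * x ^ n) * (coeff 0 j * gauss j l) ∎

  G-rec : ∀ n → G 0 (3 ℕ.+ n) ≈ - (x ^ suc n) * G 0 n
  G-rec n = begin
    G 0 (3 ℕ.+ n)
      ≈⟨ G₀-rec (suc n) ⟩
    G 1 (2 ℕ.+ n) - G 1 (1 ℕ.+ n)
      ≈⟨ +-congʳ (G₁-rec n) ⟩
    G 1 (1 ℕ.+ n) - x ^ suc n * G 0 n - G 1 (1 ℕ.+ n)
      ≈⟨ solve 3 (λ a X b → a :- X :* b :- a := :- X :* b) refl _ _ _ ⟩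
    - (x ^ suc n) * G 0 n ∎

  -- lucas j l is (1 - x^(2j + l)) / (1 - x^(j + l)) [j + l; j].
  lucas : ℕ → ℕ → Carrier
  lucas zero l = 1#
  lucas (suc j) l = gauss (suc j) l + x ^ (suc j ℕ.+ l) * gauss j l

  -- Division-free form of the quotient: on the diagonal of length n the right side contains 1 -
  -- x^n, which becomes the nilpotent element later, and the left side only the cancellable 1 - x^(j
  -- + 1).
  lucas-suc : ∀ j l → lucas (suc j) l * d (suc j) ≈ d (suc j ℕ.+ (suc j ℕ.+ l)) * gauss j l
  lucas-suc j l = begin
    (gauss (suc j) l + X * g) * d (suc j)
      ≈⟨ distribʳ _ _ _ ⟩
    gauss (suc j) l * d (suc j) + X * g * d (suc j)
      ≈⟨ +-congʳ (gauss-sucˡ j l) ⟩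
    g * d (suc j ℕ.+ l) + X * g * d (suc j)
      ≈⟨ solve 4 (λ g a X b → g :* a :+ X :* g :* b := (a :+ X :* b) :* g) refl _ _ _ _ ⟩
    (d (suc j ℕ.+ l) + X * d (suc j)) * g
      ≈⟨ *-congʳ (trans (d-+ (suc j ℕ.+ l) (suc j)) (reflexive (≡.cong d (ℕ.+-comm (suc j ℕ.+ l) (suc j))))) ⟩
    d (suc j ℕ.+ (suc j ℕ.+ l)) * g ∎
    where
    g = gauss j l
    X = x ^ (suc j ℕ.+ l)

  L : ℕ → Carrier
  L = ∑ (λ j l → coeff 0 j * lucas j l)

  -- The second half of `lucas` lowers j, hence shortens the diagonal by two; its power of x
  -- together with that of the coefficient is x^(n + 1) throughout.
  L-rec : ∀ n → L (2 ℕ.+ n) ≈ G 0 (2 ℕ.+ n) - x ^ suc n * G 0 n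
  L-rec n = begin
    L (2 ℕ.+ n)
      ≈⟨ ∑-cong (2 ℕ.+ n) step ⟩
    ∑ (λ j l → coeff 0 j * gauss j l + shift (λ i → F i l) j) (2 ℕ.+ n)
      ≈⟨ ∑-+ (λ j l → coeff 0 j * gauss j l) (λ j l → shift (λ i → F i l) j) (2 ℕ.+ n) ⟩
    G 0 (2 ℕ.+ n) + ∑ (λ j l → shift (λ i → F i l) j) (2 ℕ.+ n)
      ≈⟨ +-congˡ (trans (∑-shiftˡ F n) (trans (∑-cong n F≈) (∑-*ˡ _ _ n))) ⟩
    G 0 (2 ℕ.+ n) + - (x ^ suc n) * G 0 n
      ≈⟨ +-congˡ (-‿distribˡ-* _ _) ⟨
    G 0 (2 ℕ.+ n) - x ^ suc n * G 0 n ∎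
    where
    F : ℕ → ℕ → Carrier
    F i l = coeff 0 (suc i) * (x ^ (suc i ℕ.+ l) * gauss i l)

    step : ∀ j l → j ℕ.+ (j ℕ.+ l) ≡ 2 ℕ.+ n →
      coeff 0 j * lucas j l ≈ coeff 0 j * gauss j l + shift (λ i → F i l) j
    step zero l _ = sym (+-identityʳ _)
    step (suc j) l _ = distribˡ _ _ _

    F≈ : ∀ j l → j ℕ.+ (j ℕ.+ l) ≡ n → F j l ≈ - (x ^ suc n) * (coeff 0 j * gauss j l)
    F≈ j l e = begin
      - 1# * coeff 1 j * (x * x ^ (j ℕ.+ l) * gauss j l)
        ≈⟨ *-cong (*-congˡ (coeff-suc 0 j)) (*-congʳ (*-congˡ (^-homo-* x j l))) ⟩
      - 1# * (x ^ j * coeff 0 j) * (x * (x ^ j * x ^ l) * gauss j l)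
        ≈⟨ solve 5 (λ x J c L g → :- con 1ℤ :* (J :* c) :* (x :* (J :* L) :* g) :=
             :- (x :* (J :* (J :* L))) :* (c :* g)) refl x (x ^ j) _ (x ^ l) _ ⟩
      - (x * (x ^ j * (x ^ j * x ^ l))) * (coeff 0 j * gauss j l)
        ≈⟨ *-congʳ (-‿cong (*-congˡ (x^weight j l e))) ⟩
      - (x * x ^ n) * (coeff 0 j * gauss j l) ∎

  -- The pentagonal numbers m(3m - 1)/2, given by their increments 3m + 1, which are the exponents
  -- contributed by the recursion of step three; `pent′` is the companion family m(3m + 1)/2.
  pent : ℕ → ℕ
  pent zero = 0
  pent (suc m) = suc (m ℕ.* 3) ℕ.+ pent m

  pent′ : ℕ → ℕ
  pent′ zero = 0
  pent′ (suc m) = 2 ℕ.+ m ℕ.* 3 ℕ.+ pent′ m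

  sign : ℕ → Carrier
  sign m = (- 1#) ^ m

  private
    sign-step : ∀ m k e → - (x ^ k) * (sign m * x ^ e) ≈ sign (suc m) * x ^ (k ℕ.+ e)
    sign-step m k e = trans
      (solve 3 (λ X s Y → :- X :* (s :* Y) := :- con 1ℤ :* s :* (X :* Y)) refl (x ^ k) (sign m) (x ^ e))
      (*-congˡ (sym (^-homo-* x k e)))

  G-3m : ∀ m → G 0 (m ℕ.* 3) ≈ sign m * x ^ pent m
  G-3m zero = refl
  G-3m (suc m) = trans (G-rec (m ℕ.* 3)) (trans (*-congˡ (G-3m m)) (sign-step m (suc (m ℕ.* 3)) (pent m)))

  G-3m+1 : ∀ m → G 0 (1 ℕ.+ m ℕ.* 3) ≈ sign m * x ^ pent′ m
  G-3m+1 zero = refl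
  G-3m+1 (suc m) = trans (G-rec (1 ℕ.+ m ℕ.* 3))
    (trans (*-congˡ (G-3m+1 m)) (sign-step m (2 ℕ.+ m ℕ.* 3) (pent′ m)))

  -- The sum at 2 is 1 - 1, and the recursion propagates zero through the residue class.
  G-3m+2 : ∀ m → G 0 (2 ℕ.+ m ℕ.* 3) ≈ 0#
  G-3m+2 zero = solve 0 (con 1ℤ :* con 1ℤ :+ (:- con 1ℤ :* con 1ℤ) :* con 1ℤ := con 0ℤ) refl
  G-3m+2 (suc m) = trans (G-rec (2 ℕ.+ m ℕ.* 3)) (trans (*-congˡ (G-3m+2 m)) (zeroʳ _))

  -- Only in this class do both sums of `L-rec` avoid the vanishing class 2 modulo 3, whence the two
  -- terms of θ_n for n divisible by 3.
  L-3m+3 : ∀ m → L (3 ℕ.+ m ℕ.* 3) ≈ sign (suc m) * x ^ pent (suc m) + sign (suc m) * x ^ pent′ (suc m)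
  L-3m+3 m = trans (L-rec (1 ℕ.+ m ℕ.* 3)) (+-cong (G-3m (suc m))
    (trans (-‿distribˡ-* _ _) (trans (*-congˡ (G-3m+1 m)) (sign-step m (2 ℕ.+ m ℕ.* 3) (pent′ m)))))

  L-3m+1 : ∀ m → L (1 ℕ.+ m ℕ.* 3) ≈ sign m * x ^ pent′ m
  L-3m+1 zero = refl
  L-3m+1 (suc m) = trans (L-rec (2 ℕ.+ m ℕ.* 3)) (trans (+-cong (G-3m+1 (suc m))
    (trans (-‿cong (trans (*-congˡ (G-3m+2 m)) (zeroʳ _))) -0#≈0#)) (+-identityʳ _))

  L-3m+2 : ∀ m → L (2 ℕ.+ m ℕ.* 3) ≈ sign (suc m) * x ^ pent (suc m)
  L-3m+2 m = trans (L-rec (m ℕ.* 3)) (trans (+-cong (G-3m+2 m)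
    (trans (-‿distribˡ-* _ _) (trans (*-congˡ (G-3m m)) (sign-step m (suc (m ℕ.* 3)) (pent m)))))
    (+-identityˡ _))

  -- The exponent of θ_n for n = 3m + 2 is the pentagonal number of index m + 1; doubling makes the
  -- floor division exact.
  pent-suc : ∀ m → ((m ℕ.+ 1) ℕ.* (3 ℕ.* m ℕ.+ 2)) / 2 ≡ pent (suc m)
  pent-suc m = ≡.trans (≡.cong (_/ 2) (≡.sym (double m))) (m*n/n≡m (pent (suc m)) 2)
    where
    double : ∀ m → pent (suc m) ℕ.* 2 ≡ (m ℕ.+ 1) ℕ.* (3 ℕ.* m ℕ.+ 2)
    double zero = ≡.refl
    double (suc m) = ≡.trans (ℕ.*-distribʳ-+ 2 (suc (suc m ℕ.* 3)) (pent (suc m)))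
      (≡.trans (≡.cong (suc (suc m ℕ.* 3) ℕ.* 2 ℕ.+_) (double m)) (identity m))
      where
      identity : ∀ m → suc (suc m ℕ.* 3) ℕ.* 2 ℕ.+ (m ℕ.+ 1) ℕ.* (3 ℕ.* m ℕ.+ 2) ≡
        (suc m ℕ.+ 1) ℕ.* (3 ℕ.* suc m ℕ.+ 2)
      identity = solve-∀

  pent-closed : ∀ m → (m ℕ.* (3 ℕ.* m ∸ 1)) / 2 ≡ pent m
  pent-closed zero = ≡.refl
  pent-closed (suc m) = ≡.trans (≡.cong (_/ 2) (≡.cong₂ ℕ._*_ (ℕ.+-comm 1 m) (≡.cong (_∸ 1) (identity m))))
    (pent-suc m)
    where
    identity : ∀ m → 3 ℕ.* suc m ≡ suc (3 ℕ.* m ℕ.+ 2)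
    identity = solve-∀

  pent+m : ∀ m → pent m ℕ.+ m ≡ pent′ m
  pent+m zero = ≡.refl
  pent+m (suc m) = ≡.trans (identity (m ℕ.* 3) (pent m) m) (≡.cong (2 ℕ.+ m ℕ.* 3 ℕ.+_) (pent+m m))
    where
    identity : ∀ a b m → suc a ℕ.+ b ℕ.+ suc m ≡ 2 ℕ.+ a ℕ.+ (b ℕ.+ m)
    identity = solve-∀

  pent′-closed : ∀ m → (m ℕ.* (3 ℕ.* m ℕ.+ 1)) / 2 ≡ pent′ m
  pent′-closed m = ≡.trans (≡.cong (_/ 2) (≡.sym (double m))) (m*n/n≡m (pent′ m) 2)
    where
    double : ∀ m → pent′ m ℕ.* 2 ≡ m ℕ.* (3 ℕ.* m ℕ.+ 1)
    double zero = ≡.refl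
    double (suc m) = ≡.trans (ℕ.*-distribʳ-+ 2 (2 ℕ.+ m ℕ.* 3) (pent′ m))
      (≡.trans (≡.cong ((2 ℕ.+ m ℕ.* 3) ℕ.* 2 ℕ.+_) (double m)) (identity m))
      where
      identity : ∀ m → (2 ℕ.+ m ℕ.* 3) ℕ.* 2 ℕ.+ m ℕ.* (3 ℕ.* m ℕ.+ 1) ≡ suc m ℕ.* (3 ℕ.* suc m ℕ.+ 1)
      identity = solve-∀

  -- Mirrors `thetaAux` clause by clause, keeping its floor divisions, so that evaluating the
  -- polynomial lands here directly.
  theta : ℕ → ℕ → Carrier
  theta m zero = sign m * x ^ e + sign m * x ^ (e ℕ.+ m)
    where e = (m ℕ.* (3 ℕ.* m ∸ 1)) / 2
  theta m (suc zero) = sign m * x ^ ((m ℕ.* (3 ℕ.* m ℕ.+ 1)) / 2)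
  theta m (suc (suc _)) = sign (suc m) * x ^ (((m ℕ.+ 1) ℕ.* (3 ℕ.* m ℕ.+ 2)) / 2)

  L≈theta : ∀ n → 0 < n → L n ≈ theta (n / 3) (n % 3)
  L≈theta n 0<n = trans (reflexive (≡.cong L n≡)) (main (n % 3) (n / 3) (m%n<n n 3) (≡.subst (0 <_) n≡ 0<n))
    where
    n≡ = m≡m%n+[m/n]*n n 3

    main : ∀ r m → r < 3 → 0 < r ℕ.+ m ℕ.* 3 → L (r ℕ.+ m ℕ.* 3) ≈ theta m r
    -- The index m = 0 would mean n = 0, where the sum is 1 but the closed form gives 2; positivity
    -- of n excludes it.
    main zero (suc m) _ _ = trans (L-3m+3 m) (+-cong
      (*-congˡ (^-congʳ x (≡.sym (pent-closed (suc m)))))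
      (*-congˡ (^-congʳ x (≡.sym (≡.trans (≡.cong (ℕ._+ suc m) (pent-closed (suc m))) (pent+m (suc m)))))))
    main (suc zero) m _ _ = trans (L-3m+1 m) (*-congˡ (^-congʳ x (≡.sym (pent′-closed m))))
    main (suc (suc zero)) m _ _ = trans (L-3m+2 m) (*-congˡ (^-congʳ x (≡.sym (pent-suc m))))
    main (suc (suc (suc _))) m (s≤s (s≤s (s≤s ()))) _

-- The congruence in an abstract ring with a near root of unity.

-- An invertible q in a ring where q^n = 1 up to an element of square zero, and where every 1 - q^i
-- with 0 < i < n is cancellable: q is nearly a primitive n-th root of unity.
record RootOfUnity {c ℓ} (R : CommutativeRing c ℓ) : Set (c ⊔ ℓ) where
  open CommutativeRing R hiding (zero)
  open Algebra.Properties.Semiring.Exp semiring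
  field
    q p : Carrier
    q*p≈1 : q * p ≈ 1#
    n : ℕ
  w : Carrier
  w = 1# - q ^ n
  field
    w*w≈0 : w * w ≈ 0#
    cancel : ∀ i → 0 < i → i < n → ∀ {x y} → (1# - q ^ i) * x ≈ (1# - q ^ i) * y → x ≈ y

module Supercongruence {c ℓ} {R : CommutativeRing c ℓ} (root : RootOfUnity R) where
  open RootOfUnity root
  open CommutativeRing R hiding (zero)
  open Algebra.Properties.Semiring.Exp semiring
  open Algebra.Properties.Semiring.Mult semiring using (_×_)
  open Algebra.Properties.CommutativeSemiring.Exp commutativeSemiring using (^-distrib-*)
  open IntegerCoefficients.Solver R
  open Relation.Binary.Reasoning.Setoid setoid
  open DiagonalSums R
  module Q = GaussianBinomials R (q * q)
  module P where
    open GaussianBinomials R p public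
    open ThetaSums R p public
  open GaussianBinomials R q

  private
    -- These are the elements on which q^n acts as 1. Multiples of w are among them since w^2 = 0,
    -- and reductions modulo q^n = 1 are legitimate only when applied to them.
    Killed : Carrier → Set _
    Killed t = w * t ≈ 0#

  killed-*ˡ : ∀ a {t} → Killed t → Killed (a * t)
  killed-*ˡ a {t} h = trans (solve 3 (λ w a t → w :* (a :* t) := a :* (w :* t)) refl w a t)
    (trans (*-congˡ h) (zeroʳ a))

  cancel-zero : ∀ i → 0 < i → i < n → ∀ {x} → d i * x ≈ 0# → x ≈ 0#
  cancel-zero i 0<i i<n h = cancel i 0<i i<n (trans h (sym (zeroʳ _)))

  q^p^ : ∀ j → q ^ j * p ^ j ≈ 1#
  q^p^ zero = *-identityˡ 1#
  q^p^ (suc j) = begin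
    q * q ^ j * (p * p ^ j)
      ≈⟨ solve 4 (λ a b c d → a :* b :* (c :* d) := a :* c :* (b :* d)) refl q (q ^ j) p (p ^ j) ⟩
    q * p * (q ^ j * p ^ j)
      ≈⟨ *-cong q*p≈1 (q^p^ j) ⟩
    1# * 1#
      ≈⟨ *-identityˡ 1# ⟩
    1# ∎

  -- First-order expansion of 1 - (1 - w)^k. With k = 2e it is the origin of the factor 2(a - b).
  d-multiple : ∀ k → d (k ℕ.* n) ≈ (k × 1#) * w
  d-multiple zero = trans (-‿inverseʳ 1#) (sym (zeroˡ w))
  d-multiple (suc k) = begin
    d (n ℕ.+ k ℕ.* n)
      ≈⟨ d-+ n (k ℕ.* n) ⟨
    w + q ^ n * d (k ℕ.* n)
      ≈⟨ +-congˡ (*-congˡ (d-multiple k)) ⟩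
    w + q ^ n * ((k × 1#) * w)
      ≈⟨ solve 2 (λ c e → let w = con 1ℤ :- e in
           w :+ e :* (c :* w) := (con 1ℤ :+ c) :* w :- c :* (w :* w)) refl (k × 1#) (q ^ n) ⟩
    (1# + k × 1#) * w - (k × 1#) * (w * w)
      ≈⟨ +-congˡ (-‿cong (trans (*-congˡ w*w≈0) (zeroʳ _))) ⟩
    (1# + k × 1#) * w - 0#
      ≈⟨ solve 1 (λ a → a :- con 0ℤ := a) refl _ ⟩
    (1# + k × 1#) * w ∎

  q^multiple : ∀ k {t} → Killed t → q ^ (k ℕ.* n) * t ≈ t
  q^multiple k {t} h = begin
    q ^ (k ℕ.* n) * t
      ≈⟨ solve 2 (λ a t → a :* t := t :- (con 1ℤ :- a) :* t) refl (q ^ (k ℕ.* n)) t ⟩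
    t - d (k ℕ.* n) * t
      ≈⟨ +-congˡ (-‿cong (*-congʳ (d-multiple k))) ⟩
    t - (k × 1#) * w * t
      ≈⟨ +-congˡ (-‿cong (trans (*-assoc _ _ _) (trans (*-congˡ h) (zeroʳ _)))) ⟩
    t - 0#
      ≈⟨ solve 1 (λ a → a :- con 0ℤ := a) refl t ⟩
    t ∎

  q^-reflect : ∀ k u j {t} → u ℕ.+ j ≡ k ℕ.* n → Killed t → q ^ u * t ≈ p ^ j * t
  q^-reflect k u j {t} e h = begin
    q ^ u * t
      ≈⟨ *-congˡ (*-identityˡ t) ⟨
    q ^ u * (1# * t)
      ≈⟨ *-congˡ (*-congʳ (q^p^ j)) ⟨
    q ^ u * (q ^ j * p ^ j * t)
      ≈⟨ solve 4 (λ a b c t → a :* (b :* c :* t) := a :* b :* (c :* t)) refl (q ^ u) (q ^ j) (p ^ j) t ⟩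
    q ^ u * q ^ j * (p ^ j * t)
      ≈⟨ *-congʳ (trans (sym (^-homo-* q u j)) (^-congʳ q e)) ⟩
    q ^ (k ℕ.* n) * (p ^ j * t)
      ≈⟨ q^multiple k (killed-*ˡ (p ^ j) h) ⟩
    p ^ j * t ∎

  p^-reflect : ∀ k u j {t} → u ℕ.+ j ≡ k ℕ.* n → Killed t → p ^ u * t ≈ q ^ j * t
  p^-reflect k u j {t} e h = begin
    p ^ u * t
      ≈⟨ *-congˡ (trans (*-congʳ (trans (sym (^-homo-* q u j)) (^-congʳ q e))) (q^multiple k h)) ⟨
    p ^ u * (q ^ u * q ^ j * t)
      ≈⟨ solve 4 (λ a b c t → c :* (a :* b :* t) := a :* c :* (b :* t)) refl (q ^ u) (q ^ j) (p ^ u) t ⟩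
    q ^ u * p ^ u * (q ^ j * t)
      ≈⟨ trans (*-congʳ (q^p^ u)) (*-identityˡ _) ⟩
    q ^ j * t ∎

  q^-drop : ∀ k j {t} → Killed t → q ^ (k ℕ.* n ℕ.+ j) * t ≈ q ^ j * t
  q^-drop k j {t} h = trans (*-congʳ (^-homo-* q (k ℕ.* n) j))
    (trans (*-assoc _ _ _) (q^multiple k (killed-*ˡ (q ^ j) h)))

  d-drop : ∀ k j {t} → Killed t → d (k ℕ.* n ℕ.+ j) * t ≈ d j * t
  d-drop k j {t} h = begin
    d (k ℕ.* n ℕ.+ j) * t            ≈⟨ solve 2 (λ a t → (con 1ℤ :- a) :* t := t :- a :* t) refl _ t ⟩
    t - q ^ (k ℕ.* n ℕ.+ j) * t      ≈⟨ +-congˡ (-‿cong (q^-drop k j h)) ⟩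
    t - q ^ j * t                    ≈⟨ solve 2 (λ a t → (con 1ℤ :- a) :* t := t :- a :* t) refl _ t ⟨
    d j * t                          ∎

  Qd≈d : ∀ j → Q.d j ≈ d (j ℕ.+ j)
  Qd≈d j = +-congˡ (-‿cong (trans (^-distrib-* q q j) (sym (^-homo-* q j j))))

  Q-gauss-move : ∀ u v → Q.gauss u (suc v) * Q.d (suc v) ≈ Q.gauss (suc u) v * Q.d (suc u)
  Q-gauss-move u v = trans (Q.gauss-sucʳ u v) (sym (Q.gauss-sucˡ u v))

  -- The numerator factors 1 - q^(l + 1), ..., 1 - q^(l + i) act on killed elements only through l
  -- modulo n, and the denominator factors are cancellable because i < n. Absorption turns this into
  -- an induction on i.
  gauss-drop : ∀ k l i {t} → i < n → Killed t → gauss i (k ℕ.* n ℕ.+ l) * t ≈ gauss i l * t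
  gauss-drop k l zero i<n kt = refl
  gauss-drop k l (suc i) {t} i<n kt = cancel (suc i) (s≤s z≤n) i<n (begin
    d (suc i) * (gauss (suc i) kn+l * t)
      ≈⟨ solve 3 (λ d g t → d :* (g :* t) := g :* d :* t) refl _ _ t ⟩
    gauss (suc i) kn+l * d (suc i) * t
      ≈⟨ *-congʳ (gauss-sucˡ i kn+l) ⟩
    gauss i kn+l * d (suc i ℕ.+ kn+l) * t
      ≈⟨ solve 3 (λ d g t → g :* d :* t := g :* (d :* t)) refl _ _ t ⟩
    gauss i kn+l * (d (suc i ℕ.+ kn+l) * t)
      ≈⟨ *-congˡ (trans (*-congʳ (reflexive (≡.cong d (shuffle (suc i) (k ℕ.* n) l)))) (d-drop k (suc i ℕ.+ l) kt)) ⟩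
    gauss i kn+l * (d (suc i ℕ.+ l) * t)
      ≈⟨ gauss-drop k l i (ℕ.<-trans (ℕ.n<1+n i) i<n) (killed-*ˡ _ kt) ⟩
    gauss i l * (d (suc i ℕ.+ l) * t)
      ≈⟨ *-assoc _ _ _ ⟨
    gauss i l * d (suc i ℕ.+ l) * t
      ≈⟨ *-congʳ (gauss-sucˡ i l) ⟨
    gauss (suc i) l * d (suc i) * t
      ≈⟨ solve 3 (λ d g t → d :* (g :* t) := g :* d :* t) refl _ _ t ⟨
    d (suc i) * (gauss (suc i) l * t) ∎)
    where
    kn+l = k ℕ.* n ℕ.+ l
    shuffle : ∀ i m l → i ℕ.+ (m ℕ.+ l) ≡ m ℕ.+ (i ℕ.+ l)
    shuffle = solve-∀

  -- Since a and b agree only on killed elements, powers are compared one factor at a time, each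
  -- time against an element that is still killed.
  killed-^ : ∀ a b → (∀ {t} → Killed t → a * t ≈ b * t) → ∀ m {t} → Killed t → a ^ m * t ≈ b ^ m * t
  killed-^ a b h zero kt = refl
  killed-^ a b h (suc m) {t} kt = begin
    a * a ^ m * t     ≈⟨ *-assoc _ _ _ ⟩
    a * (a ^ m * t)   ≈⟨ h (killed-*ˡ (a ^ m) kt) ⟩
    b * (a ^ m * t)   ≈⟨ *-congˡ (killed-^ a b h m kt) ⟩
    b * (b ^ m * t)   ≈⟨ *-assoc _ _ _ ⟨
    b * b ^ m * t     ∎

  q^-P-d : ∀ j → q ^ j * P.d j ≈ - d j
  q^-P-d j = begin
    q ^ j * (1# - p ^ j)      ≈⟨ solve 2 (λ a b → a :* (con 1ℤ :- b) := a :- a :* b) refl (q ^ j) (p ^ j) ⟩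
    q ^ j - q ^ j * p ^ j     ≈⟨ +-congˡ (-‿cong (q^p^ j)) ⟩
    q ^ j - 1#                ≈⟨ solve 1 (λ a → a :- con 1ℤ := :- (con 1ℤ :- a)) refl (q ^ j) ⟩
    - d j                     ∎

  -- As p^n inverts 1 - w, it is 1 + w up to w^2.
  P-d-n : P.d n ≈ - w
  P-d-n = begin
    P.d n                    ≈⟨ *-identityˡ _ ⟨
    1# * P.d n               ≈⟨ solve 2 (λ a b → con 1ℤ :* b := (con 1ℤ :- a) :* b :+ a :* b) refl (q ^ n) (P.d n) ⟩
    w * P.d n + q ^ n * P.d n  ≈⟨ +-cong w*Pd (q^-P-d n) ⟩
    0# - w                   ≈⟨ +-identityˡ _ ⟩
    - w                      ∎
    where
    w*Pd : w * P.d n ≈ 0#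
    w*Pd = begin
      w * P.d n      ≈⟨ solve 2 (λ w b → w :* (con 1ℤ :- b) := w :- b :* w) refl w (p ^ n) ⟩
      w - p ^ n * w  ≈⟨ +-congˡ (-‿cong (p^-reflect 1 n 0 ≡.refl w*w≈0)) ⟩
      w - 1# * w     ≈⟨ solve 1 (λ w → w :- con 1ℤ :* w := con 0ℤ) refl w ⟩
      0#             ∎

  -- σ k = (-1)^k q^(k (k + 1) / 2)
  σ : ℕ → Carrier
  σ zero = 1#
  σ (suc k) = - (q ^ suc k) * σ k

  -- Modulo q^n = 1 the numerator factor 1 - p^(l + i) is 1 - q^(n - l - i), while 1 - p^i = -q^(-i)
  -- (1 - q^i) in the denominator contributes the sign and the power collected in σ. The induction
  -- moves (k + 1, l) to (k, l + 1) and so keeps m fixed.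
  gauss-reflect : ∀ k l m → k < n → k ℕ.+ l ℕ.+ suc m ≡ n → w * P.gauss k l ≈ w * (σ k * gauss k m)
  gauss-reflect zero l m _ _ = *-congˡ (sym (*-identityˡ 1#))
  gauss-reflect (suc k) l m k<n h = cancel (suc k) (s≤s z≤n) k<n (begin
    d (suc k) * (w * P.gauss (suc k) l)
      ≈⟨ solve 2 (λ d x → d :* x := :- (:- d :* x)) refl _ _ ⟩
    - (- d (suc k) * (w * P.gauss (suc k) l))
      ≈⟨ -‿cong (*-congʳ (q^-P-d (suc k))) ⟨
    - (Q′ * P.d (suc k) * (w * P.gauss (suc k) l))
      ≈⟨ solve 4 (λ a b w g → :- (a :* b :* (w :* g)) := :- a :* (w :* (g :* b))) refl Q′ (P.d (suc k)) w _ ⟩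
    - Q′ * (w * (P.gauss (suc k) l * P.d (suc k)))
      ≈⟨ *-congˡ (*-congˡ (trans (P.gauss-sucˡ k l) (sym (P.gauss-sucʳ k l)))) ⟩
    - Q′ * (w * (P.gauss k (suc l) * P.d (suc l)))
      ≈⟨ *-congˡ (trans (sym (*-assoc _ _ _)) (*-congʳ (gauss-reflect k (suc l) m (ℕ.<-trans (ℕ.n<1+n k) k<n)
           (≡.trans (≡.cong (ℕ._+ suc m) (ℕ.+-suc k l)) h)))) ⟩
    - Q′ * (w * (σ k * gauss k m) * P.d (suc l))
      ≈⟨ solve 5 (λ a w s g b → a :* (w :* (s :* g) :* b) := a :* s :* (g :* (b :* w))) refl (- Q′) w (σ k) _ _ ⟩
    σ (suc k) * (gauss k m * (P.d (suc l) * w))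
      ≈⟨ *-congˡ (*-congˡ P-d-reflect) ⟩
    σ (suc k) * (gauss k m * (d (suc k ℕ.+ m) * w))
      ≈⟨ *-congˡ (trans (sym (*-assoc _ _ _)) (*-congʳ (sym (gauss-sucˡ k m)))) ⟩
    σ (suc k) * (gauss (suc k) m * d (suc k) * w)
      ≈⟨ solve 4 (λ s g d w → s :* (g :* d :* w) := d :* (w :* (s :* g))) refl (σ (suc k)) _ _ w ⟩
    d (suc k) * (w * (σ (suc k) * gauss (suc k) m)) ∎)
    where
    Q′ = q ^ suc k
    shuffle : ∀ k l m → suc l ℕ.+ (suc k ℕ.+ m) ≡ suc k ℕ.+ l ℕ.+ suc m
    shuffle = solve-∀
    P-d-reflect : P.d (suc l) * w ≈ d (suc k ℕ.+ m) * w
    P-d-reflect = begin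
      P.d (suc l) * w              ≈⟨ solve 2 (λ b w → (con 1ℤ :- b) :* w := w :- b :* w) refl _ w ⟩
      w - p ^ suc l * w            ≈⟨ +-congˡ (-‿cong (p^-reflect 1 (suc l) (suc k ℕ.+ m)
                                        (≡.trans (shuffle k l m) (≡.trans h (≡.sym (ℕ.+-identityʳ n)))) w*w≈0)) ⟩
      w - q ^ (suc k ℕ.+ m) * w    ≈⟨ solve 2 (λ b w → (con 1ℤ :- b) :* w := w :- b :* w) refl _ w ⟨
      d (suc k ℕ.+ m) * w          ∎

  lucas-reflect : ∀ i l → suc i ℕ.+ (suc i ℕ.+ l) ≡ n →
    d (suc i) * P.lucas (suc i) l ≈ q ^ suc i * (w * P.gauss i l)
  lucas-reflect i l h = begin
    d (suc i) * P.lucas (suc i) l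
      ≈⟨ solve 2 (λ d x → d :* x := :- (:- d :* x)) refl _ _ ⟩
    - (- d (suc i) * P.lucas (suc i) l)
      ≈⟨ -‿cong (*-congʳ (q^-P-d (suc i))) ⟨
    - (q ^ suc i * P.d (suc i) * P.lucas (suc i) l)
      ≈⟨ solve 3 (λ a b g → :- (a :* b :* g) := :- (a :* (g :* b))) refl _ _ _ ⟩
    - (q ^ suc i * (P.lucas (suc i) l * P.d (suc i)))
      ≈⟨ -‿cong (*-congˡ (trans (P.lucas-suc i l) (*-congʳ (trans (reflexive (≡.cong P.d h)) P-d-n)))) ⟩
    - (q ^ suc i * (- w * P.gauss i l))
      ≈⟨ solve 3 (λ a w g → :- (a :* (:- w :* g)) := a :* (w :* g)) refl _ w _ ⟩
    q ^ suc i * (w * P.gauss i l) ∎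

  -- Both exponents are i(i + 1)/2, one of p and one of q, and the signs differ by one factor -1.
  coeff-σ : ∀ i → P.coeff 0 (suc i) * σ i ≈ - 1#
  coeff-σ zero = trans (*-identityʳ _) (*-identityʳ _)
  coeff-σ (suc i) = begin
    - 1# * P.coeff 1 (suc i) * (- (q ^ suc i) * σ i)
      ≈⟨ *-congʳ (*-congˡ (P.coeff-suc 0 (suc i))) ⟩
    - 1# * (p ^ suc i * P.coeff 0 (suc i)) * (- (q ^ suc i) * σ i)
      ≈⟨ solve 4 (λ b c a s → :- con 1ℤ :* (b :* c) :* (:- a :* s) := a :* b :* (c :* s)) refl
           (p ^ suc i) (P.coeff 0 (suc i)) (q ^ suc i) (σ i) ⟩
    q ^ suc i * p ^ suc i * (P.coeff 0 (suc i) * σ i)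
      ≈⟨ *-cong (q^p^ (suc i)) (coeff-σ i) ⟩
    1# * - 1#
      ≈⟨ *-identityˡ _ ⟩
    - 1# ∎

  -- Here e stands for a - b, and `y₀` is [an; bn] in base q^2. `W` is `y₀` times 1 - q^(2en), the
  -- common nilpotent factor of all summands with j ≥ 1.
  module Fixed (e b : ℕ) where
    U = e ℕ.* n
    B = b ℕ.* n
    N = (2 ℕ.* e) × 1#
    y₀ = Q.gauss U B
    W = w * (N * y₀)

    killed-W : ∀ a → Killed (a * W)
    killed-W a = killed-*ˡ a (trans (sym (*-assoc _ _ _)) (trans (*-congʳ w*w≈0) (zeroˡ _)))

    -- κ i = (-1)^i p^(i (i + 1))
    κ : ℕ → Carrier
    κ zero = 1#
    κ (suc i) = - (p ^ (suc i ℕ.+ suc i)) * κ i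

    double-+ : ∀ k j → (k ℕ.* n ℕ.+ j) ℕ.+ (k ℕ.* n ℕ.+ j) ≡ (2 ℕ.* k) ℕ.* n ℕ.+ (j ℕ.+ j)
    double-+ k j = identity k n j
      where
      identity : ∀ k n j → (k ℕ.* n ℕ.+ j) ℕ.+ (k ℕ.* n ℕ.+ j) ≡ (2 ℕ.* k) ℕ.* n ℕ.+ (j ℕ.+ j)
      identity = solve-∀

    double-reflect : ∀ u j → u ℕ.+ j ≡ U → (u ℕ.+ u) ℕ.+ (j ℕ.+ j) ≡ (2 ℕ.* e) ℕ.* n
    double-reflect u j h = ≡.trans (shuffle u j) (≡.trans (≡.cong (λ m → m ℕ.+ m) h) (double e n))
      where
      shuffle : ∀ u j → (u ℕ.+ u) ℕ.+ (j ℕ.+ j) ≡ (u ℕ.+ j) ℕ.+ (u ℕ.+ j)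
      shuffle = solve-∀
      double : ∀ e n → e ℕ.* n ℕ.+ e ℕ.* n ≡ (2 ℕ.* e) ℕ.* n
      double = solve-∀

    -- A bootstrap: w t is killed for any t, so multiplying the equation by w already allows
    -- reduction modulo q^n = 1 and cancellation of 1 - q^(2j). This shows that t is killed, and
    -- then the reduction applies to t itself.
    reduce : ∀ j {t z} → 0 < j → j ℕ.+ j < n → t * Q.d (B ℕ.+ j) ≈ z → Killed z →
      Killed t Data.Product.× t * Q.d j ≈ z
    reduce j {t} {z} 0<j 2j<n h kz = kt , trans (*-comm _ _) (trans (*-congʳ (Qd≈d j)) (trans (sym (d-t kt))
      (trans (*-congʳ (sym Qd-B)) (trans (*-comm _ _) h))))
      where
      Qd-B : Q.d (B ℕ.+ j) ≈ d ((2 ℕ.* b) ℕ.* n ℕ.+ (j ℕ.+ j))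
      Qd-B = trans (Qd≈d (B ℕ.+ j)) (reflexive (≡.cong d (double-+ b j)))
      d-t : ∀ {s} → Killed s → d ((2 ℕ.* b) ℕ.* n ℕ.+ (j ℕ.+ j)) * s ≈ d (j ℕ.+ j) * s
      d-t = d-drop (2 ℕ.* b) (j ℕ.+ j)
      kt : Killed t
      kt = cancel-zero (j ℕ.+ j) (ℕ.<-≤-trans 0<j (ℕ.m≤m+n j j)) 2j<n (begin
        d (j ℕ.+ j) * (w * t)
          ≈⟨ d-t (trans (sym (*-assoc _ _ _)) (trans (*-congʳ w*w≈0) (zeroˡ _))) ⟨
        d ((2 ℕ.* b) ℕ.* n ℕ.+ (j ℕ.+ j)) * (w * t)
          ≈⟨ *-congʳ Qd-B ⟨
        Q.d (B ℕ.+ j) * (w * t)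
          ≈⟨ solve 3 (λ a w t → a :* (w :* t) := w :* (t :* a)) refl _ w t ⟩
        w * (t * Q.d (B ℕ.+ j))
          ≈⟨ *-congˡ h ⟩
        w * z
          ≈⟨ kz ⟩
        0# ∎)

    -- Walk along row an of the q^2-binomials, starting at `y₀`, where 1 - q^(2en) = 2e w. One step
    -- trades the factor 1 - q^(2j) for 1 - q^(2u); as u is -j modulo n, the latter is 1 - p^(2j) =
    -- -p^(2j) (1 - q^(2j)), so each step contributes -p^(2j) to κ. Cancellation of 1 - q^(2j)
    -- forces 2j < n.
    column : ∀ i u → i ℕ.+ i < n → u ℕ.+ i ≡ U → Q.gauss u (B ℕ.+ i) * Q.d u ≈ κ i * W
    column-killed : ∀ i u → suc i ℕ.+ suc i < n → u ℕ.+ suc i ≡ U →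
      Killed (Q.gauss u (B ℕ.+ suc i)) Data.Product.× Q.gauss u (B ℕ.+ suc i) * Q.d (suc i) ≈ κ i * W

    column zero u _ h = begin
      Q.gauss u (B ℕ.+ 0) * Q.d u
        ≡⟨ ≡.cong₂ (λ u v → Q.gauss u v * Q.d u) (≡.trans (≡.sym (ℕ.+-identityʳ u)) h) (ℕ.+-identityʳ B) ⟩
      y₀ * Q.d U
        ≈⟨ *-congˡ (trans (Qd≈d U) (trans (reflexive (≡.cong d U+U)) (d-multiple (2 ℕ.* e)))) ⟩
      y₀ * (N * w)
        ≈⟨ solve 3 (λ y N w → y :* (N :* w) := con 1ℤ :* (w :* (N :* y))) refl y₀ N w ⟩
      1# * W ∎
      where
      U+U : U ℕ.+ U ≡ (2 ℕ.* e) ℕ.* n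
      U+U = ≡.trans (≡.sym (ℕ.+-identityʳ (U ℕ.+ U))) (double-reflect U 0 (ℕ.+-identityʳ U))
    column (suc i) u 2i<n h with column-killed i u 2i<n h
    ... | kt , eq = begin
      t * Q.d u
        ≈⟨ trans (*-comm _ _) (*-congʳ (Qd≈d u)) ⟩
      (1# - q ^ (u ℕ.+ u)) * t
        ≈⟨ solve 2 (λ a t → (con 1ℤ :- a) :* t := t :- a :* t) refl _ t ⟩
      t - q ^ (u ℕ.+ u) * t
        ≈⟨ +-congˡ (-‿cong (q^-reflect (2 ℕ.* e) (u ℕ.+ u) jj (double-reflect u j h) kt)) ⟩
      t - p ^ jj * t
        ≈⟨ +-congʳ (trans (sym (*-identityˡ t)) (*-congʳ (sym (q^p^ jj)))) ⟩
      q ^ jj * p ^ jj * t - p ^ jj * t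
        ≈⟨ solve 3 (λ a b t → a :* b :* t :- b :* t := :- b :* ((con 1ℤ :- a) :* t)) refl (q ^ jj) (p ^ jj) t ⟩
      - (p ^ jj) * (d jj * t)
        ≈⟨ *-congˡ (trans (*-congʳ (sym (Qd≈d j))) (trans (*-comm _ _) eq)) ⟩
      - (p ^ jj) * (κ i * W)
        ≈⟨ *-assoc _ _ _ ⟨
      κ (suc i) * W ∎
      where
      j = suc i
      jj = j ℕ.+ j
      t = Q.gauss u (B ℕ.+ j)

    column-killed i u 2j<n h = reduce (suc i) (s≤s z≤n) 2j<n
      (begin
        Q.gauss u (B ℕ.+ suc i) * Q.d (B ℕ.+ suc i)
          ≡⟨ ≡.cong (λ v → Q.gauss u v * Q.d v) (ℕ.+-suc B i) ⟩
        Q.gauss u (suc (B ℕ.+ i)) * Q.d (suc (B ℕ.+ i))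
          ≈⟨ Q-gauss-move u (B ℕ.+ i) ⟩
        Q.gauss (suc u) (B ℕ.+ i) * Q.d (suc u)
          ≈⟨ column i (suc u) (ℕ.<-trans (ℕ.+-mono-< (ℕ.n<1+n i) (ℕ.n<1+n i)) 2j<n)
               (≡.trans (≡.sym (ℕ.+-suc u i)) h) ⟩
        κ i * W ∎)
      (killed-W (κ i))

    -- Covers j = n/2 as well. Multiplying by 1 - q^j lets the q-binomial absorb it and release 1 -
    -- q^(2(bn + j)), which is the factor wanted for one step in the row of the q^2-binomial; thus
    -- `column` is invoked only at i = j - 1.
    column-product : ∀ i u → i ℕ.+ i < n → suc i < n → u ℕ.+ suc i ≡ U →
      d (suc i) * (Q.gauss u (B ℕ.+ suc i) * gauss (suc i) ((2 ℕ.* b) ℕ.* n ℕ.+ suc i)) ≈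
      κ i * W * gauss i (suc i)
    column-product i u 2i<n j<n h = begin
      d j * (t * gauss j l)
        ≈⟨ solve 3 (λ d t g → d :* (t :* g) := t :* (g :* d)) refl (d j) t (gauss j l) ⟩
      t * (gauss j l * d j)
        ≈⟨ *-congˡ (gauss-sucˡ i l) ⟩
      t * (gauss i l * d (j ℕ.+ l))
        ≈⟨ *-congˡ (*-congˡ (trans (reflexive (≡.cong d top)) (sym (Qd≈d (B ℕ.+ j))))) ⟩
      t * (gauss i l * Q.d (B ℕ.+ j))
        ≈⟨ solve 3 (λ d t g → t :* (g :* d) := g :* (t :* d)) refl _ _ _ ⟩
      gauss i l * (t * Q.d (B ℕ.+ j))
        ≡⟨ ≡.cong (λ v → gauss i l * (Q.gauss u v * Q.d v)) (ℕ.+-suc B i) ⟩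
      gauss i l * (Q.gauss u (suc (B ℕ.+ i)) * Q.d (suc (B ℕ.+ i)))
        ≈⟨ *-congˡ (Q-gauss-move u (B ℕ.+ i)) ⟩
      gauss i l * (Q.gauss (suc u) (B ℕ.+ i) * Q.d (suc u))
        ≈⟨ *-congˡ (column i (suc u) 2i<n (≡.trans (≡.sym (ℕ.+-suc u i)) h)) ⟩
      gauss i l * (κ i * W)
        ≈⟨ gauss-drop (2 ℕ.* b) j i (ℕ.<-trans (ℕ.n<1+n i) j<n) (killed-W (κ i)) ⟩
      gauss i j * (κ i * W)
        ≈⟨ *-comm _ _ ⟩
      κ i * W * gauss i j ∎
      where
      j = suc i
      l = (2 ℕ.* b) ℕ.* n ℕ.+ j
      t = Q.gauss u (B ℕ.+ j)
      top : j ℕ.+ l ≡ (B ℕ.+ j) ℕ.+ (B ℕ.+ j)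
      top = identity b n j
        where
        identity : ∀ b n j → j ℕ.+ ((2 ℕ.* b) ℕ.* n ℕ.+ j) ≡ (b ℕ.* n ℕ.+ j) ℕ.+ (b ℕ.* n ℕ.+ j)
        identity = solve-∀

    -- For u = U - j this is the summand k = u of the given sum: 2an - 2u = 2bn + 2j and an - bn - u
    -- = j. Keeping u separate permits transport along the truncated subtraction.
    summandAt : ℕ → ℕ → Carrier
    summandAt u j = (- 1#) ^ u * q ^ (u ℕ.* u) * Q.gauss u (B ℕ.+ j) * gauss j ((2 ℕ.* b) ℕ.* n ℕ.+ j)

    summand : ℕ → Carrier
    summand j = summandAt (U ∸ j) j

    x₀ : Carrier
    x₀ = (- 1#) ^ U * q ^ (U ℕ.* U) * y₀

    -- Since u is -j modulo n, the squares agree modulo n. The two sign changes are made one after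
    -- the other, with p as the intermediate base.
    q^[u*u] : ∀ u j → u ℕ.+ j ≡ U → q ^ (u ℕ.* u) * w ≈ q ^ (j ℕ.* j) * w
    q^[u*u] u j h = begin
      q ^ (u ℕ.* u) * w    ≈⟨ *-congʳ (^-assocʳ q u u) ⟨
      (q ^ u) ^ u * w      ≈⟨ killed-^ (q ^ u) (p ^ j) (q^-reflect e u j h) u w*w≈0 ⟩
      (p ^ j) ^ u * w      ≈⟨ *-congʳ (^-assocʳ p j u) ⟩
      p ^ (j ℕ.* u) * w    ≈⟨ *-congʳ (trans (^-congʳ p (ℕ.*-comm j u)) (sym (^-assocʳ p u j))) ⟩
      (p ^ u) ^ j * w      ≈⟨ killed-^ (p ^ u) (q ^ j) (p^-reflect e u j h) j w*w≈0 ⟩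
      (q ^ j) ^ j * w      ≈⟨ *-congʳ (^-assocʳ q j j) ⟩
      q ^ (j ℕ.* j) * w    ∎

    q^[U*U] : q ^ (U ℕ.* U) * w ≈ w
    q^[U*U] = trans (*-congʳ (^-congʳ q (≡.sym (ℕ.*-assoc U e n)))) (q^multiple (U ℕ.* e) w*w≈0)

    -- The exponents balance as (i + 1)^2 - i(i + 1) = i + 1.
    q^κ : ∀ i → q ^ (suc i ℕ.* suc i) * κ i ≈ (- 1#) ^ i * q ^ suc i
    q^κ zero = trans (*-identityʳ _) (sym (*-identityˡ _))
    q^κ (suc i) = begin
      q ^ (suc j ℕ.* suc j) * (- (p ^ jj) * κ i)
        ≈⟨ *-congʳ (trans (^-congʳ q (square j)) (*-congˡ (^-homo-* q jj (j ℕ.* j)))) ⟩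
      q * (q ^ jj * q ^ (j ℕ.* j)) * (- (p ^ jj) * κ i)
        ≈⟨ solve 5 (λ q a b c k → q :* (a :* b) :* (:- c :* k) := a :* c :* (:- q :* (b :* k))) refl
             q (q ^ jj) (q ^ (j ℕ.* j)) (p ^ jj) (κ i) ⟩
      q ^ jj * p ^ jj * (- q * (q ^ (j ℕ.* j) * κ i))
        ≈⟨ *-cong (q^p^ jj) (*-congˡ (q^κ i)) ⟩
      1# * (- q * ((- 1#) ^ i * q ^ j))
        ≈⟨ solve 3 (λ q s a → con 1ℤ :* (:- q :* (s :* a)) := :- con 1ℤ :* s :* (q :* a)) refl q _ (q ^ j) ⟩
      (- 1#) ^ suc i * q ^ suc j ∎
      where
      j = suc i
      jj = j ℕ.+ j
      square : ∀ j → suc j ℕ.* suc j ≡ suc ((j ℕ.+ j) ℕ.+ j ℕ.* j)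
      square = solve-∀

    summand-suc : ∀ i l → suc i ℕ.+ (suc i ℕ.+ l) ≡ n → suc i ≤ U →
      summand (suc i) ≈ N * x₀ * (P.coeff 0 (suc i) * P.lucas (suc i) l)
    summand-suc i l h j≤U = cancel j (s≤s z≤n) j<n (begin
      d j * summand j
        ≈⟨ solve 5 (λ d s a t g → d :* (s :* a :* t :* g) := s :* a :* (d :* (t :* g))) refl
             (d j) s_u (q ^ (u ℕ.* u)) _ _ ⟩
      s_u * q ^ (u ℕ.* u) * (d j * (Q.gauss u (B ℕ.+ j) * gauss j ((2 ℕ.* b) ℕ.* n ℕ.+ j)))
        ≈⟨ *-congˡ (column-product i u 2i<n j<n u+j) ⟩
      s_u * q ^ (u ℕ.* u) * (κ i * (w * (N * y₀)) * g)
        ≈⟨ solve 7 (λ s a k w N y g → s :* a :* (k :* (w :* (N :* y)) :* g) := a :* w :* (k :* s :* N :* y :* g)) refl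
             s_u (q ^ (u ℕ.* u)) (κ i) w N y₀ g ⟩
      q ^ (u ℕ.* u) * w * (κ i * s_u * N * y₀ * g)
        -- The factor w released from `W` is what allows exponents of q to be reduced modulo n.
        ≈⟨ *-congʳ (q^[u*u] u j u+j) ⟩
      q ^ (j ℕ.* j) * w * (κ i * s_u * N * y₀ * g)
        ≈⟨ solve 7 (λ a w k s N y g → a :* w :* (k :* s :* N :* y :* g) := a :* k :* (w :* s :* N :* y :* g)) refl
             (q ^ (j ℕ.* j)) w (κ i) s_u N y₀ g ⟩
      q ^ (j ℕ.* j) * κ i * (w * s_u * N * y₀ * g)
        ≈⟨ *-congʳ (q^κ i) ⟩
      (- 1#) ^ i * q ^ j * (w * s_u * N * y₀ * g)
        ≈⟨ solve 7 (λ t a w s N y g → t :* a :* (w :* s :* N :* y :* g) :=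
             w :* (s :* (:- con 1ℤ :* t) :* (:- con 1ℤ) :* a :* N :* y :* g)) refl
             ((- 1#) ^ i) (q ^ j) w s_u N y₀ g ⟩
      w * (s_u * (- 1#) ^ j * - 1# * q ^ j * N * y₀ * g)
        -- Factors are inserted here: w absorbs q^(U^2), U being a multiple of n, and - 1# is
        -- replaced by `coeff 0 j * σ i`. They complete `x₀` and the theta summand.
        ≈⟨ *-cong (sym q^[U*U]) (*-congʳ (*-congʳ (*-congʳ (*-congʳ (*-cong sign-U (sym (coeff-σ i))))))) ⟩
      q ^ (U ℕ.* U) * w * ((- 1#) ^ U * (P.coeff 0 j * σ i) * q ^ j * N * y₀ * g)
        ≈⟨ solve 9 (λ a w s c σ b N y g → a :* w :* (s :* (c :* σ) :* b :* N :* y :* g) :=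
             N :* (s :* a :* y) :* (c :* (b :* (w :* (σ :* g))))) refl
             (q ^ (U ℕ.* U)) w ((- 1#) ^ U) (P.coeff 0 j) (σ i) (q ^ j) N y₀ g ⟩
      N * x₀ * (P.coeff 0 j * (q ^ j * (w * (σ i * g))))
        -- The reflection is used with m = j, because i + l + (j + 1) = n.
        ≈⟨ *-congˡ (*-congˡ (trans (lucas-reflect i l h)
             (*-congˡ (gauss-reflect i l j (ℕ.<-trans (ℕ.n<1+n i) j<n) (≡.trans (identity i l) h))))) ⟨
      N * x₀ * (P.coeff 0 j * (d j * P.lucas j l))
        ≈⟨ solve 4 (λ N c d L → N :* (c :* (d :* L)) := d :* (N :* (c :* L))) refl (N * x₀) _ (d j) _ ⟩
      d j * (N * x₀ * (P.coeff 0 j * P.lucas j l)) ∎)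
      where
      j = suc i
      u = U ∸ j
      g = gauss i j
      s_u = (- 1#) ^ u
      u+j = ℕ.m∸n+n≡m j≤U
      j<n : j < n
      j<n = ≡.subst (j <_) h (ℕ.m<m+n j (s≤s z≤n))
      2i<n : i ℕ.+ i < n
      2i<n = ≡.subst (i ℕ.+ i <_) h (s≤s (ℕ.+-monoʳ-≤ i (ℕ.≤-trans (ℕ.n≤1+n i) (ℕ.m≤m+n (suc i) l))))
      sign-U : s_u * (- 1#) ^ j ≈ (- 1#) ^ U
      sign-U = trans (sym (^-homo-* (- 1#) u j)) (^-congʳ (- 1#) u+j)
      identity : ∀ i l → i ℕ.+ l ℕ.+ suc (suc i) ≡ suc i ℕ.+ (suc i ℕ.+ l)
      identity = solve-∀

    ∑-summand : 0 < n → 0 < e → ∑ (λ j l → summand j) n ≈ x₀ * (1# - N * (1# - P.L n))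
    ∑-summand 0<n 0<e = begin
      ∑ (λ j l → summand j) n
        ≈⟨ ∑-cong n pointwise ⟩
      ∑ (λ j l → N * x₀ * (P.coeff 0 j * P.lucas j l) + (x₀ - N * x₀) * δ j l) n
        ≈⟨ ∑-+ _ (λ j l → (x₀ - N * x₀) * δ j l) n ⟩
      ∑ (λ j l → N * x₀ * (P.coeff 0 j * P.lucas j l)) n + ∑ (λ j l → (x₀ - N * x₀) * δ j l) n
        ≈⟨ +-cong (∑-*ˡ (N * x₀) _ n) (trans (∑-*ˡ (x₀ - N * x₀) δ n) (*-congˡ (∑-δ n))) ⟩
      N * x₀ * P.L n + (x₀ - N * x₀) * 1#
        ≈⟨ solve 3 (λ N x L → N :* x :* L :+ (x :- N :* x) :* con 1ℤ := x :* (con 1ℤ :- N :* (con 1ℤ :- L)))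
             refl N x₀ (P.L n) ⟩
      x₀ * (1# - N * (1# - P.L n)) ∎
      where
      -- Indicator of j = 0. The summand there is x₀ and not N x₀ times the theta summand 1, so the
      -- uniform formula needs the correction x₀ - N x₀ at this index.
      δ : ℕ → ℕ → Carrier
      δ zero l = 1#
      δ (suc j) l = 0#
      ∑-0 : ∀ m → ∑ (λ j l → 0#) m ≈ 0#
      ∑-0 zero = refl
      ∑-0 (suc zero) = refl
      ∑-0 (suc (suc m)) = trans (+-identityˡ _) (∑-0 m)
      ∑-δ : ∀ m → ∑ δ m ≈ 1#
      ∑-δ zero = refl
      ∑-δ (suc zero) = refl
      ∑-δ (suc (suc m)) = trans (+-congˡ (∑-0 m)) (+-identityʳ 1#)

      n≤U : n ≤ U
      n≤U = ≡.subst (_≤ U) (ℕ.*-identityˡ n) (ℕ.*-monoˡ-≤ n 0<e)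
      pointwise : ∀ j l → j ℕ.+ (j ℕ.+ l) ≡ n →
        summand j ≈ N * x₀ * (P.coeff 0 j * P.lucas j l) + (x₀ - N * x₀) * δ j l
      pointwise zero l _ = trans (*-identityʳ _)
        (trans (*-congˡ (reflexive (≡.cong (Q.gauss U) (ℕ.+-identityʳ B))))
          (solve 2 (λ N x → x := N :* x :* (con 1ℤ :* con 1ℤ) :+ (x :- N :* x) :* con 1ℤ) refl N x₀))
      pointwise (suc i) l h = trans
        (summand-suc i l h (ℕ.≤-trans (ℕ.≤-trans (ℕ.m≤m+n (suc i) (suc i ℕ.+ l)) (ℕ.≤-reflexive h)) n≤U))
        (solve 2 (λ a b → a := a :+ b :* con 0ℤ) refl _ (x₀ - N * x₀))

-- The commutative ring of integer coefficient lists.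

module PolynomialRing where
  coeffₚ : Poly → ℕ → ℤ
  coeffₚ [] i = 0ℤ
  coeffₚ (a ∷ p) zero = a
  coeffₚ (a ∷ p) (suc i) = coeffₚ p i

  infix 4 _≃_
  -- Lists may end in zeros, so equality is coefficientwise. The record keeps p and r recoverable
  -- from the type, which a bare family of equations would not.
  record _≃_ (p r : Poly) : Set where
    constructor coeffwise
    field coeff≡ : ∀ i → coeffₚ p i ≡ coeffₚ r i
  open _≃_ public

  coeff-+ : ∀ p r i → coeffₚ (p +ₚ r) i ≡ coeffₚ p i ℤ.+ coeffₚ r i
  coeff-+ [] r i = ≡.sym (ℤ.+-identityˡ _)
  coeff-+ (a ∷ p) [] i = ≡.sym (ℤ.+-identityʳ _)
  coeff-+ (a ∷ p) (b ∷ r) zero = ≡.refl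
  coeff-+ (a ∷ p) (b ∷ r) (suc i) = coeff-+ p r i

  coeff-neg : ∀ p i → coeffₚ (negₚ p) i ≡ ℤ.- coeffₚ p i
  coeff-neg [] i = ≡.refl
  coeff-neg (a ∷ p) zero = ≡.refl
  coeff-neg (a ∷ p) (suc i) = coeff-neg p i

  coeff-scale : ∀ c p i → coeffₚ (scaleₚ c p) i ≡ c ℤ.* coeffₚ p i
  coeff-scale c [] i = ≡.sym (ℤ.*-zeroʳ c)
  coeff-scale c (a ∷ p) zero = ≡.refl
  coeff-scale c (a ∷ p) (suc i) = coeff-scale c p i

  coeff-sub : ∀ p r i → coeffₚ (p -ₚ r) i ≡ coeffₚ p i ℤ.- coeffₚ r i
  coeff-sub p r i = ≡.trans (coeff-+ p (negₚ r) i) (≡.cong (λ z → coeffₚ p i ℤ.+ z) (coeff-neg r i))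

  ≃⇒≈ₚ : ∀ {p r} → p ≃ r → p ≈ₚ r
  ≃⇒≈ₚ {p} {r} h = isZero (p -ₚ r) (λ i → ≡.trans (coeff-sub p r i) (ℤ.i≡j⇒i-j≡0 (coeff≡ h i)))
    where
    isZero : ∀ p → (∀ i → coeffₚ p i ≡ 0ℤ) → IsZeroₚ p
    isZero [] h = []
    isZero (a ∷ p) h = h 0 ∷ isZero p (λ i → h (suc i))

  ≃-isEquivalence : IsEquivalence _≃_
  ≃-isEquivalence = record
    { refl = coeffwise λ i → ≡.refl
    ; sym = λ h → coeffwise λ i → ≡.sym (coeff≡ h i)
    ; trans = λ h k → coeffwise λ i → ≡.trans (coeff≡ h i) (coeff≡ k i)
    }

  open IsEquivalence ≃-isEquivalence

  +-cong : ∀ {p p′ r r′} → p ≃ p′ → r ≃ r′ → p +ₚ r ≃ p′ +ₚ r′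
  +-cong {p} {p′} {r} {r′} h k = coeffwise λ i → ≡.trans (coeff-+ p r i)
    (≡.trans (≡.cong₂ ℤ._+_ (coeff≡ h i) (coeff≡ k i)) (≡.sym (coeff-+ p′ r′ i)))

  +-assoc : ∀ p r s → (p +ₚ r) +ₚ s ≃ p +ₚ (r +ₚ s)
  +-assoc p r s = coeffwise λ i → ≡.trans (coeff-+ (p +ₚ r) s i) (≡.trans (≡.cong (ℤ._+ coeffₚ s i) (coeff-+ p r i))
    (≡.trans (ℤ.+-assoc (coeffₚ p i) (coeffₚ r i) (coeffₚ s i))
    (≡.sym (≡.trans (coeff-+ p (r +ₚ s) i) (≡.cong (λ z → coeffₚ p i ℤ.+ z) (coeff-+ r s i))))))

  +-comm : ∀ p r → p +ₚ r ≃ r +ₚ p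
  +-comm p r = coeffwise λ i → ≡.trans (coeff-+ p r i)
    (≡.trans (ℤ.+-comm (coeffₚ p i) (coeffₚ r i)) (≡.sym (coeff-+ r p i)))

  +-identityʳ : ∀ p → p +ₚ [] ≃ p
  +-identityʳ [] = refl
  +-identityʳ (a ∷ p) = refl

  neg-cong : ∀ {p r} → p ≃ r → negₚ p ≃ negₚ r
  neg-cong {p} {r} h = coeffwise λ i → ≡.trans (coeff-neg p i)
    (≡.trans (≡.cong ℤ.-_ (coeff≡ h i)) (≡.sym (coeff-neg r i)))

  +-inverseʳ : ∀ p → p +ₚ negₚ p ≃ []
  +-inverseʳ p = coeffwise λ i → ≡.trans (coeff-sub p p i) (ℤ.+-inverseʳ (coeffₚ p i))

  +-isAbelianGroup : IsAbelianGroup _≃_ _+ₚ_ [] negₚ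
  +-isAbelianGroup = record
    { isGroup = record
      { isMonoid = record
        { isSemigroup = record
          { isMagma = record { isEquivalence = ≃-isEquivalence ; ∙-cong = +-cong }
          ; assoc = +-assoc }
        ; identity = (λ p → refl) , +-identityʳ }
      ; inverse = (λ p → trans (+-comm (negₚ p) p) (+-inverseʳ p)) , +-inverseʳ
      ; ⁻¹-cong = neg-cong }
    ; comm = +-comm }

  +-commutativeSemigroup : CommutativeSemigroup _ _
  +-commutativeSemigroup = record
    { isCommutativeSemigroup = IsAbelianGroup.isCommutativeSemigroup +-isAbelianGroup }

  open Algebra.Properties.CommutativeSemigroup +-commutativeSemigroup using (interchange; x∙yz≈y∙xz)

  ∷-cong : ∀ {a b p r} → a ≡ b → p ≃ r → a ∷ p ≃ b ∷ r
  ∷-cong a≡b h = coeffwise λ { zero → a≡b ; (suc i) → coeff≡ h i }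

  0∷[] : 0ℤ ∷ [] ≃ []
  0∷[] = coeffwise λ { zero → ≡.refl ; (suc i) → ≡.refl }

  scale-cong : ∀ c {p r} → p ≃ r → scaleₚ c p ≃ scaleₚ c r
  scale-cong c {p} {r} h = coeffwise λ i → ≡.trans (coeff-scale c p i)
    (≡.trans (≡.cong (c ℤ.*_) (coeff≡ h i)) (≡.sym (coeff-scale c r i)))

  scale-distribˡ : ∀ c p r → scaleₚ c (p +ₚ r) ≃ scaleₚ c p +ₚ scaleₚ c r
  scale-distribˡ c p r = coeffwise λ i → ≡.trans (coeff-scale c (p +ₚ r) i)
    (≡.trans (≡.cong (c ℤ.*_) (coeff-+ p r i)) (≡.trans (ℤ.*-distribˡ-+ c (coeffₚ p i) (coeffₚ r i))
    (≡.sym (≡.trans (coeff-+ (scaleₚ c p) (scaleₚ c r) i) (≡.cong₂ ℤ._+_ (coeff-scale c p i) (coeff-scale c r i))))))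

  scale-distribʳ : ∀ c e p → scaleₚ (c ℤ.+ e) p ≃ scaleₚ c p +ₚ scaleₚ e p
  scale-distribʳ c e p = coeffwise λ i → ≡.trans (coeff-scale (c ℤ.+ e) p i)
    (≡.trans (ℤ.*-distribʳ-+ (coeffₚ p i) c e)
    (≡.sym (≡.trans (coeff-+ (scaleₚ c p) (scaleₚ e p) i) (≡.cong₂ ℤ._+_ (coeff-scale c p i) (coeff-scale e p i)))))

  scale-scale : ∀ c e p → scaleₚ (c ℤ.* e) p ≃ scaleₚ c (scaleₚ e p)
  scale-scale c e p = coeffwise λ i → ≡.trans (coeff-scale (c ℤ.* e) p i) (≡.trans (ℤ.*-assoc c e (coeffₚ p i))
    (≡.sym (≡.trans (coeff-scale c (scaleₚ e p) i) (≡.cong (c ℤ.*_) (coeff-scale e p i)))))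

  scale-zero : ∀ p → scaleₚ 0ℤ p ≃ []
  scale-zero p = coeffwise λ i → ≡.trans (coeff-scale 0ℤ p i) (ℤ.*-zeroˡ (coeffₚ p i))

  scale-one : ∀ p → scaleₚ 1ℤ p ≃ p
  scale-one p = coeffwise λ i → ≡.trans (coeff-scale 1ℤ p i) (ℤ.*-identityˡ (coeffₚ p i))

  *-congʳ : ∀ p {r r′} → r ≃ r′ → p *ₚ r ≃ p *ₚ r′
  *-congʳ [] h = refl
  *-congʳ (a ∷ p) h = +-cong (scale-cong a h) (∷-cong ≡.refl (*-congʳ p h))

  *-distribʳ : ∀ r p p′ → (p +ₚ p′) *ₚ r ≃ p *ₚ r +ₚ p′ *ₚ r
  *-distribʳ r [] p′ = refl
  *-distribʳ r (a ∷ p) [] = sym (+-identityʳ _)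
  *-distribʳ r (a ∷ p) (b ∷ p′) = trans
    (+-cong (scale-distribʳ a b r) (∷-cong ≡.refl (*-distribʳ r p p′)))
    (interchange (scaleₚ a r) (scaleₚ b r) (0ℤ ∷ p *ₚ r) (0ℤ ∷ p′ *ₚ r))

  *-zeroʳ : ∀ p → p *ₚ [] ≃ []
  *-zeroʳ [] = refl
  *-zeroʳ (a ∷ p) = trans (∷-cong ≡.refl (*-zeroʳ p)) 0∷[]

  -- The product is defined by recursion on its left factor; this is the matching recursion on the
  -- right one, from which commutativity follows.
  *-∷ : ∀ p b r → p *ₚ (b ∷ r) ≃ scaleₚ b p +ₚ (0ℤ ∷ p *ₚ r)
  *-∷ [] b r = sym 0∷[]
  *-∷ (a ∷ p) b r = ∷-cong (≡.cong (ℤ._+ 0ℤ) (ℤ.*-comm a b))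
    (trans (+-cong refl (*-∷ p b r)) (x∙yz≈y∙xz (scaleₚ a r) (scaleₚ b p) (0ℤ ∷ p *ₚ r)))

  *-comm : ∀ p r → p *ₚ r ≃ r *ₚ p
  *-comm [] r = sym (*-zeroʳ r)
  *-comm (a ∷ p) r = trans (+-cong refl (∷-cong ≡.refl (*-comm p r))) (sym (*-∷ r a p))

  *-cong : ∀ {p p′ r r′} → p ≃ p′ → r ≃ r′ → p *ₚ r ≃ p′ *ₚ r′
  *-cong {p} {p′} {r} {r′} h k = trans (*-congʳ p k)
    (trans (*-comm p r′) (trans (*-congʳ r′ h) (*-comm r′ p′)))

  scale-* : ∀ c p r → scaleₚ c p *ₚ r ≃ scaleₚ c (p *ₚ r)
  scale-* c [] r = refl
  scale-* c (a ∷ p) r = trans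
    (+-cong (scale-scale c a r) (∷-cong (≡.sym (ℤ.*-zeroʳ c)) (scale-* c p r)))
    (sym (scale-distribˡ c (scaleₚ a r) (0ℤ ∷ p *ₚ r)))

  0∷-* : ∀ p r → (0ℤ ∷ p) *ₚ r ≃ 0ℤ ∷ p *ₚ r
  0∷-* p r = +-cong (scale-zero r) refl

  *-assoc : ∀ p r s → (p *ₚ r) *ₚ s ≃ p *ₚ (r *ₚ s)
  *-assoc [] r s = refl
  *-assoc (a ∷ p) r s = trans (*-distribʳ s (scaleₚ a r) (0ℤ ∷ p *ₚ r))
    (+-cong (scale-* a r s) (trans (0∷-* (p *ₚ r) s) (∷-cong ≡.refl (*-assoc p r s))))

  const-* : ∀ c p → constₚ c *ₚ p ≃ scaleₚ c p
  const-* c p = trans (+-cong refl 0∷[]) (+-identityʳ _)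

  *-identityˡ : ∀ p → oneₚ *ₚ p ≃ p
  *-identityˡ p = trans (const-* 1ℤ p) (scale-one p)

  polyRing : CommutativeRing _ _
  polyRing = record
    { Carrier = Poly ; _≈_ = _≃_ ; _+_ = _+ₚ_ ; _*_ = _*ₚ_ ; -_ = negₚ ; 0# = [] ; 1# = oneₚ
    ; isCommutativeRing = record
      { isRing = record
        { +-isAbelianGroup = +-isAbelianGroup
        ; *-cong = *-cong
        ; *-assoc = *-assoc
        ; *-identity = *-identityˡ , (λ p → trans (*-comm p oneₚ) (*-identityˡ p))
        ; distrib = (λ p r s → trans (*-comm p (r +ₚ s))
            (trans (*-distribʳ p r s) (+-cong (*-comm r p) (*-comm s p)))) , *-distribʳ
        }
      ; *-comm = *-comm
      }
    }

-- Coprimality through Bézout relations with integer constants.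

module Coprimality {c ℓ} (R : CommutativeRing c ℓ) where
  open CommutativeRing R hiding (zero)
  open IntegerCoefficients R
  open Solver hiding (⟦_⟧)
  open Algebra.Properties.Semiring.Exp semiring
  open Relation.Binary.Reasoning.Setoid setoid

  record Coprime (x y : Carrier) : Set (c ⊔ ℓ) where
    constructor coprime
    field
      {u v} : Carrier
      {k} : ℤ
      k≢0 : k ≢ 0ℤ
      bézout : u * x + v * y ≈ ⟦ k ⟧

  coprime-sym : ∀ {x y} → Coprime x y → Coprime y x
  coprime-sym (coprime k≢0 b) = coprime k≢0 (trans (+-comm _ _) b)

  coprime-respˡ : ∀ {x x′ y} → x ≈ x′ → Coprime x y → Coprime x′ y
  coprime-respˡ x≈x′ (coprime k≢0 b) = coprime k≢0 (trans (+-congʳ (*-congˡ (sym x≈x′))) b)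

  coprime-1 : ∀ y → Coprime 1# y
  coprime-1 y = coprime {u = 1#} {v = 0#} {k = 1ℤ} (λ ())
    (solve 1 (λ y → con 1ℤ :* con 1ℤ :+ con 0ℤ :* y := con 1ℤ) refl y)

  coprime-* : ∀ {x x′ y} → Coprime x y → Coprime x′ y → Coprime (x * x′) y
  coprime-* {x} {x′} {y} (coprime {u} {v} {k} k≢0 b) (coprime {u′} {v′} {k′} k′≢0 b′) = coprime
    {u = u * u′} {v = u * x * v′ + v * ⟦ k′ ⟧} {k = k ℤ.* k′}
    (λ kk′≡0 → Data.Sum.[ k≢0 , k′≢0 ]′ (ℤ.i*j≡0⇒i≡0∨j≡0 k kk′≡0))
    (begin
      u * u′ * (x * x′) + (u * x * v′ + v * ⟦ k′ ⟧) * y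
        ≈⟨ solve 8 (λ u u′ v v′ x x′ y k′ → u :* u′ :* (x :* x′) :+ (u :* x :* v′ :+ v :* k′) :* y :=
             u :* x :* (u′ :* x′ :+ v′ :* y) :+ v :* y :* k′) refl u u′ v v′ x x′ y ⟦ k′ ⟧ ⟩
      u * x * (u′ * x′ + v′ * y) + v * y * ⟦ k′ ⟧
        ≈⟨ +-congʳ (*-congˡ b′) ⟩
      u * x * ⟦ k′ ⟧ + v * y * ⟦ k′ ⟧
        ≈⟨ distribʳ _ _ _ ⟨
      (u * x + v * y) * ⟦ k′ ⟧
        ≈⟨ *-congʳ b ⟩
      ⟦ k ⟧ * ⟦ k′ ⟧
        ≈⟨ *-homo k k′ ⟨
      ⟦ k ℤ.* k′ ⟧ ∎)

  -- A common divisor of x and y also divides s x + t y. Passing to factors, to negatives and from a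
  -- gcd of exponents to an exponent are all instances.
  coprime-ideal : ∀ {x y} s t → Coprime (s * x + t * y) y → Coprime x y
  coprime-ideal {x} {y} s t (coprime {u} {v} k≢0 b) = coprime {u = u * s} {v = u * t + v} k≢0
    (trans (solve 6 (λ u s x v t y → u :* s :* x :+ (u :* t :+ v) :* y :=
      u :* (s :* x :+ t :* y) :+ v :* y) refl u s x v t y) b)

  coprime-factorˡ : ∀ {x x′ y} → Coprime (x * x′) y → Coprime x y
  coprime-factorˡ {x} {x′} {y} h = coprime-ideal x′ 0#
    (coprime-respˡ (solve 3 (λ x x′ y → x :* x′ := x′ :* x :+ con 0ℤ :* y) refl x x′ y) h)

  coprime-^ : ∀ {x y} k → Coprime x y → Coprime (x ^ k) y
  coprime-^ zero h = coprime-1 _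
  coprime-^ (suc k) h = coprime-* h (coprime-^ k h)

  coprime-neg : ∀ {x y} → Coprime x y → Coprime (- x) y
  coprime-neg {x} {y} h = coprime-ideal (- 1#) 0#
    (coprime-respˡ (solve 2 (λ x y → x := :- con 1ℤ :* (:- x) :+ con 0ℤ :* y) refl x y) h)

  geometric : Carrier → ℕ → Carrier
  geometric x zero = 0#
  geometric x (suc k) = 1# + x * geometric x k

  x^k-1 : ∀ x k → x ^ k - 1# ≈ (x - 1#) * geometric x k
  x^k-1 x zero = solve 1 (λ x → con 1ℤ :- con 1ℤ := (x :- con 1ℤ) :* con 0ℤ) refl x
  x^k-1 x (suc k) = begin
    x * x ^ k - 1#
      ≈⟨ solve 2 (λ x X → x :* X :- con 1ℤ := (x :- con 1ℤ) :+ x :* (X :- con 1ℤ)) refl x (x ^ k) ⟩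
    (x - 1#) + x * (x ^ k - 1#)
      ≈⟨ +-congˡ (*-congˡ (x^k-1 x k)) ⟩
    (x - 1#) + x * ((x - 1#) * geometric x k)
      ≈⟨ solve 2 (λ x g → (x :- con 1ℤ) :+ x :* ((x :- con 1ℤ) :* g) := (x :- con 1ℤ) :* (con 1ℤ :+ x :* g)) refl x _ ⟩
    (x - 1#) * (1# + x * geometric x k) ∎

  -- The sum 1 + x + ... + x^(k - 1) is k modulo x - 1; this k is the reason for allowing nonzero
  -- integer constants in Bézout relations.
  geometric-at-1 : ∀ x k → Σ Carrier λ v → geometric x k + v * (x - 1#) ≈ ⟦ + k ⟧
  geometric-at-1 x zero = 0# , solve 1 (λ x → con 0ℤ :+ con 0ℤ :* (x :- con 1ℤ) := con 0ℤ) refl x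
  geometric-at-1 x (suc k) with geometric-at-1 x k
  ... | v , h = v - geometric x k , (begin
    1# + x * g + (v - g) * (x - 1#)
      ≈⟨ solve 3 (λ x g v → con 1ℤ :+ x :* g :+ (v :- g) :* (x :- con 1ℤ) :=
           con 1ℤ :+ (g :+ v :* (x :- con 1ℤ))) refl x g v ⟩
    1# + (g + v * (x - 1#))
      ≈⟨ +-congˡ h ⟩
    1# + ⟦ + k ⟧
      ≈⟨ +-homo 1ℤ (+ k) ⟨
    ⟦ + suc k ⟧ ∎)
    where g = geometric x k

  geometric-coprime : ∀ x k → 0 < k → Coprime (x - 1#) (geometric x k)
  geometric-coprime x (suc k) _ with geometric-at-1 x (suc k)
  ... | v , h = coprime {u = v} {v = 1#} {k = + suc k} (λ ())
    (trans (trans (+-comm _ _) (+-congʳ (*-identityˡ _))) h)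

-- Localisation at φ modulo φ^2, and values of fractions.

module LocalQuotient {c ℓ} (R : CommutativeRing c ℓ) (φ : CommutativeRing.Carrier R) where
  open CommutativeRing R hiding (zero)
  open IntegerCoefficients.Solver R hiding (⟦_⟧)
  open Coprimality R
  open Relation.Binary.Reasoning.Setoid setoid

  infix 4 _∼_
  -- Equality after localisation, stated inside R: s is the cleared denominator. The carrier stays
  -- R, so polynomials need not be embedded anywhere.
  record _∼_ (x y : Carrier) : Set (c ⊔ ℓ) where
    constructor local
    field
      {s z} : Carrier
      s⊥φ : Coprime s φ
      eq : s * x ≈ s * y + φ * φ * z

  ≈⇒∼ : ∀ {x y} → x ≈ y → x ∼ y
  ≈⇒∼ {x} {y} x≈y = local (coprime-1 φ) (trans (*-congˡ x≈y)
    (solve 2 (λ y f → con 1ℤ :* y := con 1ℤ :* y :+ f :* f :* con 0ℤ) refl y φ))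

  ∼-sym : ∀ {x y} → x ∼ y → y ∼ x
  ∼-sym {x} {y} (local {s} {z} s⊥φ eq) = local {z = - z} s⊥φ (begin
    s * y                                    ≈⟨ solve 4 (λ s y f z → s :* y := s :* y :+ f :* f :* z :+ f :* f :* :- z) refl s y φ z ⟩
    s * y + φ * φ * z + φ * φ * - z          ≈⟨ +-congʳ eq ⟨
    s * x + φ * φ * - z                      ∎)

  ∼-trans : ∀ {x y z} → x ∼ y → y ∼ z → x ∼ z
  ∼-trans {x} {y} {z} (local {s} {a} s⊥φ eq) (local {t} {b} t⊥φ eq′) =
    local {s = s * t} {z = t * a + s * b} (coprime-* s⊥φ t⊥φ) (begin
    s * t * x
      ≈⟨ solve 3 (λ s t x → s :* t :* x := t :* (s :* x)) refl s t x ⟩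
    t * (s * x)
      ≈⟨ *-congˡ eq ⟩
    t * (s * y + φ * φ * a)
      ≈⟨ solve 5 (λ s t y f a → t :* (s :* y :+ f :* f :* a) := s :* (t :* y) :+ f :* f :* (t :* a)) refl s t y φ a ⟩
    s * (t * y) + φ * φ * (t * a)
      ≈⟨ +-congʳ (*-congˡ eq′) ⟩
    s * (t * z + φ * φ * b) + φ * φ * (t * a)
      ≈⟨ solve 6 (λ s t z f a b → s :* (t :* z :+ f :* f :* b) :+ f :* f :* (t :* a) :=
           s :* t :* z :+ f :* f :* (t :* a :+ s :* b)) refl s t z φ a b ⟩
    s * t * z + φ * φ * (t * a + s * b) ∎)

  ∼-+ : ∀ {x x′ y y′} → x ∼ x′ → y ∼ y′ → x + y ∼ x′ + y′
  ∼-+ {x} {x′} {y} {y′} (local {s} {a} s⊥φ eq) (local {t} {b} t⊥φ eq′) =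
    local {s = s * t} {z = t * a + s * b} (coprime-* s⊥φ t⊥φ) (begin
    s * t * (x + y)
      ≈⟨ solve 4 (λ s t x y → s :* t :* (x :+ y) := t :* (s :* x) :+ s :* (t :* y)) refl s t x y ⟩
    t * (s * x) + s * (t * y)
      ≈⟨ +-cong (*-congˡ eq) (*-congˡ eq′) ⟩
    t * (s * x′ + φ * φ * a) + s * (t * y′ + φ * φ * b)
      ≈⟨ solve 7 (λ s t x y f a b → t :* (s :* x :+ f :* f :* a) :+ s :* (t :* y :+ f :* f :* b) :=
           s :* t :* (x :+ y) :+ f :* f :* (t :* a :+ s :* b)) refl s t x′ y′ φ a b ⟩
    s * t * (x′ + y′) + φ * φ * (t * a + s * b) ∎)

  ∼-* : ∀ {x x′ y y′} → x ∼ x′ → y ∼ y′ → x * y ∼ x′ * y′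
  ∼-* {x} {x′} {y} {y′} (local {s} {a} s⊥φ eq) (local {t} {b} t⊥φ eq′) =
    local {s = s * t} {z = a * (t * y′) + s * x′ * b + φ * φ * a * b} (coprime-* s⊥φ t⊥φ) (begin
    s * t * (x * y)
      ≈⟨ solve 4 (λ s t x y → s :* t :* (x :* y) := (s :* x) :* (t :* y)) refl s t x y ⟩
    (s * x) * (t * y)
      ≈⟨ *-cong eq eq′ ⟩
    (s * x′ + φ * φ * a) * (t * y′ + φ * φ * b)
      ≈⟨ solve 7 (λ s t x y f a b → (s :* x :+ f :* f :* a) :* (t :* y :+ f :* f :* b) :=
           s :* t :* (x :* y) :+ f :* f :* (a :* (t :* y) :+ s :* x :* b :+ f :* f :* a :* b)) refl s t x′ y′ φ a b ⟩
    s * t * (x′ * y′) + φ * φ * (a * (t * y′) + s * x′ * b + φ * φ * a * b) ∎)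

  ∼-neg : ∀ {x x′} → x ∼ x′ → - x ∼ - x′
  ∼-neg {x} {x′} (local {s} {a} s⊥φ eq) = local {z = - a} s⊥φ (begin
    s * - x                    ≈⟨ solve 2 (λ s x → s :* :- x := :- (s :* x)) refl s x ⟩
    - (s * x)                  ≈⟨ -‿cong eq ⟩
    - (s * x′ + φ * φ * a)     ≈⟨ solve 4 (λ s x f a → :- (s :* x :+ f :* f :* a) := s :* :- x :+ f :* f :* :- a) refl s x′ φ a ⟩
    s * - x′ + φ * φ * - a     ∎)

  ∼-cancel : ∀ {t x y} → Coprime t φ → t * x ∼ t * y → x ∼ y
  ∼-cancel {t} {x} {y} t⊥φ (local {s} {z} s⊥φ eq) = local {s = s * t} (coprime-* s⊥φ t⊥φ)
    (trans (*-assoc s t x) (trans eq (+-congʳ (sym (*-assoc s t y)))))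

  φ*φ∼0 : ∀ z → φ * φ * z ∼ 0#
  φ*φ∼0 z = local (coprime-1 φ) (solve 2 (λ f z → con 1ℤ :* (f :* f :* z) := con 1ℤ :* con 0ℤ :+ f :* f :* z) refl φ z)

  localRing : CommutativeRing c (c ⊔ ℓ)
  localRing = record
    { Carrier = Carrier ; _≈_ = _∼_ ; _+_ = _+_ ; _*_ = _*_ ; -_ = -_ ; 0# = 0# ; 1# = 1#
    ; isCommutativeRing = record
      { isRing = record
        { +-isAbelianGroup = record
          { isGroup = record
            { isMonoid = record
              { isSemigroup = record
                { isMagma = record
                  { isEquivalence = record { refl = ≈⇒∼ refl ; sym = ∼-sym ; trans = ∼-trans }
                  ; ∙-cong = ∼-+ }
                ; assoc = λ x y z → ≈⇒∼ (+-assoc x y z) }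
              ; identity = (λ x → ≈⇒∼ (+-identityˡ x)) , (λ x → ≈⇒∼ (+-identityʳ x)) }
            ; inverse = (λ x → ≈⇒∼ (-‿inverseˡ x)) , (λ x → ≈⇒∼ (-‿inverseʳ x))
            ; ⁻¹-cong = ∼-neg }
          ; comm = λ x y → ≈⇒∼ (+-comm x y) }
        ; *-cong = ∼-*
        ; *-assoc = λ x y z → ≈⇒∼ (*-assoc x y z)
        ; *-identity = (λ x → ≈⇒∼ (*-identityˡ x)) , (λ x → ≈⇒∼ (*-identityʳ x))
        ; distrib = (λ x y z → ≈⇒∼ (distribˡ x y z)) , (λ x y z → ≈⇒∼ (distribʳ x y z))
        }
      ; *-comm = λ x y → ≈⇒∼ (*-comm x y)
      }
    }

  -- Value a b x says that a / b is x in the local ring at φ modulo φ², where b itself may vanish.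
  record Value (a b x : Carrier) : Set (c ⊔ ℓ) where
    constructor value
    field
      {s z} : Carrier
      s⊥φ : Coprime s φ
      eq : s * a ≈ (s * x + φ * φ * z) * b

  -- Serves the q-binomials, whose denominators φ may divide; `value-local` serves denominators
  -- coprime to φ, where a local identity is enough.
  value-exact : ∀ {a b x} → a ≈ x * b → Value a b x
  value-exact {a} {b} {x} h = value (coprime-1 φ) (trans (*-congˡ h)
    (solve 3 (λ x b f → con 1ℤ :* (x :* b) := (con 1ℤ :* x :+ f :* f :* con 0ℤ) :* b) refl x b φ))

  value-local : ∀ {a b x} → Coprime b φ → a ∼ x * b → Value a b x
  value-local {a} {b} {x} b⊥φ (local {s} {z} s⊥φ eq) = value {s = s * b} {z = z} (coprime-* s⊥φ b⊥φ) (begin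
    s * b * a                      ≈⟨ solve 3 (λ s b a → s :* b :* a := s :* a :* b) refl s b a ⟩
    s * a * b                      ≈⟨ *-congʳ eq ⟩
    (s * (x * b) + φ * φ * z) * b  ≈⟨ solve 5 (λ s x b f z → (s :* (x :* b) :+ f :* f :* z) :* b :=
                                        (s :* b :* x :+ f :* f :* z) :* b) refl s x b φ z ⟩
    (s * b * x + φ * φ * z) * b    ∎)

  value-+ : ∀ {a b x a′ b′ x′} → Value a b x → Value a′ b′ x′ → Value (a * b′ + a′ * b) (b * b′) (x + x′)
  value-+ {a} {b} {x} {a′} {b′} {x′} (value {s} {z} s⊥φ eq) (value {t} {y} t⊥φ eq′) =
    value {s = s * t} {z = t * z + s * y} (coprime-* s⊥φ t⊥φ) (begin
    s * t * (a * b′ + a′ * b)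
      ≈⟨ solve 6 (λ s t a b a′ b′ → s :* t :* (a :* b′ :+ a′ :* b) := t :* b′ :* (s :* a) :+ s :* b :* (t :* a′)) refl
           s t a b a′ b′ ⟩
    t * b′ * (s * a) + s * b * (t * a′)
      ≈⟨ +-cong (*-congˡ eq) (*-congˡ eq′) ⟩
    t * b′ * ((s * x + φ * φ * z) * b) + s * b * ((t * x′ + φ * φ * y) * b′)
      ≈⟨ solve 9 (λ s t b b′ x x′ f z y → t :* b′ :* ((s :* x :+ f :* f :* z) :* b) :+ s :* b :* ((t :* x′ :+ f :* f :* y) :* b′) :=
           (s :* t :* (x :+ x′) :+ f :* f :* (t :* z :+ s :* y)) :* (b :* b′)) refl
           s t b b′ x x′ φ z y ⟩
    (s * t * (x + x′) + φ * φ * (t * z + s * y)) * (b * b′) ∎)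

  value-neg : ∀ {a b x} → Value a b x → Value (- a) b (- x)
  value-neg {a} {b} {x} (value {s} {z} s⊥φ eq) = value {z = - z} s⊥φ (begin
    s * - a                            ≈⟨ solve 2 (λ s x → s :* :- x := :- (s :* x)) refl s a ⟩
    - (s * a)                          ≈⟨ -‿cong eq ⟩
    - ((s * x + φ * φ * z) * b)        ≈⟨ solve 5 (λ s x f z b → :- ((s :* x :+ f :* f :* z) :* b) :=
                                            (s :* :- x :+ f :* f :* :- z) :* b) refl s x φ z b ⟩
    (s * - x + φ * φ * - z) * b        ∎)

  value-resp : ∀ {a a′ b x x′} → a ≈ a′ → x ≈ x′ → Value a b x → Value a′ b x′
  value-resp a≈a′ x≈x′ (value s⊥φ eq) =
    value s⊥φ (trans (*-congˡ (sym a≈a′)) (trans eq (*-congʳ (+-congʳ (*-congˡ x≈x′)))))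

  value-sub : ∀ {a b x a′ b′ x′} → Value a b x → Value a′ b′ x′ → Value (a * b′ - a′ * b) (b * b′) (x - x′)
  value-sub {b = b} {a′ = a′} v v′ = value-resp
    (+-congˡ (solve 2 (λ a b → :- a :* b := :- (a :* b)) refl a′ b)) refl (value-+ v (value-neg v′))

  value-* : ∀ {a b x a′ b′ x′} → Value a b x → Value a′ b′ x′ → Value (a * a′) (b * b′) (x * x′)
  value-* {a} {b} {x} {a′} {b′} {x′} (value {s} {z} s⊥φ eq) (value {t} {y} t⊥φ eq′) =
    value {s = s * t} {z = z * (t * x′) + s * x * y + φ * φ * z * y} (coprime-* s⊥φ t⊥φ) (begin
    s * t * (a * a′)
      ≈⟨ solve 4 (λ s t x y → s :* t :* (x :* y) := (s :* x) :* (t :* y)) refl s t a a′ ⟩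
    (s * a) * (t * a′)
      ≈⟨ *-cong eq eq′ ⟩
    ((s * x + φ * φ * z) * b) * ((t * x′ + φ * φ * y) * b′)
      ≈⟨ solve 9 (λ s t b b′ x x′ f z y → ((s :* x :+ f :* f :* z) :* b) :* ((t :* x′ :+ f :* f :* y) :* b′) :=
           (s :* t :* (x :* x′) :+ f :* f :* (z :* (t :* x′) :+ s :* x :* y :+ f :* f :* z :* y)) :* (b :* b′)) refl
           s t b b′ x x′ φ z y ⟩
    (s * t * (x * x′) + φ * φ * (z * (t * x′) + s * x * y + φ * φ * z * y)) * (b * b′) ∎)

  value-∼0 : ∀ {a b x} → Value a b x → x ∼ 0# →
    Σ Carrier λ z → Σ Carrier λ s → Coprime s φ Data.Product.× s * a ≈ φ * φ * z * b
  value-∼0 {a} {b} {x} (value {s} {z} s⊥φ eq) (local {t} {y} t⊥φ eq′) =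
    s * y + t * z , s * t , coprime-* s⊥φ t⊥φ , (begin
    s * t * a
      ≈⟨ solve 3 (λ s t a → s :* t :* a := t :* (s :* a)) refl s t a ⟩
    t * (s * a)
      ≈⟨ *-congˡ eq ⟩
    t * ((s * x + φ * φ * z) * b)
      ≈⟨ solve 6 (λ s t x f z b → t :* ((s :* x :+ f :* f :* z) :* b) := (s :* (t :* x) :+ f :* f :* t :* z) :* b) refl s t x φ z b ⟩
    (s * (t * x) + φ * φ * t * z) * b
      ≈⟨ *-congʳ (+-congʳ (*-congˡ eq′)) ⟩
    (s * (t * 0# + φ * φ * y) + φ * φ * t * z) * b
      ≈⟨ solve 6 (λ s t y f z b → (s :* (t :* con 0ℤ :+ f :* f :* y) :+ f :* f :* t :* z) :* b :=
           f :* f :* (s :* y :+ t :* z) :* b) refl s t y φ z b ⟩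
    φ * φ * (s * y + t * z) * b ∎)

-- Degrees, monic polynomials and division with remainder.

module Degree where
  open PolynomialRing
  open CommutativeRing polyRing using (refl; sym; trans; reflexive; setoid; +-congˡ; +-congʳ; -‿cong)
  open IntegerCoefficients polyRing using (⟦_⟧)
  open IntegerCoefficients.Solver polyRing using (solve; _:=_; _:+_; _:*_; _:-_; :-_)
  open Algebra.Properties.Semiring.Exp (CommutativeRing.semiring polyRing)
  open Relation.Binary.Reasoning.Setoid setoid

  Bounded : ℕ → Poly → Set
  Bounded m p = ∀ i → m ≤ i → coeffₚ p i ≡ 0ℤ

  Monic : ℕ → Poly → Set
  Monic m p = coeffₚ p m ≡ 1ℤ Data.Product.× Bounded (suc m) p

  ≃[] : ∀ {p} → (∀ i → coeffₚ p i ≡ 0ℤ) → p ≃ []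
  ≃[] h = coeffwise h

  bounded-length : ∀ p → Bounded (length p) p
  bounded-length [] i _ = ≡.refl
  bounded-length (a ∷ p) (suc i) (s≤s h) = bounded-length p i h

  monic-resp : ∀ {m p r} → p ≃ r → Monic m p → Monic m r
  monic-resp p≃r (top , bd) = ≡.trans (≡.sym (coeff≡ p≃r _)) top ,
    λ i h → ≡.trans (≡.sym (coeff≡ p≃r i)) (bd i h)

  coeff-∷-* : ∀ a p r i → coeffₚ ((a ∷ p) *ₚ r) (suc i) ≡ a ℤ.* coeffₚ r (suc i) ℤ.+ coeffₚ (p *ₚ r) i
  coeff-∷-* a p r i = ≡.trans (coeff-+ (scaleₚ a r) (0ℤ ∷ p *ₚ r) (suc i))
    (≡.cong (ℤ._+ coeffₚ (p *ₚ r) i) (coeff-scale a r (suc i)))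

  zero-* : ∀ p → Bounded 0 p → ∀ r i → coeffₚ (p *ₚ r) i ≡ 0ℤ
  zero-* p h r = coeff≡ (*-cong {p} {[]} {r} (≃[] (λ i → h i z≤n)) refl)

  coeff-scale-zero : ∀ a {z} → z ≡ 0ℤ → a ℤ.* z ≡ 0ℤ
  coeff-scale-zero a ≡.refl = ℤ.*-zeroʳ a

  bounded-* : ∀ m k p r → Bounded (suc m) p → Bounded (suc k) r → Bounded (suc (m ℕ.+ k)) (p *ₚ r)
  bounded-* m k [] r _ _ i _ = ≡.refl
  bounded-* m k (a ∷ p) r hp hr (suc i) (s≤s h) = ≡.trans (coeff-∷-* a p r i)
    (≡.cong₂ ℤ._+_ (coeff-scale-zero a (hr (suc i) (s≤s (ℕ.≤-trans (ℕ.m≤n+m k m) h)))) (tail m hp h))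
    where
    tail : ∀ m → Bounded (suc m) (a ∷ p) → m ℕ.+ k ≤ i → coeffₚ (p *ₚ r) i ≡ 0ℤ
    tail zero hp _ = zero-* p (λ i _ → hp (suc i) (s≤s z≤n)) r i
    tail (suc m) hp h = bounded-* m k p r (λ i h → hp (suc i) (s≤s h)) hr i h

  coeff-top : ∀ m k p r → Bounded (suc m) p → Bounded (suc k) r →
    coeffₚ (p *ₚ r) (m ℕ.+ k) ≡ coeffₚ p m ℤ.* coeffₚ r k
  coeff-top m k [] r _ _ = ≡.sym (ℤ.*-zeroˡ (coeffₚ r k))
  coeff-top zero zero (a ∷ p) r _ _ = ≡.trans (coeff-+ (scaleₚ a r) (0ℤ ∷ p *ₚ r) 0)
    (≡.trans (ℤ.+-identityʳ _) (coeff-scale a r 0))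
  coeff-top zero (suc k) (a ∷ p) r hp _ = ≡.trans (coeff-∷-* a p r k)
    (≡.trans (≡.cong (λ z → a ℤ.* coeffₚ r (suc k) ℤ.+ z) (zero-* p (λ i _ → hp (suc i) (s≤s z≤n)) r k)) (ℤ.+-identityʳ _))
  coeff-top (suc m) k (a ∷ p) r hp hr = ≡.trans (coeff-∷-* a p r (m ℕ.+ k))
    (≡.trans (≡.cong (ℤ._+ coeffₚ (p *ₚ r) (m ℕ.+ k)) (coeff-scale-zero a (hr (suc (m ℕ.+ k)) (s≤s (ℕ.m≤n+m k m)))))
    (≡.trans (ℤ.+-identityˡ _) (coeff-top m k p r (λ i h → hp (suc i) (s≤s h)) hr)))

  Leading : ℕ → Poly → Set
  Leading k p = coeffₚ p k ≢ 0ℤ Data.Product.× Bounded (suc k) p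

  leading : ∀ p → p ≃ [] Data.Sum.⊎ Σ ℕ λ k → Leading k p
  leading [] = inj₁ refl
  leading (a ∷ p) with leading p
  ... | inj₂ (k , top , bd) = inj₂ (suc k , top , λ { (suc i) (s≤s h) → bd i h })
  ... | inj₁ p≃[] with a ℤ.≟ 0ℤ
  ...   | yes a≡0 = inj₁ (≃[] λ { zero → a≡0 ; (suc i) → coeff≡ p≃[] i })
  ...   | no a≢0 = inj₂ (0 , a≢0 , λ { (suc i) _ → coeff≡ p≃[] i })

  leading-unique : ∀ {p m k} → Leading m p → Leading k p → m ≡ k
  leading-unique {m = m} {k} (top , bd) (top′ , bd′) = ℕ.≤-antisym
    (ℕ.≮⇒≥ λ k<m → top (bd′ m k<m)) (ℕ.≮⇒≥ λ m<k → top′ (bd k m<k))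

  monic⇒leading : ∀ {m p} → Monic m p → Leading m p
  monic⇒leading (top , bd) = (λ top≡0 → 1≢0 (≡.trans (≡.sym top) top≡0)) , bd
    where
    1≢0 : 1ℤ ≢ 0ℤ
    1≢0 ()

  monic-* : ∀ {m k p r} → Monic m p → Monic k r → Monic (m ℕ.+ k) (p *ₚ r)
  monic-* {m} {k} {p} {r} (top , bd) (top′ , bd′) =
    ≡.trans (coeff-top m k p r bd bd′) (≡.cong₂ ℤ._*_ top top′) , bounded-* m k p r bd bd′

  monic-coeff : ∀ {m d} → Monic m d → ∀ k x → Bounded (suc k) x → coeffₚ (d *ₚ x) (m ℕ.+ k) ≡ coeffₚ x k
  monic-coeff {m} {d} (top , bd) k x bd′ = ≡.trans (coeff-top m k d x bd bd′)
    (≡.trans (≡.cong (ℤ._* coeffₚ x k) top) (ℤ.*-identityˡ _))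

  -- A leading coefficient of x in degree k would reappear in d x in degree m + k, which is at least
  -- m. Cancellation and the uniqueness of quotients rest on this.
  monic-small : ∀ {m d x} → Monic m d → Bounded m (d *ₚ x) → x ≃ []
  monic-small {m} {d} {x} hd h with leading x
  ... | inj₁ x≃[] = x≃[]
  ... | inj₂ (k , top , bd) = contradiction
    (≡.trans (≡.sym (monic-coeff {d = d} hd k x bd)) (h (m ℕ.+ k) (ℕ.m≤m+n m k))) top

  x-y≃[] : ∀ {x y} → x -ₚ y ≃ [] → x ≃ y
  x-y≃[] {x} {y} h = trans (solve 2 (λ x y → x := (x :- y) :+ y) refl x y) (+-congʳ h)

  monic-cancel : ∀ {m d x y} → Monic m d → d *ₚ x ≃ d *ₚ y → x ≃ y
  monic-cancel {m} {d} {x} {y} hd h = x-y≃[] (monic-small {d = d} hd λ i _ → coeff≡ d[x-y]≃[] i)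
    where
    d[x-y]≃[] : d *ₚ (x -ₚ y) ≃ []
    d[x-y]≃[] = begin
      d *ₚ (x -ₚ y)          ≈⟨ solve 3 (λ d x y → d :* (x :- y) := d :* x :- d :* y) refl d x y ⟩
      d *ₚ x -ₚ d *ₚ y       ≈⟨ +-congʳ h ⟩
      d *ₚ y -ₚ d *ₚ y       ≈⟨ +-inverseʳ (d *ₚ y) ⟩
      []                     ∎

  monic-quotient : ∀ {n m d x} → Monic n (d *ₚ x) → Monic m d → Σ ℕ λ k → Monic k x
  monic-quotient {n} {m} {d} {x} hdx hd with leading x
  ... | inj₁ x≃[] = contradiction (coeff≡ (trans (*-congʳ d x≃[]) (*-zeroʳ d)) n) (proj₁ (monic⇒leading {p = d *ₚ x} hdx))
  ... | inj₂ (k , top , bd) = k , ≡.trans (≡.sym top≡) (≡.trans (≡.cong (coeffₚ (d *ₚ x)) m+k≡n) (proj₁ hdx)) , bd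
    where
    top≡ = monic-coeff {d = d} hd k x bd
    m+k≡n = leading-unique {d *ₚ x} {m ℕ.+ k} {n}
      ((λ z → top (≡.trans (≡.sym top≡) z)) , bounded-* m k d x (proj₂ hd) bd) (monic⇒leading {p = d *ₚ x} hdx)

  divide : ∀ {m d} → Monic m d → ∀ p → Σ Poly λ s → Σ Poly λ r → p ≃ d *ₚ s +ₚ r Data.Product.× Bounded m r
  divide {d = d} hd [] = [] , [] , sym (trans (+-identityʳ _) (*-zeroʳ d)) , λ i _ → ≡.refl
  divide {m} {d} hd (a ∷ p) with divide {d = d} hd p
  ... | s , r , p≃ , bd = c ∷ s , (a ∷ r) -ₚ scaleₚ c d , eq , bound
    where
    -- Passing from p to a + q p turns the remainder r into a + q r, of degree at most m; d being
    -- monic, subtracting c d removes the coefficient c in degree m.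
    c = coeffₚ (a ∷ r) m
    eq : a ∷ p ≃ d *ₚ (c ∷ s) +ₚ ((a ∷ r) -ₚ scaleₚ c d)
    eq = begin
      a ∷ p
        ≈⟨ ∷-cong (≡.sym (ℤ.+-identityˡ a)) p≃ ⟩
      (0ℤ ∷ d *ₚ s) +ₚ (a ∷ r)
        ≈⟨ solve 3 (λ x y z → x :+ y := (z :+ x) :+ (y :- z)) refl (0ℤ ∷ d *ₚ s) (a ∷ r) (scaleₚ c d) ⟩
      (scaleₚ c d +ₚ (0ℤ ∷ d *ₚ s)) +ₚ ((a ∷ r) -ₚ scaleₚ c d)
        ≈⟨ +-congʳ (*-∷ d c s) ⟨
      d *ₚ (c ∷ s) +ₚ ((a ∷ r) -ₚ scaleₚ c d) ∎
    high : ∀ i → m < i → coeffₚ (a ∷ r) i ≡ 0ℤ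
    high (suc i) (s≤s h) = bd i h
    bound : Bounded m ((a ∷ r) -ₚ scaleₚ c d)
    bound i m≤i = ≡.trans (coeff-sub (a ∷ r) (scaleₚ c d) i)
      (≡.trans (≡.cong (λ z → coeffₚ (a ∷ r) i ℤ.- z) (coeff-scale c d i)) (cancels (ℕ.m≤n⇒m<n∨m≡n m≤i)))
      where
      cancels : m < i Data.Sum.⊎ m ≡ i → coeffₚ (a ∷ r) i ℤ.- c ℤ.* coeffₚ d i ≡ 0ℤ
      cancels (inj₁ m<i) = ≡.cong₂ ℤ._-_ (high i m<i) (coeff-scale-zero c (proj₂ hd i m<i))
      cancels (inj₂ ≡.refl) = ≡.trans (≡.cong (λ z → c ℤ.- c ℤ.* z) (proj₁ hd))
        (≡.trans (≡.cong (λ z → c ℤ.- z) (ℤ.*-identityʳ c)) (ℤ.+-inverseʳ c))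

  ⟦⟧≃const : ∀ c → ⟦ c ⟧ ≃ constₚ c
  ⟦⟧≃const (+ n) = natural n
    where
    open Algebra.Properties.Semiring.Mult.TCOptimised (CommutativeRing.semiring polyRing) using (_×_; 1+×)
    natural : ∀ n → n × oneₚ ≃ constₚ (+ n)
    natural zero = sym 0∷[]
    natural (suc n) = trans (1+× n oneₚ) (+-congˡ (natural n))
  ⟦⟧≃const -[1+ n ] = -‿cong (⟦⟧≃const (+ suc n))

  -- The remainder of x modulo d is killed by c.
  monic-divides : ∀ {m d c x y} → Monic m d → c ≢ 0ℤ → ⟦ c ⟧ *ₚ x ≃ d *ₚ y → Σ Poly λ z → x ≃ d *ₚ z
  monic-divides {m} {d} {c} {x} {y} hd c≢0 h with divide {d = d} hd x
  ... | s , r , x≃ , bd = s , trans x≃ (trans (+-congˡ r≃[]) (+-identityʳ _))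
    where
    C = ⟦ c ⟧
    eq : d *ₚ (y -ₚ C *ₚ s) ≃ scaleₚ c r
    eq = begin
      d *ₚ (y -ₚ C *ₚ s)
        ≈⟨ solve 4 (λ d y c s → d :* (y :- c :* s) := d :* y :- c :* (d :* s)) refl d y C s ⟩
      d *ₚ y -ₚ C *ₚ (d *ₚ s)
        ≈⟨ +-congʳ (trans (sym h) (*-congʳ C x≃)) ⟩
      C *ₚ (d *ₚ s +ₚ r) -ₚ C *ₚ (d *ₚ s)
        ≈⟨ solve 3 (λ c a r → c :* (a :+ r) :- c :* a := c :* r) refl C (d *ₚ s) r ⟩
      C *ₚ r
        ≈⟨ *-cong (⟦⟧≃const c) refl ⟩
      constₚ c *ₚ r
        ≈⟨ const-* c r ⟩
      scaleₚ c r ∎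
    small : y -ₚ C *ₚ s ≃ []
    small = monic-small {d = d} hd λ i m≤i → ≡.trans (coeff≡ eq i)
      (≡.trans (coeff-scale c r i) (coeff-scale-zero c (bd i m≤i)))
    r≃[] : r ≃ []
    r≃[] = ≃[] λ i → Data.Sum.[ (λ c≡0 → contradiction c≡0 c≢0) , (λ z → z) ]′ (ℤ.i*j≡0⇒i≡0∨j≡0 c
      (≡.trans (≡.sym (coeff-scale c r i)) (coeff≡ (trans (sym eq) (trans (*-congʳ d small) (*-zeroʳ d))) i)))

  q : Poly
  q = mono 1ℤ 1

  q-* : ∀ p → q *ₚ p ≃ 0ℤ ∷ p
  q-* p = trans (0∷-* oneₚ p) (∷-cong ≡.refl (*-identityˡ p))

  mono≃ : ∀ c e → mono c e ≃ constₚ c *ₚ q ^ e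
  mono≃ c zero = sym (trans (const-* c oneₚ) (∷-cong (ℤ.*-identityʳ c) refl))
  mono≃ c (suc e) = begin
    0ℤ ∷ mono c e                  ≈⟨ ∷-cong ≡.refl (mono≃ c e) ⟩
    0ℤ ∷ constₚ c *ₚ q ^ e         ≈⟨ q-* _ ⟨
    q *ₚ (constₚ c *ₚ q ^ e)       ≈⟨ solve 3 (λ q c e → q :* (c :* e) := c :* (q :* e)) refl q (constₚ c) (q ^ e) ⟩
    constₚ c *ₚ (q *ₚ q ^ e)       ∎

  ++≃ : ∀ p x → p ++ [ x ] ≃ p +ₚ mono x (length p)
  ++≃ [] x = refl
  ++≃ (a ∷ p) x = ∷-cong (≡.sym (ℤ.+-identityʳ a)) (++≃ p x)

  reverse-∷ : ∀ x xs → reverse (x ∷ xs) ≃ reverse xs +ₚ mono x (length xs)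
  reverse-∷ x xs = trans (reflexive (List.unfold-reverse x xs)) (trans (++≃ (reverse xs) x)
    (reflexive (≡.cong (λ l → reverse xs +ₚ mono x l) (List.length-reverse xs))))

  coeff-mono : ∀ c n → coeffₚ (mono c n) n ≡ c
  coeff-mono c zero = ≡.refl
  coeff-mono c (suc n) = coeff-mono c n

  bounded-mono : ∀ c n → Bounded (suc n) (mono c n)
  bounded-mono c zero (suc i) h = ≡.refl
  bounded-mono c (suc n) (suc i) (s≤s h) = bounded-mono c n i h

  monic-q^n-1 : ∀ n → 0 < n → Monic n (mono 1ℤ n -ₚ oneₚ)
  monic-q^n-1 (suc n) _ = ≡.trans (coeff≡ (+-identityʳ (mono 1ℤ n)) n) (coeff-mono 1ℤ n) ,
    λ { (suc i) (s≤s h) → ≡.trans (coeff≡ (+-identityʳ (mono 1ℤ n)) i) (bounded-mono 1ℤ n i h) }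

-- Correctness of the long division.

-- The worker of divₚ is private, so it is named here by unification, with its arguments and the [] of reverse
-- abstracted to variables to make the unification problem solvable:
-- quotient acc f k d xs is reverse (divLoop f k (lead d) d xs) ++ acc.
module LongDivision where
  open PolynomialRing
  open Degree
  open CommutativeRing polyRing using (refl; sym; trans; reflexive; setoid; +-congˡ; +-congʳ; -‿cong)
  open IntegerCoefficients.Solver polyRing using (solve; _:=_; _:+_; _:*_; _:-_; :-_)
  open Algebra.Properties.Semiring.Exp (CommutativeRing.semiring polyRing)
  open Relation.Binary.Reasoning.Setoid setoid

  -- The private trimming of zeros reduces only on an explicit list, so the double reversals are
  -- first replaced by the lists they equal; then both sides compute to the same term.
  normₚ-0∷ : ∀ xs → normₚ (reverse (0ℤ ∷ xs)) ≡ normₚ (reverse xs)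
  normₚ-0∷ xs with reverse (reverse (0ℤ ∷ xs)) | List.reverse-involutive (0ℤ ∷ xs)
    | reverse (reverse xs) | List.reverse-involutive xs
  ... | _ | ≡.refl | _ | ≡.refl = ≡.refl

  normₚ-≢0∷ : ∀ x xs → x ≢ 0ℤ → normₚ (reverse (x ∷ xs)) ≡ reverse (x ∷ xs)
  normₚ-≢0∷ x xs x≢0 with reverse (reverse (x ∷ xs)) | List.reverse-involutive (x ∷ xs)
  normₚ-≢0∷ (+ 0) xs x≢0 | _ | ≡.refl = contradiction ≡.refl x≢0
  normₚ-≢0∷ ℤ.+[1+ n ] xs x≢0 | _ | ≡.refl = ≡.refl
  normₚ-≢0∷ -[1+ n ] xs x≢0 | _ | ≡.refl = ≡.refl

  mutual
    quotient : List ℤ → ℕ → ℕ → List ℤ → List ℤ → List ℤ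
    quotient = _

    divₚ≡quotient : ∀ p d → divₚ p d ≡ quotient [] (length (reverse (normₚ p))) (length (reverse (normₚ d)))
      (reverse (normₚ d)) (reverse (normₚ p))
    divₚ≡quotient p d with length (reverse (normₚ p)) | length (reverse (normₚ d))
    ... | f | k with reverse (normₚ d) | reverse (normₚ p)
    ... | ds | xs with List.[] {A = ℤ}
    ... | acc = ≡.refl

  mutual
    subtract : ℤ → List ℤ → List ℤ → List ℤ
    subtract = _

    -- The loop subtracts x d times the divisor and drops the head, so only ds and xs enter the new
    -- dividend. `subtract` is the private subtraction, found by unification like the loop.
    quotient-step : ∀ acc f k d ds x xs → (suc (length xs) ℕ.<ᵇ k) ≡ Data.Bool.false →
      quotient acc (suc f) k (d ∷ ds) (x ∷ xs) ≡
      quotient (x ℤ.* d ∷ acc) f k (d ∷ ds) (subtract (x ℤ.* d) ds xs)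
    quotient-step acc f k d ds x xs h with suc (length xs) ℕ.<ᵇ k
    quotient-step acc f k d ds x xs () | Data.Bool.true
    quotient-step acc f k d ds x xs h | Data.Bool.false with x ℤ.* d
    ... | c = ≡.refl

  quotient-stop : ∀ acc f k d ds x xs → (suc (length xs) ℕ.<ᵇ k) ≡ Data.Bool.true →
    quotient acc (suc f) k (d ∷ ds) (x ∷ xs) ≡ acc
  quotient-stop acc f k d ds x xs h with suc (length xs) ℕ.<ᵇ k
  quotient-stop acc f k d ds x xs h | Data.Bool.true = ≡.refl
  quotient-stop acc f k d ds x xs () | Data.Bool.false

  mono-0 : ∀ e → mono 0ℤ e ≃ []
  mono-0 e = trans (mono≃ 0ℤ e) (*-cong 0∷[] refl)

  normₚ-reverse : ∀ xs → normₚ (reverse xs) ≃ reverse xs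
  normₚ-reverse [] = refl
  normₚ-reverse (x ∷ xs) with x ℤ.≟ 0ℤ
  ... | no x≢0 = reflexive (normₚ-≢0∷ x xs x≢0)
  ... | yes ≡.refl = begin
    normₚ (reverse (0ℤ ∷ xs))            ≡⟨ normₚ-0∷ xs ⟩
    normₚ (reverse xs)                   ≈⟨ normₚ-reverse xs ⟩
    reverse xs                           ≈⟨ +-identityʳ _ ⟨
    reverse xs +ₚ []                     ≈⟨ +-congˡ (mono-0 (length xs)) ⟨
    reverse xs +ₚ mono 0ℤ (length xs)    ≈⟨ reverse-∷ 0ℤ xs ⟨
    reverse (0ℤ ∷ xs)                    ∎

  normₚ≃ : ∀ p → normₚ p ≃ p
  normₚ≃ p = ≡.subst (λ p → normₚ p ≃ p) (List.reverse-involutive p) (normₚ-reverse (reverse p))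

  data Normal : List ℤ → Set where
    empty : Normal []
    nonzero : ∀ {x xs} → x ≢ 0ℤ → Normal (x ∷ xs)

  normₚ-normal : ∀ p → Normal (reverse (normₚ p))
  normₚ-normal p = ≡.subst (λ p → Normal (reverse (normₚ p))) (List.reverse-involutive p) (go (reverse p))
    where
    go : ∀ xs → Normal (reverse (normₚ (reverse xs)))
    go [] = empty
    go (x ∷ xs) with x ℤ.≟ 0ℤ
    ... | yes ≡.refl = ≡.subst (λ p → Normal (reverse p)) (≡.sym (normₚ-0∷ xs)) (go xs)
    ... | no x≢0 = ≡.subst Normal (≡.sym (≡.trans (≡.cong reverse (normₚ-≢0∷ x xs x≢0))
      (List.reverse-involutive (x ∷ xs)))) (nonzero x≢0)

  monic-normₚ : ∀ {m d} → Monic m d → Σ (List ℤ) λ ds → reverse (normₚ d) ≡ 1ℤ ∷ ds Data.Product.× length ds ≡ m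
  monic-normₚ {m} {d} hd = go (reverse (normₚ d)) (normₚ-normal d)
    (trans (reflexive (List.reverse-involutive (normₚ d))) (normₚ≃ d))
    where
    go : ∀ xs → Normal xs → reverse xs ≃ d → Σ (List ℤ) λ ds → xs ≡ 1ℤ ∷ ds Data.Product.× length ds ≡ m
    go [] _ h = contradiction (≡.sym (coeff≡ h m)) (proj₁ (monic⇒leading {p = d} hd))
    go (x ∷ xs) (nonzero x≢0) h = xs , ≡.cong (_∷ xs) x≡1 , e≡m
      where
      e = length xs
      split : d ≃ reverse xs +ₚ mono x e
      split = trans (sym h) (reverse-∷ x xs)
      coeff-d : ∀ i → e ≤ i → coeffₚ d i ≡ coeffₚ (mono x e) i
      coeff-d i e≤i = ≡.trans (coeff≡ split i) (≡.trans (coeff-+ (reverse xs) (mono x e) i)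
        (≡.trans (≡.cong (ℤ._+ coeffₚ (mono x e) i) (bounded-length (reverse xs) i
          (≡.subst (_≤ i) (≡.sym (List.length-reverse xs)) e≤i))) (ℤ.+-identityˡ _)))
      top : coeffₚ d e ≡ x
      top = ≡.trans (coeff-d e ℕ.≤-refl) (coeff-mono x e)
      e≡m : e ≡ m
      e≡m = leading-unique {d} ((λ z → x≢0 (≡.trans (≡.sym top) z)) ,
        λ i h → ≡.trans (coeff-d i (ℕ.<⇒≤ h)) (bounded-mono x e i h)) (monic⇒leading {p = d} hd)
      x≡1 : x ≡ 1ℤ
      x≡1 = ≡.trans (≡.sym top) (≡.trans (≡.cong (coeffₚ d) e≡m) (proj₁ hd))

  mono-split : ∀ c {e f g} → e ℕ.+ f ≡ g → mono c g ≃ mono c e *ₚ q ^ f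
  mono-split c {e} {f} ≡.refl = begin
    mono c (e ℕ.+ f)                   ≈⟨ mono≃ c (e ℕ.+ f) ⟩
    constₚ c *ₚ q ^ (e ℕ.+ f)          ≈⟨ *-congʳ (constₚ c) (^-homo-* q e f) ⟩
    constₚ c *ₚ (q ^ e *ₚ q ^ f)       ≈⟨ *-assoc (constₚ c) (q ^ e) (q ^ f) ⟨
    constₚ c *ₚ q ^ e *ₚ q ^ f         ≈⟨ *-cong {r = q ^ f} (mono≃ c e) refl ⟨
    mono c e *ₚ q ^ f                  ∎

  const-homo-* : ∀ a b → constₚ (a ℤ.* b) ≃ constₚ a *ₚ constₚ b
  const-homo-* a b = sym (const-* a (constₚ b))

  length-subtract : ∀ c ds xs → length ds ≤ length xs → length (subtract c ds xs) ≡ length xs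
  length-subtract c [] xs _ = ≡.refl
  length-subtract c (d ∷ ds) (x ∷ xs) (s≤s h) = ≡.cong suc (length-subtract c ds xs h)

  subtract-≃ : ∀ c ds xs e → e ℕ.+ length ds ≡ length xs →
    reverse (subtract c ds xs) ≃ reverse xs -ₚ mono c e *ₚ reverse ds
  subtract-≃ c [] xs e _ = sym (trans (+-congˡ (-‿cong (*-zeroʳ (mono c e)))) (+-identityʳ _))
  subtract-≃ c (d ∷ ds) [] e h = contradiction (≡.trans (≡.sym (ℕ.+-suc e (length ds))) h) λ ()
  subtract-≃ c (d ∷ ds) (x ∷ xs) e h = begin
    reverse ((x ℤ.- c ℤ.* d) ∷ s)
      ≈⟨ reverse-∷ (x ℤ.- c ℤ.* d) s ⟩
    reverse s +ₚ mono (x ℤ.- c ℤ.* d) (length s)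
      ≈⟨ +-cong (subtract-≃ c ds xs e e+f) (trans (reflexive (≡.cong (mono _) (length-subtract c ds xs f≤g))) (mono≃ _ g)) ⟩
    (reverse xs -ₚ mono c e *ₚ reverse ds) +ₚ constₚ (x ℤ.- c ℤ.* d) *ₚ q ^ g
      ≈⟨ +-congˡ {x = reverse xs -ₚ mono c e *ₚ reverse ds} (*-cong {r = q ^ g}
           (+-congˡ {x = constₚ x} (-‿cong {x = constₚ (c ℤ.* d)} (const-homo-* c d))) refl) ⟩
    (reverse xs -ₚ mono c e *ₚ reverse ds) +ₚ (constₚ x -ₚ constₚ c *ₚ constₚ d) *ₚ q ^ g
      ≈⟨ solve 7 (λ X C D M R S Q → (R :- M :* S) :+ (X :- C :* D) :* Q :=
           (R :+ X :* Q) :- M :* S :- (C :* Q) :* D) refl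
           (constₚ x) (constₚ c) (constₚ d) (mono c e) (reverse xs) (reverse ds) (q ^ g) ⟩
    (reverse xs +ₚ constₚ x *ₚ q ^ g) -ₚ mono c e *ₚ reverse ds -ₚ (constₚ c *ₚ q ^ g) *ₚ constₚ d
      ≈⟨ +-cong (+-congʳ (trans (+-congˡ (sym (mono≃ x g))) (sym (reverse-∷ x xs))))
           (-‿cong (*-cong (trans (sym (mono≃ c g)) (mono-split c {e} {f} e+f)) refl)) ⟩
    reverse (x ∷ xs) -ₚ mono c e *ₚ reverse ds -ₚ (mono c e *ₚ q ^ f) *ₚ constₚ d
      ≈⟨ solve 5 (λ A M S Q D → A :- M :* S :- (M :* Q) :* D := A :- M :* (S :+ D :* Q)) refl _ (mono c e) _ _ _ ⟩
    reverse (x ∷ xs) -ₚ mono c e *ₚ (reverse ds +ₚ constₚ d *ₚ q ^ f)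
      ≈⟨ +-congˡ (-‿cong (*-congʳ (mono c e) (trans (+-congˡ (sym (mono≃ d f))) (sym (reverse-∷ d ds))))) ⟩
    reverse (x ∷ xs) -ₚ mono c e *ₚ reverse (d ∷ ds) ∎
    where
    s = subtract c ds xs
    f = length ds
    g = length xs
    e+f : e ℕ.+ f ≡ g
    e+f = ℕ.suc-injective (≡.trans (≡.sym (ℕ.+-suc e f)) h)
    f≤g : f ≤ g
    f≤g = ≡.subst (f ≤_) e+f (ℕ.m≤n+m f e)

  -- The length of s is part of the invariant because the coefficient of the current step is
  -- appended at the top: `s ++ [ c ]` adds c q^e only if s has exactly e entries, leading zeros
  -- included.
  record Division (acc : List ℤ) (f : ℕ) (ds xs : List ℤ) : Set where
    field
      s r : Poly
      quotient≡ : quotient acc f (suc (length ds)) (1ℤ ∷ ds) xs ≡ s ++ acc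
      length-s : length s ≡ length xs ∸ length ds
      divides≃ : reverse xs ≃ reverse (1ℤ ∷ ds) *ₚ s +ₚ r
      bounded : Bounded (length ds) r

  small : ∀ acc f ds xs → quotient acc f (suc (length ds)) (1ℤ ∷ ds) xs ≡ acc → length xs ≤ length ds →
    Division acc f ds xs
  small acc f ds xs h xs≤ds = record
    { s = [] ; r = reverse xs ; quotient≡ = h ; length-s = ≡.sym (ℕ.m≤n⇒m∸n≡0 xs≤ds)
    ; divides≃ = sym (+-cong (*-zeroʳ (reverse (1ℤ ∷ ds))) refl)
    ; bounded = λ i h → bounded-length (reverse xs) i
        (≡.subst (_≤ i) (≡.sym (List.length-reverse xs)) (ℕ.≤-trans xs≤ds h)) }

  division : ∀ acc f ds xs → length xs ≤ f → Division acc f ds xs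
  division acc zero ds [] _ = small acc 0 ds [] ≡.refl z≤n
  division acc (suc f) ds [] _ = small acc (suc f) ds [] ≡.refl z≤n
  division acc (suc f) ds (x ∷ xs) (s≤s xs≤f) = go _ ≡.refl
    where
    go : ∀ b → (suc (length xs) ℕ.<ᵇ suc (length ds)) ≡ b → Division acc (suc f) ds (x ∷ xs)
    go Data.Bool.true h = small acc (suc f) ds (x ∷ xs) (quotient-stop acc f (suc (length ds)) 1ℤ ds x xs h)
      (ℕ.<ᵇ⇒< _ _ (≡.subst Data.Bool.T (≡.sym h) _))
    go Data.Bool.false h = record
      { s = D.s ++ [ c ]
      ; r = D.r
      ; quotient≡ = ≡.trans (quotient-step acc f (suc (length ds)) 1ℤ ds x xs h)
          (≡.trans D.quotient≡ (≡.sym (List.++-assoc D.s [ c ] acc)))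
      ; length-s = ≡.trans (List.length-++ D.s) (≡.trans (ℕ.+-comm (length D.s) 1)
          (≡.trans (≡.cong suc len-s) (≡.sym (ℕ.+-∸-assoc 1 ds≤xs))))
      ; divides≃ = begin
          reverse (x ∷ xs)
            ≈⟨ reverse-∷ x xs ⟩
          reverse xs +ₚ mono x (length xs)
            ≡⟨ ≡.cong (λ c → reverse xs +ₚ mono c (length xs)) (ℤ.*-identityʳ x) ⟨
          reverse xs +ₚ mono c (length xs)
            ≈⟨ +-congˡ (mono-split c {e} {length ds} (ℕ.m∸n+n≡m ds≤xs)) ⟩
          reverse xs +ₚ mono c e *ₚ q ^ length ds
            ≈⟨ solve 4 (λ X M S Q → X :+ M :* Q := (X :- M :* S) :+ M :* (S :+ Q)) refl
                 (reverse xs) (mono c e) (reverse ds) (q ^ length ds) ⟩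
          (reverse xs -ₚ mono c e *ₚ reverse ds) +ₚ mono c e *ₚ (reverse ds +ₚ q ^ length ds)
            ≈⟨ +-cong (trans (sym (subtract-≃ c ds xs e (ℕ.m∸n+n≡m ds≤xs))) D.divides≃)
                 (*-congʳ (mono c e) (sym d≃)) ⟩
          (d *ₚ D.s +ₚ D.r) +ₚ mono c e *ₚ d
            ≈⟨ solve 4 (λ d s r m → (d :* s :+ r) :+ m :* d := d :* (s :+ m) :+ r) refl d D.s D.r (mono c e) ⟩
          d *ₚ (D.s +ₚ mono c e) +ₚ D.r
            ≈⟨ +-congʳ (*-congʳ d (trans (++≃ D.s c) (reflexive (≡.cong (λ l → D.s +ₚ mono c l) len-s)))) ⟨
          d *ₚ (D.s ++ [ c ]) +ₚ D.r ∎
      ; bounded = D.bounded }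
      where
      c = x ℤ.* 1ℤ
      e = length xs ∸ length ds
      d = reverse (1ℤ ∷ ds)
      d≃ : d ≃ reverse ds +ₚ q ^ length ds
      d≃ = trans (reverse-∷ 1ℤ ds) (+-congˡ (trans (mono≃ 1ℤ (length ds)) (*-identityˡ _)))
      ds≤xs : length ds ≤ length xs
      ds≤xs = ℕ.≮⇒≥ λ xs<ds → ≡.subst Data.Bool.T h (ℕ.<⇒<ᵇ (s≤s xs<ds))
      len = length-subtract c ds xs ds≤xs
      module D = Division (division (c ∷ acc) f ds (subtract c ds xs) (≡.subst (_≤ f) (≡.sym len) xs≤f))
      len-s : length D.s ≡ e
      len-s = ≡.trans D.length-s (≡.cong (_∸ length ds) len)

  -- Uniqueness of the quotient: d times the difference of the two quotients is the negated
  -- remainder, whose degree is below that of d.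
  divₚ-exact : ∀ {m d p x} → Monic m d → p ≃ d *ₚ x → divₚ p d ≃ x
  divₚ-exact {m} {d} {p} {x} hd h with monic-normₚ {d = d} hd
  ... | ds , d≡ , len = begin
    divₚ p d
      ≡⟨ divₚ≡quotient p d ⟩
    quotient [] (length hp) (length (reverse (normₚ d))) (reverse (normₚ d)) hp
      ≡⟨ ≡.cong (λ ds → quotient [] (length hp) (length ds) ds hp) d≡ ⟩
    quotient [] (length hp) (suc (length ds)) (1ℤ ∷ ds) hp
      ≡⟨ ≡.trans D.quotient≡ (List.++-identityʳ D.s) ⟩
    D.s
      ≈⟨ x-y≃[] (monic-small {d = d} hd (λ i m≤i → ≡.trans (coeff≡ remainder i) (bounded-neg i m≤i))) ⟩
    x ∎
    where
    hp = reverse (normₚ p)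
    module D = Division (division [] (length hp) ds hp ℕ.≤-refl)
    d≃ : reverse (1ℤ ∷ ds) ≃ d
    d≃ = trans (reflexive (≡.trans (≡.cong reverse (≡.sym d≡)) (List.reverse-involutive (normₚ d)))) (normₚ≃ d)
    p≃ : p ≃ d *ₚ D.s +ₚ D.r
    p≃ = trans (sym (trans (reflexive (List.reverse-involutive (normₚ p))) (normₚ≃ p)))
      (trans D.divides≃ (+-congʳ (*-cong d≃ refl)))
    remainder : d *ₚ (D.s -ₚ x) ≃ negₚ D.r
    remainder = begin
      d *ₚ (D.s -ₚ x)                   ≈⟨ solve 4 (λ d s x r → d :* (s :- x) := (d :* s :+ r) :- d :* x :- r) refl d D.s x D.r ⟩
      (d *ₚ D.s +ₚ D.r) -ₚ d *ₚ x -ₚ D.r  ≈⟨ +-congʳ (+-cong (sym p≃) (-‿cong (sym h))) ⟩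
      p -ₚ p -ₚ D.r                     ≈⟨ solve 2 (λ p r → p :- p :- r := :- r) refl p D.r ⟩
      negₚ D.r                          ∎
    bounded-neg : Bounded m (negₚ D.r)
    bounded-neg i m≤i = ≡.trans (coeff-neg D.r i) (≡.cong ℤ.-_ (D.bounded i (≡.subst (_≤ i) (≡.sym len) m≤i)))

-- Cyclotomic polynomials: product formula and coprimality.

module Cyclotomic where
  open PolynomialRing
  open Degree
  open LongDivision
  open Coprimality polyRing
  open CommutativeRing polyRing using (refl; sym; trans; reflexive; setoid; +-congˡ; +-congʳ; -‿cong; *-identityʳ)
  open IntegerCoefficients polyRing using (⟦_⟧)
  open IntegerCoefficients.Solver polyRing using (solve; _:=_; _:+_; _:*_; _:-_; :-_; con)
  open Algebra.Properties.Semiring.Exp (CommutativeRing.semiring polyRing)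
  open Relation.Binary.Reasoning.Setoid setoid

  -- The private cycFuel, recovered by unification.
  mutual
    Φ-fuel : ℕ → ℕ → Poly
    Φ-fuel = _

    Φ-suc : ∀ k → Φ (suc k) ≡ divₚ (mono 1ℤ (suc k) -ₚ oneₚ)
      (prodₚ (map (Φ-fuel k) (filter (_∣? suc k) (map suc (upTo k)))))
    Φ-suc k = ≡.refl

  filtered : ∀ {P : ℕ → Set} n m → (∀ d → 0 < d → d ≤ m → P d) → All P (filter (_∣? n) (map suc (upTo m)))
  filtered n m h = All.filter⁺ (_∣? n) (All.map⁺ (All.applyUpTo⁺₁ (λ i → i) m (λ i<m → h _ (s≤s z≤n) i<m)))

  -- The recursion visits only proper divisors, so each level lowers the argument by at least one
  -- and fuel n already suffices.
  Φ-fuel-stable : ∀ f g n → 0 < n → n ≤ f → n ≤ g → Φ-fuel f n ≡ Φ-fuel g n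
  Φ-fuel-stable (suc f) (suc g) (suc n) _ (s≤s n≤f) (s≤s n≤g) =
    ≡.cong (λ ps → divₚ (mono 1ℤ (suc n) -ₚ oneₚ) (prodₚ ps))
      (List.map-cong-local (filtered (suc n) n (λ d 0<d d≤n →
        Φ-fuel-stable f g d 0<d (ℕ.≤-trans d≤n n≤f) (ℕ.≤-trans d≤n n≤g))))

  factor : ℕ → ℕ → Poly
  factor n d with d ∣? n
  ... | yes _ = Φ d
  ... | no _ = oneₚ

  factor-∣ : ∀ n d → d ∣ n → factor n d ≡ Φ d
  factor-∣ n d d∣n with d ∣? n
  ... | yes _ = ≡.refl
  ... | no d∤n = contradiction d∣n d∤n

  factor-∤ : ∀ n d → ¬ (d ∣ n) → factor n d ≡ oneₚ
  factor-∤ n d d∤n with d ∣? n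
  ... | yes d∣n = contradiction d∣n d∤n
  ... | no _ = ≡.refl

  -- F n m is the product of Φ d over the divisors d ≤ m of n.
  F : ℕ → ℕ → Poly
  F n zero = oneₚ
  F n (suc m) = F n m *ₚ factor n (suc m)

  prodₚ-∷ʳ : ∀ ps p → prodₚ (ps ++ [ p ]) ≃ prodₚ ps *ₚ p
  prodₚ-∷ʳ [] p = *-comm p oneₚ
  prodₚ-∷ʳ (r ∷ ps) p = trans (*-congʳ r (prodₚ-∷ʳ ps p)) (sym (*-assoc r (prodₚ ps) p))

  prodₚ-filter : ∀ n m → prodₚ (map Φ (filter (_∣? n) (map suc (upTo m)))) ≃ F n m
  prodₚ-filter n zero = refl
  prodₚ-filter n (suc m) = trans (reflexive (≡.cong (λ ds → prodₚ (map Φ ds)) split)) (last (suc m ∣? n))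
    where
    ds = filter (_∣? n) (map suc (upTo m))
    split : filter (_∣? n) (map suc (upTo (suc m))) ≡ ds ++ filter (_∣? n) [ suc m ]
    split = ≡.trans (≡.cong (λ is → filter (_∣? n) (map suc is)) (≡.sym (List.applyUpTo-∷ʳ (λ i → i) m)))
      (≡.trans (≡.cong (filter (_∣? n)) (List.map-++ suc (upTo m) [ m ]))
        (List.filter-++ (_∣? n) (map suc (upTo m)) [ suc m ]))
    last : Dec (suc m ∣ n) → prodₚ (map Φ (ds ++ filter (_∣? n) [ suc m ])) ≃ F n m *ₚ factor n (suc m)
    last (yes d∣n) = begin
      prodₚ (map Φ (ds ++ filter (_∣? n) [ suc m ]))
        ≡⟨ ≡.cong (λ es → prodₚ (map Φ (ds ++ es))) (List.filter-accept (_∣? n) d∣n) ⟩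
      prodₚ (map Φ (ds ++ [ suc m ]))
        ≡⟨ ≡.cong prodₚ (List.map-++ Φ ds [ suc m ]) ⟩
      prodₚ (map Φ ds ++ [ Φ (suc m) ])
        ≈⟨ prodₚ-∷ʳ (map Φ ds) (Φ (suc m)) ⟩
      prodₚ (map Φ ds) *ₚ Φ (suc m)
        ≈⟨ *-cong (prodₚ-filter n m) (reflexive (≡.sym (factor-∣ n (suc m) d∣n))) ⟩
      F n m *ₚ factor n (suc m) ∎
    last (no d∤n) = begin
      prodₚ (map Φ (ds ++ filter (_∣? n) [ suc m ]))
        ≡⟨ ≡.cong (λ es → prodₚ (map Φ (ds ++ es))) (List.filter-reject (_∣? n) d∤n) ⟩
      prodₚ (map Φ (ds ++ []))
        ≡⟨ ≡.cong (λ es → prodₚ (map Φ es)) (List.++-identityʳ ds) ⟩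
      prodₚ (map Φ ds)
        ≈⟨ prodₚ-filter n m ⟩
      F n m
        ≈⟨ *-identityʳ (F n m) ⟨
      F n m *ₚ oneₚ
        ≡⟨ ≡.cong (F n m *ₚ_) (factor-∤ n (suc m) d∤n) ⟨
      F n m *ₚ factor n (suc m) ∎

  W : ℕ → Poly
  W n = q ^ n -ₚ oneₚ

  mono1≃ : ∀ n → mono 1ℤ n ≃ q ^ n
  mono1≃ n = trans (mono≃ 1ℤ n) (*-identityˡ (q ^ n))

  monic-W : ∀ n → 0 < n → Monic n (W n)
  monic-W n 0<n = monic-resp {p = mono 1ℤ n -ₚ oneₚ} (+-congʳ (mono1≃ n)) (monic-q^n-1 n 0<n)

  W-multiple : ∀ k d → W (k ℕ.* d) ≃ W d *ₚ geometric (q ^ d) k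
  W-multiple k d = trans
    (+-congʳ (trans (^-congʳ q (ℕ.*-comm k d)) (sym (^-assocʳ q d k)))) (x^k-1 (q ^ d) k)

  W-+ : ∀ m n → W (m ℕ.+ n) ≃ W m +ₚ q ^ m *ₚ W n
  W-+ m n = trans (+-congʳ (^-homo-* q m n))
    (solve 2 (λ a b → a :* b :- con 1ℤ := (a :- con 1ℤ) :+ a :* (b :- con 1ℤ)) refl (q ^ m) (q ^ n))

  -- The induction invariant. Coprimality below n yields the product formula at n, which yields
  -- coprimality at n; monicity makes `divₚ` exact and removes the integer constants of Bézout
  -- relations.
  record IsCyclotomic (n : ℕ) : Set where
    field
      degree : ℕ
      monic : Monic degree (Φ n)
      product : F n (n ∸ 1) *ₚ Φ n ≃ W n
      coprime-W : ∀ d → 0 < d → d < n → Coprime (W d) (Φ n)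

  F-full : ∀ {n} → 0 < n → IsCyclotomic n → F n n ≃ W n
  F-full {suc n} _ c = trans (*-congʳ (F (suc n) n) (reflexive (factor-∣ (suc n) (suc n) ∣-refl))) (IsCyclotomic.product c)

  F-beyond : ∀ n t → 0 < n → F n (t ℕ.+ n) ≃ F n n
  F-beyond n zero _ = refl
  F-beyond (suc n) (suc t) 0<n = trans
    (trans (*-congʳ (F (suc n) (t ℕ.+ suc n)) (reflexive (factor-∤ (suc n) (suc (t ℕ.+ suc n)) λ d∣n →
      ℕ.<⇒≱ (s≤s (ℕ.m≤n+m (suc n) t)) (∣⇒≤ d∣n)))) (*-identityʳ _))
    (F-beyond (suc n) t 0<n)

  F-split : ∀ {n e} → e ∣ n → ∀ m → Σ Poly λ r → F n m ≃ F e m *ₚ r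
  F-split e∣n zero = oneₚ , sym (*-identityʳ oneₚ)
  F-split {n} {e} e∣n (suc m) = extend (F-split e∣n m) (suc m ∣? e)
    where
    extend : (Σ Poly λ r → F n m ≃ F e m *ₚ r) → Dec (suc m ∣ e) → Σ Poly λ r → F n (suc m) ≃ F e (suc m) *ₚ r
    extend (r , h) (yes d∣e) = r , (begin
      F n m *ₚ factor n (suc m)
        ≈⟨ *-cong h (reflexive (≡.trans (factor-∣ n (suc m) (∣-trans d∣e e∣n)) (≡.sym (factor-∣ e (suc m) d∣e)))) ⟩
      (F e m *ₚ r) *ₚ factor e (suc m)
        ≈⟨ solve 3 (λ a r b → a :* r :* b := a :* b :* r) refl (F e m) r (factor e (suc m)) ⟩
      F e m *ₚ factor e (suc m) *ₚ r ∎)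
    extend (r , h) (no d∤e) = r *ₚ factor n (suc m) , (begin
      F n m *ₚ factor n (suc m)
        ≈⟨ *-cong h refl ⟩
      (F e m *ₚ r) *ₚ factor n (suc m)
        ≈⟨ solve 3 (λ a r b → a :* r :* b := a :* con 1ℤ :* (r :* b)) refl (F e m) r (factor n (suc m)) ⟩
      F e m *ₚ oneₚ *ₚ (r *ₚ factor n (suc m))
        ≡⟨ ≡.cong (λ z → F e m *ₚ z *ₚ (r *ₚ factor n (suc m))) (factor-∤ e (suc m) d∤e) ⟨
      F e m *ₚ factor e (suc m) *ₚ (r *ₚ factor n (suc m)) ∎)

  module Step (n′ : ℕ) (ih : ∀ {d} → d < suc n′ → 0 < d → IsCyclotomic d) where
    private
      n = suc n′

    Φ∣W : ∀ d → 0 < d → (d<n : d < n) → Φ d *ₚ F d (d ∸ 1) ≃ W d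
    Φ∣W d 0<d d<n = trans (*-comm (Φ d) (F d (d ∸ 1))) (IsCyclotomic.product (ih d<n 0<d))

    -- Each factor Φ_d of the product has d < j and divides q^d - 1, which is coprime to Φ_j by
    -- induction.
    coprime-F : ∀ m j → m < j → j < n → Coprime (F n m) (Φ j)
    coprime-F zero j _ _ = coprime-1 (Φ j)
    coprime-F (suc m) j m<j j<n = coprime-* (coprime-F m j (ℕ.<-trans (ℕ.n<1+n m) m<j) j<n) factor-coprime
      where
      factor-coprime : Coprime (factor n (suc m)) (Φ j)
      factor-coprime with suc m ∣? n
      ... | no _ = coprime-1 (Φ j)
      ... | yes _ = coprime-factorˡ (coprime-respˡ (sym (Φ∣W (suc m) (s≤s z≤n) (ℕ.<-trans m<j j<n)))
        (IsCyclotomic.coprime-W (ih j<n (ℕ.<-trans (s≤s z≤n) m<j)) (suc m) (s≤s z≤n) m<j))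

    monic-F : ∀ m → m < n → Σ ℕ λ k → Monic k (F n m)
    monic-F zero _ = 0 , ≡.refl , λ { (suc i) _ → ≡.refl }
    monic-F (suc m) m<n with monic-F m (ℕ.<-trans (ℕ.n<1+n m) m<n) | suc m ∣? n
    ... | k , hk | no _ = k , monic-resp {p = F n m} (sym (*-identityʳ (F n m))) hk
    ... | k , hk | yes _ = k ℕ.+ IsCyclotomic.degree c , monic-* {p = F n m} {Φ (suc m)} hk (IsCyclotomic.monic c)
      where c = ih m<n (s≤s z≤n)

    -- For a divisor d = m + 1 of n, Φ_d divides q^n - 1 = F x and is coprime to F, so it divides c
    -- x for some nonzero integer c; as Φ_d is monic, it divides x.
    F∣W : ∀ m → m < n → Σ Poly λ x → W n ≃ F n m *ₚ x
    F∣W zero _ = W n , sym (*-identityˡ (W n))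
    F∣W (suc m) m<n with F∣W m (ℕ.<-trans (ℕ.n<1+n m) m<n) | suc m ∣? n
    ... | x , h | no _ = x , trans h (*-cong (sym (*-identityʳ (F n m))) refl)
    ... | x , h | yes (divides k n≡) = proj₁ divided , (begin
      W n                                       ≈⟨ h ⟩
      F n m *ₚ x                                ≈⟨ *-congʳ (F n m) (proj₂ divided) ⟩
      F n m *ₚ (φ *ₚ proj₁ divided)             ≈⟨ *-assoc (F n m) φ (proj₁ divided) ⟨
      F n m *ₚ φ *ₚ proj₁ divided               ∎)
      where
      d = suc m
      φ = Φ d
      g = geometric (q ^ d) k
      open Coprime (coprime-F m d (ℕ.n<1+n m) m<n) renaming (k to c)
      eq : ⟦ c ⟧ *ₚ x ≃ φ *ₚ (u *ₚ (F d m *ₚ g) +ₚ v *ₚ x)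
      eq = begin
        ⟦ c ⟧ *ₚ x
          ≈⟨ *-cong (sym bézout) refl ⟩
        (u *ₚ F n m +ₚ v *ₚ φ) *ₚ x
          ≈⟨ solve 5 (λ u f v φ x → (u :* f :+ v :* φ) :* x := u :* (f :* x) :+ v :* φ :* x) refl u (F n m) v φ x ⟩
        u *ₚ (F n m *ₚ x) +ₚ v *ₚ φ *ₚ x
          ≈⟨ +-congʳ (*-congʳ u (trans (sym h) (trans (reflexive (≡.cong W n≡))
               (trans (W-multiple k d) (*-cong (sym (Φ∣W d (s≤s z≤n) m<n)) refl))))) ⟩
        u *ₚ (φ *ₚ F d m *ₚ g) +ₚ v *ₚ φ *ₚ x
          ≈⟨ solve 6 (λ u φ f g v x → u :* (φ :* f :* g) :+ v :* φ :* x := φ :* (u :* (f :* g) :+ v :* x)) refl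
               u φ (F d m) g v x ⟩
        φ *ₚ (u *ₚ (F d m *ₚ g) +ₚ v *ₚ x) ∎
      divided : Σ Poly λ z → x ≃ φ *ₚ z
      divided = monic-divides {d = φ} (IsCyclotomic.monic (ih m<n (s≤s z≤n))) k≢0 eq

    n′<n : n′ < n
    n′<n = ℕ.n<1+n n′

    Φ-product : F n n′ *ₚ Φ n ≃ W n
    Φ-product with F∣W n′ n′<n | monic-F n′ n′<n
    ... | x , h | k , hk = trans (*-congʳ (F n n′) Φ≃x) (sym h)
      where
      ps = map (Φ-fuel n′) (filter (_∣? n) (map suc (upTo n′)))
      ps≃F : prodₚ ps ≃ F n n′
      ps≃F = trans (reflexive (≡.cong prodₚ (List.map-cong-local (filtered n n′ (λ d 0<d d≤n′ →
        Φ-fuel-stable n′ d d 0<d d≤n′ ℕ.≤-refl))))) (prodₚ-filter n n′)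
      Φ≃x : Φ n ≃ x
      Φ≃x = divₚ-exact {d = prodₚ ps} (monic-resp {p = F n n′} (sym ps≃F) hk)
        (trans (+-congʳ (mono1≃ n)) (trans h (*-cong (sym ps≃F) refl)))

    -- The quotient of q^n - 1 by q^e - 1 is a geometric sum, coprime to q^e - 1. The divisors of e
    -- account for all of q^e - 1 in the product formula, so Φ_n is a factor of that quotient.
    Φ-coprime-divisor : ∀ e → 0 < e → e < n → e ∣ n → Coprime (W e) (Φ n)
    Φ-coprime-divisor e 0<e e<n e∣n@(divides k n≡) with F-split e∣n n′
    ... | r , h = coprime-sym (coprime-factorˡ (coprime-respˡ K≃ (coprime-sym
        (geometric-coprime (q ^ e) k 0<k))))
      where
      K = geometric (q ^ e) k
      0<k : 0 < k
      0<k = ℕ.n≢0⇒n>0 λ { ≡.refl → contradiction n≡ λ () }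
      n′≡ : n′ ≡ (n′ ∸ e) ℕ.+ e
      n′≡ = ≡.sym (ℕ.m∸n+n≡m (ℕ.s≤s⁻¹ e<n))
      F≃W : F e n′ ≃ W e
      F≃W = trans (reflexive (≡.cong (F e) n′≡)) (trans (F-beyond e (n′ ∸ e) 0<e) (F-full 0<e (ih e<n 0<e)))
      K≃ : K ≃ Φ n *ₚ r
      K≃ = monic-cancel {d = W e} (monic-W e 0<e) (begin
        W e *ₚ K                   ≈⟨ W-multiple k e ⟨
        W (k ℕ.* e)                ≡⟨ ≡.cong W n≡ ⟨
        W n                        ≈⟨ Φ-product ⟨
        F n n′ *ₚ Φ n              ≈⟨ *-cong (trans h (*-cong F≃W refl)) refl ⟩
        W e *ₚ r *ₚ Φ n            ≈⟨ solve 3 (λ w r φ → w :* r :* φ := w :* (φ :* r)) refl (W e) r (Φ n) ⟩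
        W e *ₚ (Φ n *ₚ r)          ∎)

    -- Reduction to the gcd g of d and n: from g + y n = x d one gets W(xd) = W(g) + q^g W(yn), and
    -- Φ_n divides W(n). So W(g) lies in the ideal of W(d) and Φ_n; the other sign of Bézout's
    -- identity is symmetric.
    Φ-coprime : ∀ d → 0 < d → d < n → Coprime (W d) (Φ n)
    Φ-coprime d 0<d d<n with gcd d n | gcd-GCD d n | gcd[m,n]∣m d n | gcd[m,n]∣n d n
    ... | g | isGcd | g∣d | g∣n = go (Bézout.identity isGcd)
      where
      0<g : 0 < g
      0<g = ℕ.n≢0⇒n>0 λ { ≡.refl → contradiction (0∣⇒≡0 g∣n) λ () }
      g⊥Φ : Coprime (W g) (Φ n)
      g⊥Φ = Φ-coprime-divisor g 0<g (ℕ.≤-<-trans (∣⇒≤ ⦃ ℕ.>-nonZero 0<d ⦄ g∣d) d<n) g∣n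
      Wn : ∀ y → W (y ℕ.* n) ≃ geometric (q ^ n) y *ₚ F n n′ *ₚ Φ n
      Wn y = trans (W-multiple y n) (trans (*-cong (sym Φ-product) refl)
        (solve 3 (λ f φ g → f :* φ :* g := g :* f :* φ) refl (F n n′) (Φ n) (geometric (q ^ n) y)))
      Wd : ∀ x → W (x ℕ.* d) ≃ geometric (q ^ d) x *ₚ W d
      Wd x = trans (W-multiple x d) (*-comm (W d) (geometric (q ^ d) x))
      go : Bézout.Identity g d n → Coprime (W d) (Φ n)
      go (Bézout.+- x y eq) = coprime-ideal (geometric (q ^ d) x) (negₚ (q ^ g) *ₚ (geometric (q ^ n) y *ₚ F n n′))
        (coprime-respˡ (begin
          W g
            ≈⟨ solve 2 (λ a b → a := (a :+ b) :- b) refl (W g) (q ^ g *ₚ W (y ℕ.* n)) ⟩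
          (W g +ₚ q ^ g *ₚ W (y ℕ.* n)) -ₚ q ^ g *ₚ W (y ℕ.* n)
            ≈⟨ +-cong (trans (sym (W-+ g (y ℕ.* n))) (trans (reflexive (≡.cong W eq)) (Wd x)))
                 (-‿cong (*-congʳ (q ^ g) (Wn y))) ⟩
          geometric (q ^ d) x *ₚ W d -ₚ q ^ g *ₚ (geometric (q ^ n) y *ₚ F n n′ *ₚ Φ n)
            ≈⟨ solve 4 (λ a Q b φ → a :- Q :* (b :* φ) := a :+ :- Q :* b :* φ) refl _ (q ^ g) _ (Φ n) ⟩
          geometric (q ^ d) x *ₚ W d +ₚ negₚ (q ^ g) *ₚ (geometric (q ^ n) y *ₚ F n n′) *ₚ Φ n ∎) g⊥Φ)
      go (Bézout.-+ x y eq) = coprime-ideal (negₚ (q ^ g) *ₚ geometric (q ^ d) x) (geometric (q ^ n) y *ₚ F n n′)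
        (coprime-respˡ (begin
          W g
            ≈⟨ solve 2 (λ a b → a := (a :+ b) :- b) refl (W g) (q ^ g *ₚ W (x ℕ.* d)) ⟩
          (W g +ₚ q ^ g *ₚ W (x ℕ.* d)) -ₚ q ^ g *ₚ W (x ℕ.* d)
            ≈⟨ +-cong (trans (sym (W-+ g (x ℕ.* d))) (trans (reflexive (≡.cong W eq)) (Wn y)))
                 (-‿cong (*-congʳ (q ^ g) (Wd x))) ⟩
          geometric (q ^ n) y *ₚ F n n′ *ₚ Φ n -ₚ q ^ g *ₚ (geometric (q ^ d) x *ₚ W d)
            ≈⟨ solve 4 (λ a Q b w → a :- Q :* (b :* w) := :- Q :* b :* w :+ a) refl _ (q ^ g) _ (W d) ⟩
          negₚ (q ^ g) *ₚ geometric (q ^ d) x *ₚ W d +ₚ geometric (q ^ n) y *ₚ F n n′ *ₚ Φ n ∎) g⊥Φ)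

    Φ-monic : Σ ℕ λ k → Monic k (Φ n)
    Φ-monic = monic-quotient {d = F n n′} (monic-resp {p = W n} (sym Φ-product) (monic-W n (s≤s z≤n)))
      (proj₂ (monic-F n′ n′<n))

    isCyclotomic : IsCyclotomic n
    isCyclotomic = record
      { degree = proj₁ Φ-monic ; monic = proj₂ Φ-monic ; product = Φ-product ; coprime-W = Φ-coprime }

  isCyclotomic : ∀ n → 0 < n → IsCyclotomic n
  isCyclotomic = <-rec _ step
    where
    step : ∀ n → (∀ {d} → d < n → 0 < d → IsCyclotomic d) → 0 < n → IsCyclotomic n
    step (suc n) ih _ = Step.isCyclotomic n ih

-- Reindexing a sum over j ≤ n/2 as a diagonal sum.

module HalvedSums {c ℓ} (R : CommutativeRing c ℓ) where
  open CommutativeRing R hiding (zero)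
  open DiagonalSums R
  open IntegerCoefficients.Solver R

  sum : ℕ → (ℕ → Carrier) → Carrier
  sum zero f = 0#
  sum (suc m) f = f 0 + sum m (λ i → f (suc i))

  sum-reverse : ∀ h (f : ℕ → Carrier) → sum (suc (suc h)) (λ i → f (suc h ∸ i)) ≈ f 0 + sum (suc h) (λ i → f (suc (h ∸ i)))
  sum-reverse zero f = solve 2 (λ a b → b :+ (a :+ con 0ℤ) := a :+ (b :+ con 0ℤ)) refl (f 0) (f 1)
  sum-reverse (suc h) f = trans (+-congˡ (sum-reverse h f))
    (solve 3 (λ a b c → a :+ (b :+ c) := b :+ (a :+ c)) refl (f (suc (suc h))) (f 0) _)

  -- The descending argument is forced by the given sum, where k = U - j increases. Lowering n by
  -- two removes the term j = 0 on both sides, which on the left is the last one and is brought to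
  -- the front first.
  sum≈∑ : ∀ n (f : ℕ → Carrier) → sum (suc (n / 2)) (λ i → f ((n / 2) ∸ i)) ≈ ∑ (λ j l → f j) n
  sum≈∑ zero f = +-identityʳ (f 0)
  sum≈∑ (suc zero) f = +-identityʳ (f 0)
  sum≈∑ (suc (suc n)) f = trans (reflexive (≡.cong (λ h → sum (suc h) (λ i → f (h ∸ i)))
      (m/n≡1+[m∸n]/n {suc (suc n)} {2} (s≤s (s≤s z≤n)))))
    (trans (sum-reverse (n / 2) f) (+-congˡ (sum≈∑ n (λ j → f (suc j)))))

-- Evaluation of integer polynomials and of θ_n.

module Evaluation {c ℓ} (R : CommutativeRing c ℓ) (x : CommutativeRing.Carrier R) where
  open CommutativeRing R hiding (zero)
  open IntegerCoefficients R
  open IntegerCoefficients.Solver R using (solve; _:=_; _:+_; _:*_; con)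
  open Algebra.Properties.Semiring.Exp semiring
  open ThetaSums R x using (theta)
  open Relation.Binary.Reasoning.Setoid setoid

  eval : Poly → Carrier
  eval [] = 0#
  eval (a ∷ p) = ⟦ a ⟧ + x * eval p

  eval-+ : ∀ p r → eval (p +ₚ r) ≈ eval p + eval r
  eval-+ [] r = sym (+-identityˡ _)
  eval-+ (a ∷ p) [] = sym (+-identityʳ _)
  eval-+ (a ∷ p) (b ∷ r) = trans (+-cong (+-homo a b) (*-congˡ (eval-+ p r)))
    (solve 5 (λ a b x p r → (a :+ b) :+ x :* (p :+ r) := (a :+ x :* p) :+ (b :+ x :* r)) refl _ _ x _ _)

  eval-mono : ∀ c e → eval (mono c e) ≈ ⟦ c ⟧ * x ^ e
  eval-mono c zero = solve 2 (λ c x → c :+ x :* con 0ℤ := c :* con 1ℤ) refl ⟦ c ⟧ x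
  eval-mono c (suc e) = trans (+-congˡ (*-congˡ (eval-mono c e)))
    (solve 3 (λ c x X → con 0ℤ :+ x :* (c :* X) := c :* (x :* X)) refl ⟦ c ⟧ x (x ^ e))

  ⟦sgn⟧ : ∀ m → ⟦ sgn m ⟧ ≈ (- 1#) ^ m
  ⟦sgn⟧ zero = refl
  ⟦sgn⟧ (suc m) = trans (*-homo (ℤ.- 1ℤ) (sgn m)) (*-congˡ (⟦sgn⟧ m))

  eval-sgn-mono : ∀ m e → eval (mono (sgn m) e) ≈ (- 1#) ^ m * x ^ e
  eval-sgn-mono m e = trans (eval-mono (sgn m) e) (*-congʳ (⟦sgn⟧ m))

  eval-thetaAux : ∀ m r → eval (thetaAux m r) ≈ theta m r
  eval-thetaAux m zero = trans (eval-+ (mono (sgn m) e) (mono (sgn m) (e ℕ.+ m)))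
    (+-cong (eval-sgn-mono m e) (eval-sgn-mono m (e ℕ.+ m)))
    where e = (m ℕ.* (3 ℕ.* m ∸ 1)) / 2
  eval-thetaAux m (suc zero) = eval-sgn-mono m ((m ℕ.* (3 ℕ.* m ℕ.+ 1)) / 2)
  eval-thetaAux m (suc (suc r)) = eval-sgn-mono (suc m) (((m ℕ.+ 1) ℕ.* (3 ℕ.* m ℕ.+ 2)) / 2)

-- The q-binomial fractions as Gaussian polynomials.

module QBinomials where
  open PolynomialRing
  open Degree
  open Cyclotomic using (prodₚ-∷ʳ; mono1≃)
  open CommutativeRing polyRing using (refl; sym; trans; reflexive; setoid; +-congˡ; -‿cong)
  open IntegerCoefficients.Solver polyRing using (solve; _:=_; _:*_)
  open Algebra.Properties.Semiring.Exp (CommutativeRing.semiring polyRing)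
  open Relation.Binary.Reasoning.Setoid setoid

  qbin-unfold : ∀ s {n m} → m ≤ n → qbin s n m ≡
    (prodₚ (map (λ j → oneₚ -ₚ mono 1ℤ (s ℕ.* (n ∸ j))) (upTo m)) /ₚ
     prodₚ (map (λ j → oneₚ -ₚ mono 1ℤ (s ℕ.* suc j)) (upTo m)))
  qbin-unfold s {n} {m} m≤n with m ℕ.≤ᵇ n | ℕ.≤⇒≤ᵇ m≤n
  ... | Data.Bool.true | _ = ≡.refl

  module _ (s : ℕ) (x : Poly) (x^ : ∀ e → mono 1ℤ (s ℕ.* e) ≃ x ^ e) where
    open GaussianBinomials polyRing x

    d≃ : ∀ e → oneₚ -ₚ mono 1ℤ (s ℕ.* e) ≃ d e
    d≃ e = +-congˡ {x = oneₚ} (-‿cong (x^ e))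

    bottom : ℕ → Poly
    bottom m = prodₚ (applyUpTo (λ j → oneₚ -ₚ mono 1ℤ (s ℕ.* suc j)) m)

    bottom-suc : ∀ m → bottom (suc m) ≃ bottom m *ₚ d (suc m)
    bottom-suc m = trans (reflexive (≡.cong prodₚ (≡.sym (List.applyUpTo-∷ʳ (λ j → oneₚ -ₚ mono 1ℤ (s ℕ.* suc j)) m))))
      (trans (prodₚ-∷ʳ (applyUpTo _ m) _) (*-congʳ (bottom m) (d≃ (suc m))))

    -- The numerator loses its first factor and the denominator its last one; absorption is what
    -- matches the two.
    top≃ : ∀ m l → prodₚ (applyUpTo (λ j → oneₚ -ₚ mono 1ℤ (s ℕ.* ((m ℕ.+ l) ∸ j))) m) ≃ gauss m l *ₚ bottom m
    top≃ zero l = sym (*-identityˡ oneₚ)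
    top≃ (suc m) l = begin
      (oneₚ -ₚ mono 1ℤ (s ℕ.* (suc m ℕ.+ l))) *ₚ prodₚ (applyUpTo (λ j → oneₚ -ₚ mono 1ℤ (s ℕ.* ((m ℕ.+ l) ∸ j))) m)
        ≈⟨ *-cong (d≃ (suc m ℕ.+ l)) (top≃ m l) ⟩
      d (suc m ℕ.+ l) *ₚ (gauss m l *ₚ bottom m)
        ≈⟨ solve 3 (λ d g b → d :* (g :* b) := (g :* d) :* b) refl (d (suc m ℕ.+ l)) (gauss m l) (bottom m) ⟩
      (gauss m l *ₚ d (suc m ℕ.+ l)) *ₚ bottom m
        ≈⟨ *-cong {r = bottom m} (gauss-sucˡ m l) refl ⟨
      (gauss (suc m) l *ₚ d (suc m)) *ₚ bottom m
        ≈⟨ solve 3 (λ d g b → (g :* d) :* b := g :* (b :* d)) refl (d (suc m)) (gauss (suc m) l) (bottom m) ⟩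
      gauss (suc m) l *ₚ (bottom m *ₚ d (suc m))
        ≈⟨ *-congʳ (gauss (suc m) l) (bottom-suc m) ⟨
      gauss (suc m) l *ₚ bottom (suc m) ∎

    qbin≃ : ∀ {n} m l → m ℕ.+ l ≡ n → num (qbin s n m) ≃ gauss m l *ₚ den (qbin s n m)
    qbin≃ m l ≡.refl = ≡.subst (λ f → num f ≃ gauss m l *ₚ den f) (≡.sym (qbin-unfold s (ℕ.m≤m+n m l)))
      (trans (reflexive (≡.cong prodₚ (List.map-upTo _ m)))
        (trans (top≃ m l) (*-congʳ (gauss m l) (reflexive (≡.cong prodₚ (≡.sym (List.map-upTo _ m)))))))

  qbinom≃ : ∀ {n} m l → m ℕ.+ l ≡ n → num (qbinom n m) ≃ GaussianBinomials.gauss polyRing q m l *ₚ den (qbinom n m)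
  qbinom≃ = qbin≃ 1 q (λ e → trans (reflexive (≡.cong (mono 1ℤ) (ℕ.*-identityˡ e))) (mono1≃ e))

  qbinom²≃ : ∀ {n} m l → m ℕ.+ l ≡ n →
    num (qbinom² n m) ≃ GaussianBinomials.gauss polyRing (q *ₚ q) m l *ₚ den (qbinom² n m)
  qbinom²≃ = qbin≃ 2 (q *ₚ q) (λ e → trans (mono1≃ (2 ℕ.* e)) (trans (sym (^-assocʳ q 2 e))
    (^-congˡ e (*-congʳ q (trans (*-comm q oneₚ) (*-identityˡ q))))))

-- The local ring at Φ_n as a ring with a near root of unity.

module LocalAtΦ (n′ : ℕ) where
  n : ℕ
  n = suc n′

  open PolynomialRing
  open Degree using (q; mono≃; reverse-∷)
  open Cyclotomic using (F; module IsCyclotomic; mono1≃)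
  open Coprimality polyRing
  open LocalQuotient polyRing (Φ n) public
  open IsCyclotomic (Cyclotomic.isCyclotomic n (s≤s z≤n))
  open CommutativeRing polyRing using (refl; sym; trans; reflexive; +-congˡ; -‿cong)
  open IntegerCoefficients.Solver polyRing using (solve; _:=_; _:+_; _:*_; _:-_; :-_; con)
  open Algebra.Properties.Semiring.Exp (CommutativeRing.semiring polyRing)
  module L where
    open CommutativeRing localRing public
    open Algebra.Properties.Semiring.Exp semiring public using (_^_)
    open IntegerCoefficients localRing public using (⟦_⟧)
    open IntegerCoefficients.Solver localRing public using (solve; _:=_; _:+_; _:*_)
  open HalvedSums localRing using (sum)

  private
    w = oneₚ -ₚ q ^ n
    φ = Φ n

  w≃ : w ≃ negₚ (F n n′ *ₚ φ)
  w≃ = trans (solve 1 (λ a → con 1ℤ :- a := :- (a :- con 1ℤ)) refl (q ^ n)) (-‿cong (sym product))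

  w*w∼0 : w *ₚ w ∼ []
  w*w∼0 = ∼-trans (≈⇒∼ (trans (*-cong w≃ w≃)
    (solve 2 (λ f φ → (:- (f :* φ)) :* (:- (f :* φ)) := φ :* φ :* (f :* f)) refl (F n n′) φ))) (φ*φ∼0 (F n n′ *ₚ F n n′))

  -- q^n = 1 - w, and 1 + w is the inverse of 1 - w modulo w².
  q⁻¹ : Poly
  q⁻¹ = q ^ n′ *ₚ (oneₚ +ₚ w)

  q*q⁻¹∼1 : q *ₚ q⁻¹ ∼ oneₚ
  q*q⁻¹∼1 = ∼-trans
    (≈⇒∼ (solve 2 (λ q a → q :* (a :* (con 1ℤ :+ (con 1ℤ :- q :* a))) :=
      con 1ℤ :- (con 1ℤ :- q :* a) :* (con 1ℤ :- q :* a)) refl q (q ^ n′)))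
    (L.+-congˡ {oneₚ} (L.-‿cong w*w∼0))

  -- The Bézout relation is q^(n - 1) q - (q^n - 1) = 1, with q^n - 1 a multiple of Φ_n.
  q⊥Φ : Coprime q φ
  q⊥Φ = coprime {u = q ^ n′} {v = negₚ (F n n′)} {k = 1ℤ} (λ ())
    (trans (solve 4 (λ q a f φ → a :* q :+ :- f :* φ := q :* a :- f :* φ) refl q (q ^ n′) (F n n′) φ)
    (trans (+-congˡ {x = q ^ n} (-‿cong product)) (solve 1 (λ a → a :- (a :- con 1ℤ) := con 1ℤ) refl (q ^ n))))

  1-q^i⊥Φ : ∀ i → 0 < i → i < n → Coprime (oneₚ -ₚ q ^ i) φ
  1-q^i⊥Φ i 0<i i<n = coprime-respˡ (solve 1 (λ a → :- (a :- con 1ℤ) := con 1ℤ :- a) refl (q ^ i))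
    (coprime-neg (coprime-W i 0<i i<n))

  -- Both rings share their operations, yet each has its own power function by recursion on the
  -- exponent; for a variable exponent they agree only by induction.
  ^≡ : ∀ x k → x L.^ k ≡ x ^ k
  ^≡ x zero = ≡.refl
  ^≡ x (suc k) = ≡.cong (x *ₚ_) (^≡ x k)

  gauss≡ : ∀ x k l → GaussianBinomials.gauss localRing x k l ≡ GaussianBinomials.gauss polyRing x k l
  gauss≡ x zero l = ≡.refl
  gauss≡ x (suc k) zero = ≡.refl
  gauss≡ x (suc k) (suc l) = ≡.cong₂ _+ₚ_ (gauss≡ x k (suc l))
    (≡.cong₂ _*ₚ_ (^≡ x (suc k)) (gauss≡ x (suc k) l))

  root : RootOfUnity localRing
  root = record
    { q = q
    ; p = q⁻¹
    ; q*p≈1 = q*q⁻¹∼1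
    ; n = n
    ; w*w≈0 = ≡.subst (λ a → (oneₚ -ₚ a) *ₚ (oneₚ -ₚ a) ∼ []) (≡.sym (^≡ q n)) w*w∼0
    ; cancel = λ i 0<i i<n → ∼-cancel (≡.subst (λ a → Coprime (oneₚ -ₚ a) φ) (≡.sym (^≡ q i)) (1-q^i⊥Φ i 0<i i<n))
    }

  module Local = Supercongruence root

  ⟦⟧∼const : ∀ c → L.⟦ c ⟧ ∼ constₚ c
  ⟦⟧∼const (+ k) = natural k
    where
    open Algebra.Properties.Semiring.Mult.TCOptimised L.semiring using (_×_; 1+×)
    natural : ∀ k → k × oneₚ ∼ constₚ (+ k)
    natural zero = ≈⇒∼ (sym 0∷[])
    natural (suc k) = ∼-trans (1+× k oneₚ) (L.+-congˡ {oneₚ} (natural k))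
  ⟦⟧∼const -[1+ k ] = L.-‿cong (⟦⟧∼const (+ suc k))

  open Evaluation localRing q⁻¹ public

  -- Reversal is q^(L - 1) r(1/q) for a list of length L. The extra factor q avoids the exponent L -
  -- 1, so the empty list fits in; it is cancelled afterwards because q is coprime to Φ_n.
  q*reverse : ∀ r → q *ₚ reverse r ∼ q ^ length r *ₚ eval r
  q*reverse [] = ≈⇒∼ (trans (*-zeroʳ q) (sym (*-identityˡ [])))
  q*reverse (a ∷ r) = begin
    q *ₚ reverse (a ∷ r)
      ≈⟨ ≈⇒∼ (*-congʳ q (trans (reverse-∷ a r) (+-congˡ (mono≃ a (length r))))) ⟩
    q *ₚ (reverse r +ₚ constₚ a *ₚ Q)
      ≈⟨ ≈⇒∼ (solve 4 (λ q r a Q → q :* (r :+ a :* Q) := q :* r :+ a :* (q :* Q)) refl q (reverse r) (constₚ a) Q) ⟩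
    q *ₚ reverse r +ₚ constₚ a *ₚ (q *ₚ Q)
      ≈⟨ L.+-cong (q*reverse r) (L.*-congʳ (∼-sym (⟦⟧∼const a))) ⟩
    Q *ₚ eval r +ₚ L.⟦ a ⟧ *ₚ (q *ₚ Q)
      ≈⟨ L.+-congʳ (L.trans (L.sym (L.*-identityˡ (Q *ₚ eval r))) (L.*-congʳ (∼-sym q*q⁻¹∼1))) ⟩
    (q *ₚ q⁻¹) *ₚ (Q *ₚ eval r) +ₚ L.⟦ a ⟧ *ₚ (q *ₚ Q)
      ≈⟨ L.solve 5 (λ q p Q e a → (q L.:* p) L.:* (Q L.:* e) L.:+ a L.:* (q L.:* Q) L.:=
           (q L.:* Q) L.:* (a L.:+ p L.:* e)) L.refl q q⁻¹ Q (eval r) L.⟦ a ⟧ ⟩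
    (q *ₚ Q) *ₚ (L.⟦ a ⟧ +ₚ q⁻¹ *ₚ eval r) ∎
    where
    open Relation.Binary.Reasoning.Setoid L.setoid
    Q = q ^ length r

  FracValue : Frac → Poly → Set
  FracValue f x = Value (num f) (den f) x

  atInv-value : ∀ r → FracValue (atInv r) (eval r)
  atInv-value [] = value-exact refl
  atInv-value (a ∷ r) = value-local (coprime-respˡ (sym (mono1≃ (length r))) (coprime-^ (length r) q⊥Φ))
    (∼-cancel q⊥Φ (∼-trans (q*reverse (a ∷ r)) (≈⇒∼ (trans
      (solve 3 (λ q Q e → q :* Q :* e := q :* (e :* Q)) refl q (q ^ length r) (eval (a ∷ r)))
      (*-congʳ q (*-congʳ (eval (a ∷ r)) (sym (mono1≃ (length r)))))))))

  polyF-value : ∀ r x → r ≃ x → FracValue (polyF r) x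
  polyF-value r x r≃x = value-exact (trans r≃x (trans (sym (*-identityˡ x)) (*-comm oneₚ x)))

  const-sgn : ∀ k → constₚ (sgn k) ≃ negₚ oneₚ ^ k
  const-sgn zero = refl
  const-sgn (suc k) = trans (LongDivision.const-homo-* (ℤ.- 1ℤ) (sgn k)) (*-congʳ (negₚ oneₚ) (const-sgn k))

  sgn-mono-value : ∀ k e → FracValue (polyF (mono (sgn k) e)) (negₚ oneₚ L.^ k *ₚ q L.^ e)
  sgn-mono-value k e = polyF-value _ _ (trans (trans (mono≃ (sgn k) e) (*-cong {r = q ^ e} (const-sgn k) refl))
    (reflexive (≡.sym (≡.cong₂ _*ₚ_ (^≡ (negₚ oneₚ) k) (^≡ q e)))))

  qbinom-value : ∀ {m} k l → k ℕ.+ l ≡ m → FracValue (qbinom m k) (GaussianBinomials.gauss localRing q k l)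
  qbinom-value k l h = value-exact
    (trans (QBinomials.qbinom≃ k l h) (*-cong (reflexive (≡.sym (gauss≡ q k l))) refl))

  qbinom²-value : ∀ {m} k l → k ℕ.+ l ≡ m → FracValue (qbinom² m k) (GaussianBinomials.gauss localRing (q *ₚ q) k l)
  qbinom²-value k l h = value-exact
    (trans (QBinomials.qbinom²≃ k l h) (*-cong (reflexive (≡.sym (gauss≡ (q *ₚ q) k l))) refl))

  sumF-value : ∀ m f x → (∀ i → i < m → FracValue (f i) (x i)) → FracValue (sumF (applyUpTo f m)) (sum m x)
  sumF-value zero f x h = value-exact refl
  sumF-value (suc m) f x h = value-+ (h 0 (s≤s z≤n))
    (sumF-value m (λ i → f (suc i)) (λ i → x (suc i)) (λ i i<m → h (suc i) (s≤s i<m)))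

  congruent : ∀ A B {x y} → FracValue A x → FracValue B y → x ∼ y → CongΦ² n A B
  congruent A B {y = y} va vb x∼y = conclude (value-∼0 (value-sub va vb) (L.trans (L.+-congʳ x∼y) (L.-‿inverseʳ y)))
    where
    conclude : (Σ Poly λ P → Σ Poly λ Q → Coprime Q (Φ n) Data.Product.×
      (Q *ₚ num (A -f B) ≃ Φ n *ₚ Φ n *ₚ P *ₚ den (A -f B))) → CongΦ² n A B
    conclude (P , Q , coprime {u} {v} {k} k≢0 b , eq) =
      P , Q , (u , v , k , k≢0 , ≃⇒≈ₚ (trans b (Degree.⟦⟧≃const k))) , ≃⇒≈ₚ eq

-- The values of both sides and their comparison.

module Sides (a b n′ : ℕ) (b<a : b < a) where
  open LocalAtΦ n′
  open Degree using (q)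
  open Local.Fixed (a ∸ b) b
  open HalvedSums localRing using (sum; sum≈∑)
  open DiagonalSums localRing using (∑)

  private
    A = a ℕ.* n
    h = n / 2
    0<e : 0 < a ∸ b
    0<e = ℕ.m<n⇒0<n∸m b<a

    U≡ : A ∸ B ≡ U
    U≡ = ≡.sym (ℕ.*-distribʳ-∸ n a b)

    U+B : U ℕ.+ B ≡ A
    U+B = ≡.trans (≡.cong (ℕ._+ B) (≡.sym U≡)) (ℕ.m∸n+n≡m (ℕ.*-monoˡ-≤ n (ℕ.<⇒≤ b<a)))

    term : ℕ → Frac
    term k = polyF (mono (sgn k) (k ℕ.* k)) *f qbinom² A k *f qbinom (2 ℕ.* A ∸ 2 ℕ.* k) (A ∸ B ∸ k)

  term-value : ∀ k j → k ℕ.+ j ≡ U → FracValue (term k) (summand j)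
  term-value k j k+j≡U = ≡.subst (λ u → FracValue (term k) (summandAt u j))
    (≡.sym (≡.trans (≡.cong (_∸ j) (≡.sym k+j≡U)) (ℕ.m+n∸n≡m k j)))
    (value-* (value-* (sgn-mono-value k (k ℕ.* k)) (qbinom²-value k (B ℕ.+ j) k+B+j))
      (≡.subst₂ (λ m i → FracValue (qbinom m i) (GaussianBinomials.gauss localRing q j (2B ℕ.+ j))) top bottom
        (qbinom-value j (2B ℕ.+ j) ≡.refl)))
    where
    2B = (2 ℕ.* b) ℕ.* n
    k+B+j : k ℕ.+ (B ℕ.+ j) ≡ A
    k+B+j = ≡.trans (shuffle k B j) (≡.trans (≡.cong (ℕ._+ B) k+j≡U) U+B)
      where
      shuffle : ∀ k B j → k ℕ.+ (B ℕ.+ j) ≡ k ℕ.+ j ℕ.+ B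
      shuffle = solve-∀
    top : j ℕ.+ (2B ℕ.+ j) ≡ 2 ℕ.* A ∸ 2 ℕ.* k
    top = ≡.sym (≡.trans (≡.cong (λ m → 2 ℕ.* m ∸ 2 ℕ.* k) (≡.sym k+B+j))
      (≡.trans (≡.cong (_∸ 2 ℕ.* k) (expand k b n j)) (ℕ.m+n∸m≡n (2 ℕ.* k) (j ℕ.+ (2B ℕ.+ j)))))
      where
      expand : ∀ k b n j → 2 ℕ.* (k ℕ.+ (b ℕ.* n ℕ.+ j)) ≡ 2 ℕ.* k ℕ.+ (j ℕ.+ ((2 ℕ.* b) ℕ.* n ℕ.+ j))
      expand = solve-∀
    bottom : j ≡ A ∸ B ∸ k
    bottom = ≡.sym (≡.trans (≡.cong (_∸ k) (≡.trans U≡ (≡.sym k+j≡U))) (ℕ.m+n∸m≡n k j))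

  t0'-value : FracValue (t0' a b n) (sum (suc h) (λ i → summand (h ∸ i)))
  t0'-value = ≡.subst (λ m → FracValue (sumF (map (λ i → term (L ℕ.+ i)) (upTo (suc m)))) (sum (suc h) (λ i → summand (h ∸ i))))
    (≡.sym U∸L)
    (≡.subst (λ fs → FracValue (sumF fs) (sum (suc h) (λ i → summand (h ∸ i))))
      (≡.sym (List.map-upTo (λ i → term (L ℕ.+ i)) (suc h)))
      -- The i-th summand has k = L + i, hence j = h - i. Truncated subtraction is harmless in L
      -- since h ≤ n ≤ an - bn.
      (sumF-value (suc h) (λ i → term (L ℕ.+ i)) (λ i → summand (h ∸ i)) (λ { i (s≤s i≤h) →
        term-value (L ℕ.+ i) (h ∸ i) (≡.trans (ℕ.+-assoc L i (h ∸ i))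
          (≡.trans (≡.cong (L ℕ.+_) (ℕ.m+[n∸m]≡n i≤h)) L+h)) })))
    where
    L = A ∸ B ∸ h
    h≤U : h ≤ A ∸ B
    h≤U = ℕ.≤-trans (m/n≤m n 2) (≡.subst₂ _≤_ (ℕ.*-identityˡ n) (≡.sym U≡) (ℕ.*-monoˡ-≤ n 0<e))
    L+h : L ℕ.+ h ≡ U
    L+h = ≡.trans (ℕ.m∸n+n≡m h≤U) U≡
    U∸L : A ∸ B ∸ L ≡ h
    U∸L = ℕ.m∸[m∸n]≡n h≤U

  rhsAt : ℕ → Poly
  rhsAt u = negₚ oneₚ L.^ u *ₚ q L.^ (u ℕ.* u) *ₚ GaussianBinomials.gauss localRing (q *ₚ q) B u *ₚ
    (oneₚ -ₚ constₚ (+ (2 ℕ.* (a ∸ b))) *ₚ (oneₚ -ₚ eval (θ n)))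

  rhs-value : FracValue (rhs a b n) (rhsAt U)
  rhs-value = ≡.subst (λ u → FracValue (rhs a b n) (rhsAt u)) U≡
    (value-* (value-* (sgn-mono-value (A ∸ B) ((A ∸ B) ℕ.* (A ∸ B)))
      (qbinom²-value B (A ∸ B) (ℕ.m+[n∸m]≡n (ℕ.*-monoˡ-≤ n (ℕ.<⇒≤ b<a)))))
    (value-sub (polyF-value oneₚ oneₚ P.refl) (value-* (polyF-value C C P.refl)
      (value-sub (polyF-value oneₚ oneₚ P.refl) (atInv-value (θ n))))))
    where
    C = constₚ (+ (2 ℕ.* (a ∸ b)))
    module P = CommutativeRing PolynomialRing.polyRing

  sides-∼ : sum (suc h) (λ i → summand (h ∸ i)) ∼ rhsAt U
  sides-∼ = begin
    sum (suc h) (λ i → summand (h ∸ i))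
      ≈⟨ sum≈∑ n summand ⟩
    ∑ (λ j l → summand j) n
      ≈⟨ ∑-summand (s≤s z≤n) 0<e ⟩
    x₀ *ₚ (oneₚ -ₚ N *ₚ (oneₚ -ₚ ThetaSums.L localRing q⁻¹ n))
      -- The sum produces [an; an - bn] and the right side carries [an; bn], hence the symmetry of
      -- Gaussian binomials.
      ≈⟨ L.*-cong (L.*-congˡ {negₚ oneₚ L.^ U *ₚ q L.^ (U ℕ.* U)} (GaussianBinomials.gauss-comm localRing (q *ₚ q) U B))
           (L.+-congˡ {oneₚ} (L.-‿cong (L.*-cong N∼ (L.+-congˡ {oneₚ} (L.-‿cong L∼))))) ⟩
    rhsAt U ∎
    where
    open Relation.Binary.Reasoning.Setoid L.setoid
    N∼ : N ∼ constₚ (+ (2 ℕ.* (a ∸ b)))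
    N∼ = L.trans (Algebra.Properties.Semiring.Mult.TCOptimised.×ᵤ≈× L.semiring (2 ℕ.* (a ∸ b)) oneₚ)
      (⟦⟧∼const (+ (2 ℕ.* (a ∸ b))))
    L∼ : ThetaSums.L localRing q⁻¹ n ∼ eval (θ n)
    L∼ = L.trans (ThetaSums.L≈theta localRing q⁻¹ n (s≤s z≤n)) (L.sym (eval-thetaAux (n / 3) (n % 3)))

theorem1p6 : (a b n : ℕ) → 0 < b → b < a → 0 < n →
    CongΦ² n (t0' a b n) (rhs a b n)
theorem1p6 a b (suc n′) 0<b b<a 0<n = congruent (t0' a b (suc n′)) (rhs a b (suc n′)) t0'-value rhs-value sides-∼
  where
  open LocalAtΦ n′ using (congruent)
  open Sides a b n′ b<a
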